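{- There exist a constant function $T:\mathbb N\to\mathbb N$ and a linear function $S:\mathbb N\to\mathbb N$ such that the family $\Gamma(\mathcal G_{m,2})$ simulates the family $\Gamma(\mathcal G_m)$ in time $T$ and space $S$.
   Context: $\mathcal G$-networks. Let $Q$ be a finite alphabet and $\mathcal G$ a set of maps $g:Q^{i(g)}\to Q^{o(g)}$. A $\mathcal G$-network is an automata network $F:Q^V\to Q^V$ together with gates $g_1,\dots,g_n\in\mathcal G$ such that, with $I=\{(j,k):1\le k\le i(g_j)\}$ and $O=\{(j,k):1\le k\le o(g_j)\}$, $|V|=|I|=|O|$ and there are bijections $\alpha:I\to V$, $\beta:V\to O$ with no $(j,k)\in I$ satisfying $\beta(\alpha(j,k))=(j,k')$ for some $k'$, and for $v$ with $\beta(v)=(j,k)$: $F(x)_v=g_j(x_{\alpha(j,1)},\dots,x_{\alpha(j,i(g_j))})_k$. $\Gamma(\mathcal G)$ is the family of all $\mathcal G$-networks with their bounded-degree representation (interaction graph plus local transition tables). $\mathcal G_m$ consists of $\mathrm{AND},\mathrm{OR}:\{0,1\}^i\to\{0,1\}^o$ for $i,o\in\{1,2\}$ (every output of AND is the minimum of the inputs, every output of OR the maximum); $\mathcal G_{m,2}$ consists of those with $i=o=2$. Simulation. For each finite alphabet fix an injective $m_Q:Q\to\{0,1\}^{k_Q}$ extended cellwise; a circuit encoding of $F:Q^n\to Q^n$ is a Boolean circuit $C$ with $m_Q\circ F=C\circ m_Q$. A standard representation of a family is a language with a logarithmic-space algorithm producing a circuit encoding of a member from each word. A block embedding of $Q_F^{V_F}$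 into $Q_G^{V_G}$ is a partition $(D_i)_{i\in V_F}$ of $V_G$ with patterns $p_{i,q}\in Q_G^{D_i}$ injective in $q$, giving $\phi(x)|_{D_i}=p_{i,x_i}$; $G$ simulates $F$ via $\phi$ with time constant $T$ if $\phi\circ F=G^T\circ\phi$. A family $(\mathcal F,\mathcal F^*)$ simulates $(\mathcal H,\mathcal H^*)$ in time $T$ and space $S$ if a logarithmic-space Turing machine maps each word representing $H:Q_H^n\to Q_H^n$ to a word representing $F\in\mathcal F$ on $S(n)$ nodes, the number $T(n)$ and a block embedding via which $F$ simulates $H$ with time constant $T(n)$. -}

module Defs where

open import Data.Nat using (ℕ; zero; suc; _+_; _*_; _^_; _≤_; _<_; _⊓_; pred)
open import Data.Nat.Logarithm using (⌊log₂_⌋)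
import Data.Nat.Binary.Base as B
open import Data.Bool using (Bool; true; false; _∧_; _∨_)
open import Data.Fin using (Fin; toℕ)
import Data.Fin as Fin
open import Data.List using (List; []; _∷_; _++_; length; concat; map; tabulate)
open import Data.Bool.ListAction using (and; or)
open import Data.List.Membership.Propositional using (_∈_)
open import Data.List.Relation.Unary.All using (All)
open import Data.List.Relation.Unary.Unique.Propositional using (Unique)
open import Data.Maybe using (Maybe; just; nothing)
open import Data.Product using (Σ; _×_; _,_; proj₁; proj₂; ∃)
open import Function.Bundles using (_↔_; Inverse)
open import Relation.Binary.PropositionalEquality using (_≡_; _≢_)
open import Relation.Nullary using (¬_)
open import Data.Nat using (_≟_)
open import Relation.Nullary.Decidable using (does)

Network : Set → ℕ → Set
Network Q N = (Fin N → Q) → (Fin N → Q)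

iter : {A : Set} → (A → A) → ℕ → A → A
iter f zero    a = a
iter f (suc t) a = f (iter f t a)

record GateSet (Q : Set) : Set₁ where
  field
    Gate : Set
    ins  : Gate → ℕ
    outs : Gate → ℕ
    fn   : (g : Gate) → (Fin (ins g) → Q) → Fin (outs g) → Q

record IsGNetwork {Q : Set} (G : GateSet Q) {N : ℕ} (F : Network Q N) : Set where
  open GateSet G
  field
    n     : ℕ
    gates : Fin n → Gate
  I : Set
  I = Σ (Fin n) (λ j → Fin (ins (gates j)))
  O : Set
  O = Σ (Fin n) (λ j → Fin (outs (gates j)))
  field
    α      : I ↔ Fin N
    β      : Fin N ↔ O
    noLoop : ∀ (p : I) → proj₁ (Inverse.to β (Inverse.to α p)) ≢ proj₁ p
    dyn    : ∀ (x : Fin N → Q) (v : Fin N) →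
             F x v ≡ fn (gates (proj₁ (Inverse.to β v)))
                        (λ k → x (Inverse.to α (proj₁ (Inverse.to β v) , k)))
                        (proj₂ (Inverse.to β v))

data Kind : Set where
  AND OR : Kind

kindFn : Kind → List Bool → Bool
kindFn AND = and
kindFn OR  = or

-- 𝒢_m : AND/OR gates with i, o ∈ {1,2}; arity = 1 + toℕ of a Fin 2 index
Gm : GateSet Bool
Gm = record
  { Gate = Kind × Fin 2 × Fin 2
  ; ins  = λ g → suc (toℕ (proj₁ (proj₂ g)))
  ; outs = λ g → suc (toℕ (proj₂ (proj₂ g)))
  ; fn   = λ g x _ → kindFn (proj₁ g) (tabulate x)
  }

Gm2 : GateSet Bool
Gm2 = record
  { Gate = Kind
  ; ins  = λ _ → 2
  ; outs = λ _ → 2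
  ; fn   = λ g x _ → kindFn g (tabulate x)
  }

Word : Set
Word = List Bool

encB : B.ℕᵇ → Word
encB B.zero      = false ∷ []
encB B.2[1+ x ]  = true ∷ true ∷ encB x
encB B.1+[2 x ]  = true ∷ false ∷ encB x

-- binary, self-delimiting encoding of a natural number
encℕ : ℕ → Word
encℕ n = encB (B.fromℕ n)

-- self-delimiting list of (prefix-free) items
encList : List Word → Word
encList ws = concat (map (λ w → true ∷ w) ws) ++ false ∷ []

encBits : Word → Word
encBits bs = encList (map (λ b → b ∷ []) bs)

-- a node entry: list of in-neighbours (node indices) and local table
Entry : Set
Entry = List ℕ × List Bool

encEntry : Entry → Word
encEntry (ns , tb) = encList (map encℕ ns) ++ encBits tb

encRepr : (N : ℕ) → (Fin N → Entry) → Word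
encRepr N e = encList (tabulate (λ v → encEntry (e v)))

nthD : List Bool → ℕ → Bool
nthD []       _       = false
nthD (b ∷ _)  zero    = b
nthD (_ ∷ bs) (suc i) = nthD bs i

-- index of a tuple of bits in a table (first bit least significant)
bitsToℕ : List Bool → ℕ
bitsToℕ []           = 0
bitsToℕ (false ∷ bs) = 2 * bitsToℕ bs
bitsToℕ (true ∷ bs)  = suc (2 * bitsToℕ bs)

evalRepr : (N : ℕ) → (Fin N → Entry) → Network Bool N
evalRepr N e x v =
  nthD (proj₂ (e v)) (bitsToℕ (map (nthD (tabulate x)) (proj₁ (e v))))

DependsOn : {Q : Set} {N : ℕ} → Network Q N → Fin N → Fin N → Set
DependsOn {N = N} F u v =
  Σ (Fin N → _) λ x → Σ (Fin N → _) λ y →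
    (∀ w → w ≢ u → x w ≡ y w) × F x v ≢ F y v

WellFormedEntry : ℕ → Entry → Set
WellFormedEntry N (ns , tb) =
  All (_< N) ns × Unique ns × length tb ≡ 2 ^ length ns

Represents : Word → (N : ℕ) → Network Bool N → Set
Represents w N F =
  Σ (Fin N → Entry) λ e →
    (w ≡ encRepr N e) ×
    (∀ v → WellFormedEntry N (e v)) ×
    (∀ u v → (toℕ u ∈ proj₁ (e v) → DependsOn F u v) ×
             (DependsOn F u v → toℕ u ∈ proj₁ (e v))) ×
    (∀ x v → F x v ≡ evalRepr N e x v)

RepresentsΓ : GateSet Bool → Word → (N : ℕ) → Network Bool N → Set
RepresentsΓ G w N F = Represents w N F × IsGNetwork G F

-- partition (D_i) given by blk (u ∈ D_{blk u}); pattern p_{i,q}(u) = pat u q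
record BlockEmb (QH QG : Set) (NH NG : ℕ) : Set where
  field
    blk : Fin NG → Fin NH
    pat : Fin NG → QH → QG
    inj : ∀ i q q' → (∀ u → blk u ≡ i → pat u q ≡ pat u q') → q ≡ q'

embed : {QH QG : Set} {NH NG : ℕ} → BlockEmb QH QG NH NG →
        (Fin NH → QH) → (Fin NG → QG)
embed E x u = BlockEmb.pat E u (x (BlockEmb.blk E u))

SimulatesVia : {QF QG : Set} {NF NG : ℕ} → Network QG NG → Network QF NF →
               BlockEmb QF QG NF NG → ℕ → Set
SimulatesVia G F E T = ∀ x u → embed E (F x) u ≡ iter G T (embed E x) u

encEmb : {NH NG : ℕ} → BlockEmb Bool Bool NH NG → Word
encEmb {NG = NG} E = encList (tabulate (λ u →
  encℕ (toℕ (BlockEmb.blk E u)) ++ BlockEmb.pat E u false ∷ BlockEmb.pat E u true ∷ []))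

-- Logarithmic-space transducers
-- read-only input tape with end markers, one work tape (alphabet
-- Fin (suc K), blank = zero), write-only output tape.

data Move : Set where
  left stay right : Move

record TM : Set where
  field
    nStates : ℕ
    K       : ℕ
    start   : Fin nStates
    -- nothing = halt; otherwise (new state, work symbol written,
    --   input-head move, work-head move, optional output bit)
    δ : Fin nStates → Maybe Bool → Fin (suc K) →
        Maybe (Fin nStates × Fin (suc K) × Move × Move × Maybe Bool)

record Config (M : TM) : Set where
  constructor cfg
  field
    state : Fin (TM.nStates M)
    ihead : ℕ
    tape  : ℕ → Fin (suc (TM.K M))
    whead : ℕ
    out   : Word

-- input position 0 and positions > |w| hold end markers
readIn : Word → ℕ → Maybe Bool
readIn w       zero          = nothing
readIn []      (suc h)       = nothing
readIn (b ∷ w) (suc zero)    = just b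
readIn (b ∷ w) (suc (suc h)) = readIn w (suc h)

moveIn : Word → Move → ℕ → ℕ
moveIn w left  h = pred h
moveIn w stay  h = h
moveIn w right h = suc h ⊓ suc (length w)

moveW : Move → ℕ → ℕ
moveW left  h = pred h
moveW stay  h = h
moveW right h = suc h

writeTape : {A : Set} → (ℕ → A) → ℕ → A → (ℕ → A)
writeTape t i a j with does (j ≟ i)
... | true  = a
... | false = t j

emit : Maybe Bool → Word → Word
emit nothing  o = o
emit (just b) o = o ++ b ∷ []

δAt : (M : TM) → Word → Config M →
      Maybe (Fin (TM.nStates M) × Fin (suc (TM.K M)) × Move × Move × Maybe Bool)
δAt M w c = TM.δ M (Config.state c) (readIn w (Config.ihead c))
                   (Config.tape c (Config.whead c))

stepWith : (M : TM) → Word → Config M →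
  Maybe (Fin (TM.nStates M) × Fin (suc (TM.K M)) × Move × Move × Maybe Bool) →
  Config M
stepWith M w c nothing = c
stepWith M w (cfg s ih t wh o) (just (s' , a , mi , mw , b)) =
  cfg s' (moveIn w mi ih) (writeTape t wh a) (moveW mw wh) (emit b o)

step : (M : TM) → Word → Config M → Config M
step M w c = stepWith M w c (δAt M w c)

initial : (M : TM) → Config M
initial M = cfg (TM.start M) 0 (λ _ → Fin.zero) 0 []

run : (M : TM) → Word → ℕ → Config M
run M w t = iter (step M w) t (initial M)

ComputesInLogSpace : (M : TM) → ℕ → Word → Word → Set
ComputesInLogSpace M c w o =
  Σ ℕ λ t →
    (δAt M w (run M w t) ≡ nothing) ×
    (Config.out (run M w t) ≡ o) ×
    (∀ t' → t' ≤ t → Config.whead (run M w t') ≤ c * suc ⌊log₂ suc (length w) ⌋)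

SimulatesFamily : GateSet Bool → GateSet Bool → (ℕ → ℕ) → (ℕ → ℕ) → Set
SimulatesFamily GF GH T S =
  Σ TM λ M → Σ ℕ λ c →
    ∀ (w : Word) (n : ℕ) (H : Network Bool n) → RepresentsΓ GH w n H →
      Σ Word λ wF → Σ (Network Bool (S n)) λ F → Σ (BlockEmb Bool Bool n (S n)) λ E →
        ComputesInLogSpace M c w (encBits wF ++ encℕ (T n) ++ encEmb E) ×
        RepresentsΓ GF wF (S n) F ×
        SimulatesVia F H E (T n)

IsConstant : (ℕ → ℕ) → Set
IsConstant T = Σ ℕ λ c → ∀ n → T n ≡ c

IsLinear : (ℕ → ℕ) → Set
IsLinear S = Σ ℕ λ a → Σ ℕ λ b → ∀ n → S n ≡ a * n + b

{-# OPTIONS --safe #-}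

-- Gates of 𝒢_{m,2} have as many outputs as inputs, so simulating the unbalanced gates of 𝒢_m needs wires
-- that return from the consumer of a node to its producer. Every node v becomes four wires f₀, f₁
-- (carrying x_v) and b₀, b₁ (carrying 0), with a second copy of the four wires for the intermediate
-- time: then a gate with inputs a and outputs v meets equally many wires on both sides, OR(x, 0) = (x, x)
-- copies and AND(x, 0) = (0, 0) erases. In the first step a gate K with inputs a, a' sends K(a, a') to all
-- its outputs and its surplus wires to the backward wires of a, a'; the second step, local to each node,
-- takes the OR of the forward and the AND of the backward pair, which restores the zeros. This gives T = 2
-- and S(n) = 8n.
--
-- The transducer keeps three bijective binary counters on its work tape: the node A being translated, a
-- candidate U for a consumer of A, and a counter C with which every access to an entry of the input is
-- found again from the start of the input. In bijective binary 8x + j is computed digit by digit, least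
-- significant first, so node indices are streamed from the input without being stored.

module Submission where

open import Defs
open import Data.Bool using (Bool; true; false; not; _∧_; _∨_)
open import Data.Bool.Properties using (∨-identityʳ; ∨-idem; ∧-identityʳ)
open import Data.Fin using (Fin; toℕ; fromℕ<; combine; remQuot; punchOut)
import Data.Fin as Fin
open import Data.Fin.Patterns
import Data.Fin.Properties as Fin
open import Data.Fin.Properties using (any?; toℕ-combine; toℕ<n; remQuot-combine; combine-remQuot; punchOut-injective; injective⇒≤; toℕ-injective; toℕ-fromℕ<) renaming (_≟_ to _≟ᶠ_)
open import Data.List using (List; []; _∷_; _++_; length; map; concat; foldr; drop; replicate; tabulate; _ʳ++_)
open import Data.List.Membership.Propositional using (_∈_)
open import Data.List.Properties using (++-assoc; ++-identityʳ; length-++; length-ʳ++; length-replicate; length-tabulate; tabulate-cong)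
open import Data.List.Relation.Unary.All using (All; []; _∷_)
open import Data.List.Relation.Unary.AllPairs using ([]; _∷_)
open import Data.List.Relation.Unary.Any using (here; there)
open import Data.List.Relation.Unary.Unique.Propositional using (Unique)
open import Data.Maybe using (Maybe; just; nothing)
import Data.Maybe as Maybe
open import Data.Nat using (ℕ; zero; suc; _+_; _*_; _∸_; _^_; _/_; _%_; _≤_; _<_; z≤n; s≤s; s≤s⁻¹; _≟_)
open import Data.Nat.Binary.Base using (ℕᵇ; 2[1+_]; 1+[2_]; size; fromℕ)
import Data.Nat.Binary.Base as B
import Data.Nat.Binary.Properties as B
open import Data.Nat.DivMod using (_mod_)
open import Data.Nat.Logarithm using (⌊log₂_⌋; ⌊log₂⌋-mono-≤; ⌊log₂[2^n]⌋≡n)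
open import Data.Nat.Properties
open import Data.Nat.Solver using (module +-*-Solver)
open import Data.Product using (Σ; ∃; _×_; _,_; proj₁; proj₂; uncurry)
open import Data.Sum using (_⊎_; inj₁; inj₂; [_,_]′)
import Data.Sum as Sum
open import Data.Unit using (⊤; tt)
open import Function using (_∘_)
open import Function.Bundles using (Inverse; mk↔ₛ′)
open import Relation.Binary.PropositionalEquality
open import Relation.Nullary using (Dec; yes; no; ¬_; contradiction; does)
open import Relation.Nullary.Decidable using (decidable-stable; dec-true; dec-false; from-yes; map′)

-- Gate networks at the level of nodes

-- The restoring step needs no knowledge of the gate: in each backward pair one wire is 0 in any
-- case, and in each forward pair one wire carries the new state while the other carries the same
-- value or 0. AND and OR therefore recover 0 and the state. The second copy of the wires serves two
-- ends: the gates of the two steps act on disjoint wires, with only zeros in the idle half, and no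
-- gate reads a wire that it writes.
--
-- A word lists the in-neighbours of each node, but it names no gates, and two outputs of one gate
-- may list their common inputs in different orders. Whatever has to be fixed once per gate is
-- therefore fixed by the entry of its smallest output.
--
-- The simulating network is given by a rule local to each wire, which a transducer can evaluate.
-- That these rules come from gates is a separate argument: each of the two bijections between wires
-- and gate ports is built with an inverse on one side only, and the other side follows by counting,
-- both sets having 8n elements.
--
-- The counters fit because every entry occupies at least one bit: n is at most the length of the
-- input.

choose : {P X : Set} → Dec P → X → X → X
choose (yes _) x y = x
choose (no _)  x y = y

choose-yes : ∀ {P X : Set} (d : Dec P) {x y : X} → P → choose d x y ≡ x
choose-yes (yes _) p = refl
choose-yes (no ¬p) p = contradiction p ¬p

choose-no : ∀ {P X : Set} (d : Dec P) {x y : X} → (P → x ≡ y) → choose d x y ≡ y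
choose-no (yes p) f = f p
choose-no (no _)  f = refl

-- If y were missed by f, which is injective because of g, then `punchOut` at y would inject
-- `Fin (suc m)` into `Fin m`.
retract⇒inverse : ∀ {m} (f g : Fin m → Fin m) → (∀ x → g (f x) ≡ x) → ∀ y → f (g y) ≡ y
retract⇒inverse {suc m} f g gf y = decidable-stable (f (g y) ≟ᶠ y) λ fgy≢y →
  let y≢f : ∀ x → y ≢ f x
      y≢f x y≡fx = fgy≢y (trans (cong f (trans (cong g y≡fx) (gf x))) (sym y≡fx))
  in 1+n≰n (injective⇒≤ {f = λ x → punchOut (y≢f x)} λ {x} {x'} eq →
       trans (sym (gf x)) (trans (cong g (punchOut-injective (y≢f x) (y≢f x') eq)) (gf x')))

cast-retract⇒inverse : ∀ {m k} → m ≡ k → (f : Fin m → Fin k) (g : Fin k → Fin m) →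
  (∀ x → g (f x) ≡ x) → ∀ y → f (g y) ≡ y
cast-retract⇒inverse refl = retract⇒inverse

unit : Kind → Bool
unit AND = true
unit OR  = false

kindFn-unit : ∀ K {m} (f : Fin m → Bool) → (∀ k → f k ≡ unit K) → kindFn K (tabulate f) ≡ unit K
kindFn-unit AND {zero}  f e = refl
kindFn-unit OR  {zero}  f e = refl
kindFn-unit AND {suc m} f e rewrite e 0F = kindFn-unit AND (f ∘ Fin.suc) (e ∘ Fin.suc)
kindFn-unit OR  {suc m} f e rewrite e 0F = kindFn-unit OR (f ∘ Fin.suc) (e ∘ Fin.suc)

kindFn-absorb : ∀ K {m} (f : Fin m → Bool) k → f k ≡ not (unit K) → kindFn K (tabulate f) ≡ not (unit K)
kindFn-absorb AND f Fin.zero    e rewrite e = refl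
kindFn-absorb OR  f Fin.zero    e rewrite e = refl
kindFn-absorb AND f (Fin.suc k) e rewrite kindFn-absorb AND (f ∘ Fin.suc) k e with f 0F
... | true  = refl
... | false = refl
kindFn-absorb OR  f (Fin.suc k) e rewrite kindFn-absorb OR (f ∘ Fin.suc) k e with f 0F
... | true  = refl
... | false = refl

not≢ : ∀ {b} → not b ≢ b
not≢ {true}  ()
not≢ {false} ()

module _ {N m : ℕ} (G : Network Bool N) (v : Fin N) (K : Kind) (h : Fin m → Fin N)
         (dyn : ∀ x → G x v ≡ kindFn K (tabulate (x ∘ h))) where

  -- With all other inputs at the unit of K, changing one input to the absorbing value changes the
  -- output. Hence the interaction graph demanded by `Represents` is exactly the list of inputs.
  input⇒depends : ∀ k → DependsOn G (h k) v
  input⇒depends k = x , y , agree , λ e → not≢ (trans (sym (trans (dyn x) Gx)) (trans e (trans (dyn y) Gy)))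
    where
    x y : Fin N → Bool
    x w = choose (w ≟ᶠ h k) (not (unit K)) (unit K)
    y _ = unit K
    agree : ∀ w → w ≢ h k → x w ≡ y w
    agree w w≢ = choose-no (w ≟ᶠ h k) (λ w≡ → contradiction w≡ w≢)
    Gx = kindFn-absorb K (x ∘ h) k (choose-yes (h k ≟ᶠ h k) refl)
    Gy = kindFn-unit K {m} (y ∘ h) λ _ → refl

  depends⇒input : ∀ {u} → DependsOn G u v → ∃ λ k → h k ≡ u
  depends⇒input {u} (x , y , agree , ne) = decidable-stable (any? λ k → h k ≟ᶠ u) λ ¬∃ →
    ne (trans (dyn x) (trans (cong (kindFn K) (tabulate-cong λ k → agree (h k) λ e → ¬∃ (k , e))) (sym (dyn y))))

kindFn-false : ∀ K → kindFn K (false ∷ false ∷ []) ≡ false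
kindFn-false AND = refl
kindFn-false OR  = refl

kindFn-swap : ∀ K a b → kindFn K (a ∷ b ∷ []) ≡ kindFn K (b ∷ a ∷ [])
kindFn-swap AND true  true  = refl
kindFn-swap AND true  false = refl
kindFn-swap AND false true  = refl
kindFn-swap AND false false = refl
kindFn-swap OR  true  true  = refl
kindFn-swap OR  true  false = refl
kindFn-swap OR  false true  = refl
kindFn-swap OR  false false = refl

table : Kind → List Bool
table AND = false ∷ false ∷ false ∷ true ∷ []
table OR  = false ∷ true ∷ true ∷ true ∷ []

nthD-table : ∀ K a b → nthD (table K) (bitsToℕ (a ∷ b ∷ [])) ≡ kindFn K (a ∷ b ∷ [])
nthD-table AND true  true  = refl
nthD-table AND true  false = refl
nthD-table AND false true  = refl
nthD-table AND false false = refl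
nthD-table OR  true  true  = refl
nthD-table OR  true  false = refl
nthD-table OR  false true  = refl
nthD-table OR  false false = refl

nthD-tabulate : ∀ {N} (x : Fin N → Bool) v → nthD (tabulate x) (toℕ v) ≡ x v
nthD-tabulate x Fin.zero    = refl
nthD-tabulate x (Fin.suc v) = nthD-tabulate (x ∘ Fin.suc) v

-- The nodes of a network of 𝒢_m-gates: node a feeds the gate κ a and node v is an output of the gate γ v.
-- The inputs of γ v are i₀ v and i₁ v, the outputs of κ a are c₀ a and c₁ a; they coincide if there is only one.
record Wiring (n : ℕ) : Set where
  field
    {gates}   : ℕ
    κ γ       : Fin n → Fin gates
    i₀ i₁     : Fin n → Fin n
    c₀ c₁     : Fin n → Fin n
    kind      : Fin n → Kind
    κ-i₀      : ∀ v → κ (i₀ v) ≡ γ v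
    κ-i₁      : ∀ v → κ (i₁ v) ≡ γ v
    inputs    : ∀ {a v} → κ a ≡ γ v → a ≡ i₀ v ⊎ a ≡ i₁ v
    γ-c₀      : ∀ a → γ (c₀ a) ≡ κ a
    γ-c₁      : ∀ a → γ (c₁ a) ≡ κ a
    consumers : ∀ {a v} → κ a ≡ γ v → v ≡ c₀ a ⊎ v ≡ c₁ a
    c₀≤c₁     : ∀ a → c₀ a Fin.≤ c₁ a
    kind-γ    : ∀ {v v'} → γ v ≡ γ v' → kind v ≡ kind v'

  -- The two pairs of outputs describe the same set, and both are sorted. So `c₀` depends on the
  -- gate alone and can serve as its canonical representative.
  c₀-κ : ∀ {a b} → κ a ≡ κ b → c₀ a ≡ c₀ b
  c₀-κ {a} {b} e with consumers {a} {c₀ b} (trans e (sym (γ-c₀ b)))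
  ... | inj₁ p = sym p
  ... | inj₂ p with consumers {b} {c₀ a} (trans (sym e) (sym (γ-c₀ a)))
  ... | inj₁ q = q
  ... | inj₂ q = Fin.≤-antisym (subst (c₀ a Fin.≤_) (sym p) (c₀≤c₁ a)) (subst (c₀ b Fin.≤_) (sym q) (c₀≤c₁ b))

  -- Both pairs describe the input set of one gate, but each comes from the entry of its own node,
  -- so the order may differ. If both inputs of v fall on one input of v', the set is a singleton,
  -- which the converse inclusion detects.
  siblings : ∀ {v v'} → γ v ≡ γ v' → (i₀ v ≡ i₀ v' × i₁ v ≡ i₁ v') ⊎ (i₀ v ≡ i₁ v' × i₁ v ≡ i₀ v')
  siblings {v} {v'} e
    with inputs {i₀ v} {v'} (trans (κ-i₀ v) e) | inputs {i₁ v} {v'} (trans (κ-i₁ v) e)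
  ... | inj₁ p | inj₂ q = inj₁ (p , q)
  ... | inj₂ p | inj₁ q = inj₂ (p , q)
  ... | inj₁ p | inj₁ q with inputs {i₁ v'} {v} (trans (κ-i₁ v') (sym e))
  ...   | inj₁ r = inj₁ (p , trans q (sym (trans r p)))
  ...   | inj₂ r = inj₁ (p , sym r)
  siblings {v} {v'} e
      | inj₂ p | inj₂ q with inputs {i₀ v'} {v} (trans (κ-i₀ v') (sym e))
  ...   | inj₁ r = inj₂ (p , trans q (sym (trans r p)))
  ...   | inj₂ r = inj₂ (p , sym r)

  unary-γ : ∀ {v v'} → γ v ≡ γ v' → i₀ v ≡ i₁ v → i₀ v' ≡ i₁ v'
  unary-γ e p with siblings e
  ... | inj₁ (q , r) = trans (sym q) (trans p r)
  ... | inj₂ (q , r) = trans (sym r) (trans (sym p) q)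

-- The simulating network on eight wires per node

module Simulator {n : ℕ} (W : Wiring n) where
  open Wiring W

  -- Slots 0, 1 hold the state of a node and 2, 3 hold zeros; slots 4, 5, 6, 7 receive them after one step.
  Node : Set
  Node = Fin n × Fin 8

  -- A gate with two inputs is executed twice, once on the copies in slot 0 and once on those in
  -- slot 1. A gate with one input is executed once and consumes both copies; the second forward
  -- wire is then supplied with a zero from the backward wires of v.
  forward₀ forward₁ : Fin n → Node × Node × Kind
  forward₀ v = choose (i₀ v ≟ᶠ i₁ v) ((i₀ v , 0F) , (i₀ v , 1F) , kind v) ((i₀ v , 0F) , (i₁ v , 0F) , kind v)
  forward₁ v = choose (i₀ v ≟ᶠ i₁ v) ((v , 2F) , (v , 3F) , AND) ((i₀ v , 1F) , (i₁ v , 1F) , kind v)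

  local : Node → Node × Node × Kind
  local (v , 0F) = (v , 4F) , (v , 5F) , OR
  local (v , 1F) = (v , 4F) , (v , 5F) , OR
  local (v , 2F) = (v , 6F) , (v , 7F) , AND
  local (v , 3F) = (v , 6F) , (v , 7F) , AND
  local (v , 4F) = forward₀ v
  local (v , 5F) = forward₁ v
  local (a , 6F) = (c₀ a , 2F) , (c₀ a , 3F) , AND
  -- A gate with a single output has a surplus wire: slot 7 of a repeats the execution that a stands
  -- for, namely `forward₀` or `forward₁` of the output. With two outputs, the second one returns a
  -- zero here.
  local (a , 7F) = choose (c₀ a ≟ᶠ c₁ a) (choose (a ≟ᶠ i₀ (c₀ a)) (forward₀ (c₀ a)) (forward₁ (c₀ a)))
                                        ((c₁ a , 2F) , (c₁ a , 3F) , AND)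

  index : Node → ℕ
  index (v , j) = 8 * toℕ v + toℕ j

  node : Node → Fin (n * 8)
  node = uncurry combine

  toℕ-node : ∀ p → toℕ (node p) ≡ index p
  toℕ-node (v , j) = toℕ-combine v j

  unnode : Fin (n * 8) → Node
  unnode = remQuot 8

  entryOf : Node × Node × Kind → Entry
  entryOf (p , q , K) = index p ∷ index q ∷ [] , table K

  entries : Fin (n * 8) → Entry
  entries = entryOf ∘ local ∘ unnode

  -- Taken as the value of its own representation, so that the last clause of `Represents` holds by
  -- `refl`.
  F : Network Bool (n * 8)
  F = evalRepr (n * 8) entries

  apply : (Node → Bool) → Node × Node × Kind → Bool
  apply s (p , q , K) = kindFn K (s p ∷ s q ∷ [])

  F-apply : ∀ x u → F x u ≡ apply (x ∘ node) (local (unnode u))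
  F-apply x u with local (unnode u)
  ... | p , q , K = trans (cong₂ (λ a b → nthD (table K) (bitsToℕ (a ∷ b ∷ []))) (read p) (read q)) (nthD-table K _ _)
    where
    read : ∀ p → nthD (tabulate x) (index p) ≡ x (node p)
    read p = trans (cong (nthD (tabulate x)) (sym (toℕ-node p))) (nthD-tabulate x (node p))

  node-injective : ∀ {p q} → node p ≡ node q → p ≡ q
  node-injective {v , j} {v' , j'} e =
    trans (sym (remQuot-combine v j)) (trans (cong unnode e) (remQuot-combine v' j'))

  Distinct : Node × Node × Kind → Set
  Distinct (p , q , _) = p ≢ q

  distinct-choose : ∀ {P : Set} (d : Dec P) {x y} → Distinct x → (¬ P → Distinct y) → Distinct (choose d x y)
  distinct-choose (yes p) dx dy = dx
  distinct-choose (no ¬p) dx dy = dy ¬p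

  local-distinct : ∀ p → Distinct (local p)
  local-distinct (v , j) = go j
    where
    f₀ : ∀ v → Distinct (forward₀ v)
    f₀ v = distinct-choose (i₀ v ≟ᶠ i₁ v) (λ ()) λ ne → ne ∘ cong proj₁
    f₁ : ∀ v → Distinct (forward₁ v)
    f₁ v = distinct-choose (i₀ v ≟ᶠ i₁ v) (λ ()) λ ne → ne ∘ cong proj₁
    go : ∀ j → Distinct (local (v , j))
    go 0F = λ ()
    go 1F = λ ()
    go 2F = λ ()
    go 3F = λ ()
    go 4F = f₀ v
    go 5F = f₁ v
    go 6F = λ ()
    go 7F = distinct-choose (c₀ v ≟ᶠ c₁ v)
              (distinct-choose (v ≟ᶠ i₀ (c₀ v)) (f₀ (c₀ v)) λ _ → f₁ (c₀ v)) λ _ ()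

  F-represents : Represents (encRepr (n * 8) entries) (n * 8) F
  F-represents = entries , refl , wf , (λ u v → mem⇒dep u v , dep⇒mem u v) , λ _ _ → refl
    where
    inp : Fin (n * 8) → Fin 2 → Fin (n * 8)
    inp v 0F = node (proj₁ (local (unnode v)))
    inp v 1F = node (proj₁ (proj₂ (local (unnode v))))
    K : Fin (n * 8) → Kind
    K v = proj₂ (proj₂ (local (unnode v)))
    dynF : ∀ v x → F x v ≡ kindFn (K v) (tabulate (x ∘ inp v))
    dynF v x = F-apply x v
    wf : ∀ v → WellFormedEntry (n * 8) (entries v)
    wf v = let p , q , K = local (unnode v) in
      bound p ∷ bound q ∷ [] ,
      ((λ e → local-distinct (unnode v) (node-injective (toℕ-injective (trans (toℕ-node p) (trans e (sym (toℕ-node q))))))) ∷ [])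
        ∷ [] ∷ [] , tableLength K
      where
      bound : ∀ p → index p < n * 8
      bound p = subst (_< n * 8) (toℕ-node p) (toℕ<n (node p))
      tableLength : ∀ K → length (table K) ≡ 4
      tableLength AND = refl
      tableLength OR  = refl
    mem⇒dep : ∀ u v → toℕ u ∈ proj₁ (entries v) → DependsOn F u v
    mem⇒dep u v (here e) = subst (λ z → DependsOn F z v) (toℕ-injective (trans (toℕ-node _) (sym e)))
      (input⇒depends F v (K v) (inp v) (dynF v) 0F)
    mem⇒dep u v (there (here e)) = subst (λ z → DependsOn F z v) (toℕ-injective (trans (toℕ-node _) (sym e)))
      (input⇒depends F v (K v) (inp v) (dynF v) 1F)
    dep⇒mem : ∀ u v → DependsOn F u v → toℕ u ∈ proj₁ (entries v)
    dep⇒mem u v d with depends⇒input F v (K v) (inp v) (dynF v) d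
    ... | 0F , refl = here (toℕ-node _)
    ... | 1F , refl = there (here (toℕ-node _))

  slot : Fin 8 → Bool → Bool
  slot 0F q = q
  slot 1F q = q
  slot _  q = false

  embedding : BlockEmb Bool Bool n (n * 8)
  embedding = record
    { blk = proj₁ ∘ unnode
    ; pat = λ u → slot (proj₂ (unnode u))
    ; inj = λ i q q' eq → subst (λ p → slot (proj₂ p) q ≡ slot (proj₂ p) q') (remQuot-combine i 0F)
                            (eq (combine i 0F) (cong proj₁ (remQuot-combine i 0F)))
    }

  apply-cong : ∀ {s s'} → (∀ p → s p ≡ s' p) → ∀ t → apply s t ≡ apply s' t
  apply-cong e (p , q , K) = cong₂ (λ a b → kindFn K (a ∷ b ∷ [])) (e p) (e q)

  unnode-node : ∀ p → unnode (node p) ≡ p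
  unnode-node (v , j) = remQuot-combine v j

  -- After one step slots 0-3 are zero and slots 4-7 hold the results of the gates; the second step
  -- brings these back to slots 0-3, while slots 4-7 are computed from zeros alone.
  simulates : ∀ {H : Network Bool n} → (∀ x v → H x v ≡ kindFn (kind v) (x (i₀ v) ∷ x (i₁ v) ∷ [])) →
    SimulatesVia F H embedding 2
  simulates {H} dynH x u = sym (begin
    F (F (embed embedding x)) u                            ≡⟨ F-apply (F (embed embedding x)) u ⟩
    apply (F (embed embedding x) ∘ node) (local (unnode u)) ≡⟨ apply-cong first (local (unnode u)) ⟩
    apply s₁ (local (unnode u))                            ≡⟨ second (unnode u) ⟩
    embed embedding (H x) u                                ∎)
    where
    open ≡-Reasoning
    s₀ s₁ : Node → Bool
    s₀ (v , j) = slot j (x v)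
    s₁ p = apply s₀ (local p)
    first : ∀ p → F (embed embedding x) (node p) ≡ s₁ p
    first p = trans (F-apply (embed embedding x) (node p)) (trans (cong (apply (embed embedding x ∘ node) ∘ local) (unnode-node p))
      (apply-cong (λ q → cong s₀ (unnode-node q)) (local p)))
    quiet : ∀ p q K → s₁ p ≡ false → s₁ q ≡ false → apply s₁ (p , q , K) ≡ false
    quiet p q K ep eq = trans (cong₂ (λ a b → kindFn K (a ∷ b ∷ [])) ep eq) (kindFn-false K)
    quiet-choose : ∀ {P : Set} (d : Dec P) {t t'} → apply s₁ t ≡ false → apply s₁ t' ≡ false → apply s₁ (choose d t t') ≡ false
    quiet-choose (yes _) e e' = e
    quiet-choose (no _)  e e' = e'
    quiet₀ : ∀ v → apply s₁ (forward₀ v) ≡ false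
    quiet₀ v = quiet-choose (i₀ v ≟ᶠ i₁ v) (quiet (i₀ v , 0F) (i₀ v , 1F) (kind v) refl refl) (quiet (i₀ v , 0F) (i₁ v , 0F) (kind v) refl refl)
    quiet₁ : ∀ v → apply s₁ (forward₁ v) ≡ false
    quiet₁ v = quiet-choose (i₀ v ≟ᶠ i₁ v) refl (quiet (i₀ v , 1F) (i₁ v , 1F) (kind v) refl refl)
    joined : ∀ v → s₁ (v , 4F) ∨ (s₁ (v , 5F) ∨ false) ≡ H x v
    joined v with i₀ v ≟ᶠ i₁ v | dynH x v
    ... | yes e | h = trans (∨-identityʳ _) (trans (cong (λ a → kindFn (kind v) (x (i₀ v) ∷ x a ∷ [])) e) (sym h))
    ... | no _  | h = trans (cong (k ∨_) (∨-identityʳ k)) (trans (∨-idem k) (sym h))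
      where k = kindFn (kind v) (x (i₀ v) ∷ x (i₁ v) ∷ [])
    second : ∀ p → apply s₁ (local p) ≡ slot (proj₂ p) (H x (proj₁ p))
    second (v , 0F) = joined v
    second (v , 1F) = joined v
    -- Slot 6 always receives the AND of two zeros, so the AND with slot 7 is 0 whatever surplus
    -- arrives there.
    second (v , 2F) = refl
    second (v , 3F) = refl
    second (v , 4F) = quiet₀ v
    second (v , 5F) = quiet₁ v
    second (v , 6F) = refl
    second (v , 7F) = quiet-choose (c₀ v ≟ᶠ c₁ v) (quiet-choose (v ≟ᶠ i₀ (c₀ v)) (quiet₀ _) (quiet₁ _)) refl

  -- Gates 0 and 1 of v move slots 4–7 back to slots 0–3, gate 2 reads the zeros of v, and gate 3 of a reads
  -- copies of the states of the inputs of κ a.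
  Gate Port : Set
  Gate = Fin n × Fin 4
  Port = Gate × Fin 2

  gateKind : Gate → Kind
  gateKind (v , 0F) = OR
  gateKind (v , 1F) = AND
  gateKind (v , 2F) = AND
  gateKind (a , 3F) = kind (c₀ a)

  i : Fin 2 → Fin n → Fin n
  i 0F = i₀
  i 1F = i₁

  gateIn : Port → Node
  gateIn ((v , 0F) , 0F) = v , 4F
  gateIn ((v , 0F) , 1F) = v , 5F
  gateIn ((v , 1F) , 0F) = v , 6F
  gateIn ((v , 1F) , 1F) = v , 7F
  gateIn ((v , 2F) , 0F) = v , 2F
  gateIn ((v , 2F) , 1F) = v , 3F
  -- With two inputs, the position of a in the entry of `c₀ a` selects the copy that this gate reads
  -- from both of them, so the two inputs stand for the two executions.
  gateIn ((a , 3F) , k)  = choose (i₀ (c₀ a) ≟ᶠ i₁ (c₀ a)) (a , k Fin.↑ˡ 6) (i k (c₀ a) , choose (a ≟ᶠ i₀ (c₀ a)) 0F 1F)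

  feeds : Node → Port
  feeds (a , 0F) = choose (i₀ (c₀ a) ≟ᶠ i₁ (c₀ a)) ((a , 3F) , 0F) ((i₀ (c₀ a) , 3F) , choose (a ≟ᶠ i₀ (c₀ a)) 0F 1F)
  feeds (a , 1F) = choose (i₀ (c₀ a) ≟ᶠ i₁ (c₀ a)) ((a , 3F) , 1F) ((i₁ (c₀ a) , 3F) , choose (a ≟ᶠ i₀ (c₀ a)) 0F 1F)
  feeds (v , 2F) = (v , 2F) , 0F
  feeds (v , 3F) = (v , 2F) , 1F
  feeds (v , 4F) = (v , 0F) , 0F
  feeds (v , 5F) = (v , 0F) , 1F
  feeds (v , 6F) = (v , 1F) , 0F
  feeds (v , 7F) = (v , 1F) , 1F

  gateIn-binary : ∀ {x v} k → c₀ x ≡ v → i₀ v ≢ i₁ v → gateIn ((x , 3F) , k) ≡ (i k v , choose (x ≟ᶠ i₀ v) 0F 1F)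
  gateIn-binary k refl ne = choose-no (_ ≟ᶠ _) λ e → contradiction e ne

  c₀-i₀ : ∀ a → c₀ (i₀ (c₀ a)) ≡ c₀ a
  c₀-i₀ a = c₀-κ (trans (κ-i₀ _) (γ-c₀ a))

  c₀-i₁ : ∀ a → c₀ (i₁ (c₀ a)) ≡ c₀ a
  c₀-i₁ a = c₀-κ (trans (κ-i₁ _) (γ-c₀ a))

  i-position : ∀ {a v} → κ a ≡ γ v → i (choose (a ≟ᶠ i₀ v) 0F 1F) v ≡ a
  i-position {a} {v} e with a ≟ᶠ i₀ v | inputs e
  ... | yes p | _      = sym p
  ... | no ¬p | inj₁ p = contradiction p ¬p
  ... | no _  | inj₂ p = sym p

  gateIn-feeds : ∀ p → gateIn (feeds p) ≡ p
  gateIn-feeds (v , 2F) = refl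
  gateIn-feeds (v , 3F) = refl
  gateIn-feeds (v , 4F) = refl
  gateIn-feeds (v , 5F) = refl
  gateIn-feeds (v , 6F) = refl
  gateIn-feeds (v , 7F) = refl
  gateIn-feeds (a , 0F) with i₀ (c₀ a) ≟ᶠ i₁ (c₀ a) in eq
  ... | yes _ rewrite eq = refl
  ... | no ne = trans (gateIn-binary (choose (a ≟ᶠ i₀ (c₀ a)) 0F 1F) (c₀-i₀ a) ne)
    (cong₂ _,_ (i-position (sym (γ-c₀ a))) (choose-yes (i₀ (c₀ a) ≟ᶠ i₀ (c₀ a)) refl))
  gateIn-feeds (a , 1F) with i₀ (c₀ a) ≟ᶠ i₁ (c₀ a) in eq
  ... | yes _ rewrite eq = refl
  ... | no ne = trans (gateIn-binary (choose (a ≟ᶠ i₀ (c₀ a)) 0F 1F) (c₀-i₁ a) ne)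
    (cong₂ _,_ (i-position (sym (γ-c₀ a))) (choose-no (i₁ (c₀ a) ≟ᶠ i₀ (c₀ a)) λ e → contradiction (sym e) ne))

  -- `side` picks the forward slot filled by gate 3 of an input, `rank` the backward slot of an
  -- input filled by gate 2 of an output.
  side rank : Fin n → Fin n → Fin 8
  side a v = choose (a ≟ᶠ i₀ v) 4F 5F
  rank v a = choose (v ≟ᶠ c₀ a) 6F 7F

  gateOut : Port → Node
  gateOut ((v , 0F) , k)  = v , k Fin.↑ˡ 6
  gateOut ((v , 1F) , 0F) = v , 2F
  gateOut ((v , 1F) , 1F) = v , 3F
  gateOut ((v , 2F) , 0F) = choose (i₀ v ≟ᶠ i₁ v) (v , 5F) (i₀ v , rank v (i₀ v))
  gateOut ((v , 2F) , 1F) = i₁ v , rank v (i₁ v)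
  gateOut ((a , 3F) , 0F) = c₀ a , side a (c₀ a)
  gateOut ((a , 3F) , 1F) = choose (c₀ a ≟ᶠ c₁ a) (a , 7F) (c₁ a , side a (c₀ a))

  -- The port that writes a given wire. The producers of slots 4 and 5 are the inputs as ordered by
  -- `c₀ (i₀ v)`, the smallest output of the gate of v: the entry of v itself may list them the
  -- other way round.
  made : Node → Port
  made (v , 0F) = (v , 0F) , 0F
  made (v , 1F) = (v , 0F) , 1F
  made (v , 2F) = (v , 1F) , 0F
  made (v , 3F) = (v , 1F) , 1F
  made (v , 4F) = let x = i₀ (c₀ (i₀ v)) in (x , 3F) , choose (v ≟ᶠ c₀ x) 0F 1F
  made (v , 5F) = let x = i₁ (c₀ (i₀ v)) in choose (i₀ v ≟ᶠ i₁ v) ((v , 2F) , 0F) ((x , 3F) , choose (v ≟ᶠ c₀ x) 0F 1F)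
  made (a , 6F) = (c₀ a , 2F) , choose (a ≟ᶠ i₁ (c₀ a)) 1F 0F
  made (a , 7F) = choose (c₀ a ≟ᶠ c₁ a) ((a , 3F) , 1F) ((c₁ a , 2F) , choose (a ≟ᶠ i₁ (c₁ a)) 1F 0F)

  gateOut-forward : ∀ {x v} → κ x ≡ γ v → gateOut ((x , 3F) , choose (v ≟ᶠ c₀ x) 0F 1F) ≡ (v , side x (c₀ x))
  gateOut-forward {x} {v} e with v ≟ᶠ c₀ x | consumers e
  ... | yes p | _      = cong (_, side x (c₀ x)) (sym p)
  ... | no ¬p | inj₁ p = contradiction p ¬p
  ... | no ¬p | inj₂ p = trans (choose-no (c₀ x ≟ᶠ c₁ x) λ q → contradiction (trans p (sym q)) ¬p)
                               (cong (_, side x (c₀ x)) (sym p))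

  gateOut-backward : ∀ {a v} → κ a ≡ γ v → gateOut ((v , 2F) , choose (a ≟ᶠ i₁ v) 1F 0F) ≡ (a , rank v a)
  gateOut-backward {a} {v} e with a ≟ᶠ i₁ v | inputs e
  ... | yes refl | _         = refl
  ... | no ¬p    | inj₂ p    = contradiction p ¬p
  ... | no ¬p    | inj₁ refl = choose-no (i₀ v ≟ᶠ i₁ v) λ q → contradiction q ¬p

  κ-first₀ : ∀ v → κ (i₀ (c₀ (i₀ v))) ≡ γ v
  κ-first₀ v = trans (κ-i₀ _) (trans (γ-c₀ _) (κ-i₀ v))

  κ-first₁ : ∀ v → κ (i₁ (c₀ (i₀ v))) ≡ γ v
  κ-first₁ v = trans (κ-i₁ _) (trans (γ-c₀ _) (κ-i₀ v))

  γ-first : ∀ v → γ (c₀ (i₀ v)) ≡ γ v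
  γ-first v = trans (γ-c₀ (i₀ v)) (κ-i₀ v)

  gateOut-made : ∀ p → gateOut (made p) ≡ p
  gateOut-made (v , 0F) = refl
  gateOut-made (v , 1F) = refl
  gateOut-made (v , 2F) = refl
  gateOut-made (v , 3F) = refl
  gateOut-made (v , 4F) = trans (gateOut-forward (κ-first₀ v))
    (cong (v ,_) (choose-yes (_ ≟ᶠ _) (cong i₀ (sym (c₀-i₀ (i₀ v))))))
  gateOut-made (v , 5F) with i₀ v ≟ᶠ i₁ v in eq
  ... | yes _ rewrite eq = refl
  ... | no ne = trans (gateOut-forward (κ-first₁ v))
    (cong (v ,_) (choose-no (_ ≟ᶠ _) λ e → contradiction (unary-γ (γ-first v) (sym (trans e (cong i₀ (c₀-i₁ (i₀ v)))))) ne))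
  gateOut-made (a , 6F) = trans (gateOut-backward (sym (γ-c₀ a))) (cong (a ,_) (choose-yes (c₀ a ≟ᶠ c₀ a) refl))
  gateOut-made (a , 7F) with c₀ a ≟ᶠ c₁ a in eq
  ... | yes _ rewrite eq = refl
  ... | no ne = trans (gateOut-backward (sym (γ-c₁ a))) (cong (a ,_) (choose-no (c₁ a ≟ᶠ c₀ a) λ e → contradiction (sym e) ne))

  gateLocal : Gate → Node × Node × Kind
  gateLocal g = gateIn (g , 0F) , gateIn (g , 1F) , gateKind g

  -- Gate 3 of x follows the input order of `c₀ x`, the rule of the wire that of v. By `siblings`
  -- these differ at most by a swap, under which AND and OR are invariant.
  apply-forward₀ : ∀ s {x v} → κ x ≡ γ v → x ≡ i₀ (c₀ x) → apply s (forward₀ v) ≡ apply s (gateLocal (x , 3F))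
  apply-forward₀ s {x} {v} e x≡ with i₀ v ≟ᶠ i₁ v | trans (γ-c₀ x) e
  ... | yes p | γ≡ with i₀ (c₀ x) ≟ᶠ i₁ (c₀ x) | inputs e
  ...   | no ne | _      = contradiction (unary-γ (sym γ≡) p) ne
  ...   | yes _ | inj₁ q rewrite sym q | kind-γ γ≡ = refl
  ...   | yes _ | inj₂ q rewrite trans p (sym q) | kind-γ γ≡ = refl
  apply-forward₀ s {x} {v} e x≡ | no ne | γ≡
    rewrite gateIn-binary {x} 0F refl (ne ∘ unary-γ γ≡) | gateIn-binary {x} 1F refl (ne ∘ unary-γ γ≡)
          | choose-yes {X = Fin 8} (x ≟ᶠ i₀ (c₀ x)) {0F} {1F} x≡ | kind-γ γ≡
    with siblings γ≡
  ... | inj₁ (p , q) rewrite p | q = refl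
  ... | inj₂ (p , q) rewrite p | q = kindFn-swap (kind v) _ _

  apply-forward₁ : ∀ s {x v} → κ x ≡ γ v → x ≡ i₁ (c₀ x) → i₀ v ≢ i₁ v → apply s (forward₁ v) ≡ apply s (gateLocal (x , 3F))
  apply-forward₁ s {x} {v} e x≡ ne with i₀ v ≟ᶠ i₁ v | trans (γ-c₀ x) e
  ... | yes p | _  = contradiction p ne
  ... | no _  | γ≡
    rewrite gateIn-binary {x} 0F refl (ne ∘ unary-γ γ≡) | gateIn-binary {x} 1F refl (ne ∘ unary-γ γ≡)
          | choose-no {X = Fin 8} (x ≟ᶠ i₀ (c₀ x)) {0F} {1F} (λ q → contradiction (unary-γ γ≡ (trans (sym q) x≡)) ne) | kind-γ γ≡
    with siblings γ≡
  ... | inj₁ (p , q) rewrite p | q = refl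
  ... | inj₂ (p , q) rewrite p | q = kindFn-swap (kind v) _ _

  -- The link between the local rules, which are written down as entries, and the gates: all wires
  -- made by one gate compute its function.
  apply-gate : ∀ s p → apply s (local p) ≡ apply s (gateLocal (proj₁ (made p)))
  apply-gate s (v , 0F) = refl
  apply-gate s (v , 1F) = refl
  apply-gate s (v , 2F) = refl
  apply-gate s (v , 3F) = refl
  apply-gate s (v , 4F) = apply-forward₀ s (κ-first₀ v) (cong i₀ (sym (c₀-i₀ (i₀ v))))
  apply-gate s (v , 5F) with i₀ v ≟ᶠ i₁ v in eq
  ... | yes _ = refl
  ... | no ne = trans (sym (cong (apply s) (cong (λ d → choose d _ _) eq)))
    (apply-forward₁ s (κ-first₁ v) (cong i₁ (sym (c₀-i₁ (i₀ v)))) ne)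
  apply-gate s (a , 6F) = refl
  apply-gate s (a , 7F) with c₀ a ≟ᶠ c₁ a
  ... | no _ = refl
  ... | yes _ = copied (a ≟ᶠ i₀ (c₀ a)) (inputs (sym (γ-c₀ a)))
    where
    copied : (d : Dec (a ≡ i₀ (c₀ a))) → a ≡ i₀ (c₀ a) ⊎ a ≡ i₁ (c₀ a) →
      apply s (choose d (forward₀ (c₀ a)) (forward₁ (c₀ a))) ≡ apply s (gateLocal (a , 3F))
    copied (yes p) _        = apply-forward₀ s (sym (γ-c₀ a)) p
    copied (no ¬p) (inj₁ p) = contradiction p ¬p
    copied (no ¬p) (inj₂ p) = apply-forward₁ s (sym (γ-c₀ a)) p λ q → ¬p (trans p (sym q))

  gateNo : Gate → Fin (n * 4)
  gateNo = uncurry combine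

  -- Eight wires per node against four gates with two ports each: the cardinalities agree, so a
  -- one-sided inverse is two-sided.
  ports : ∀ (f : Node → Port) (g : Port → Node) → (∀ p → g (f p) ≡ p) → ∀ q → f (g q) ≡ q
  ports f g gf q = unport-injective (begin
    port (f (g q))                      ≡⟨ cong (port ∘ f) (sym (unnode-node (g q))) ⟩
    port (f (unnode (node (g q))))      ≡⟨ cong (port ∘ f ∘ unnode ∘ node ∘ g) (sym (unport-port q)) ⟩
    F′ (G′ (port q))                    ≡⟨ cast-retract⇒inverse sizes F′ G′ retract (port q) ⟩
    port q                              ∎)
    where
    open ≡-Reasoning
    port : Port → Fin (n * 4 * 2)
    port (g , k) = combine (gateNo g) k
    unport : Fin (n * 4 * 2) → Port
    unport j = let g , k = remQuot {n * 4} 2 j in remQuot 4 g , k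
    unport-port : ∀ q → unport (port q) ≡ q
    unport-port ((v , j) , k) = trans
      (cong (λ (g , k) → remQuot 4 g , k) (remQuot-combine (combine v j) k))
      (cong (_, k) (remQuot-combine v j))
    unport-injective : ∀ {p q} → port p ≡ port q → p ≡ q
    unport-injective {p} {q} e = trans (sym (unport-port p)) (trans (cong unport e) (unport-port q))
    sizes : n * 8 ≡ n * 4 * 2
    sizes = sym (*-assoc n 4 2)
    F′ : Fin (n * 8) → Fin (n * 4 * 2)
    F′ = port ∘ f ∘ unnode
    G′ : Fin (n * 4 * 2) → Fin (n * 8)
    G′ = node ∘ g ∘ unport
    retract : ∀ u → G′ (F′ u) ≡ u
    retract u = trans (cong (node ∘ g) (unport-port (f (unnode u))))
      (trans (cong node (gf (unnode u))) (combine-remQuot {n} 8 u))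

  F-gates : IsGNetwork Gm2 F
  F-gates = record
    { n      = n * 4
    ; gates  = gateKind ∘ gate
    ; α      = mk↔ₛ′ (λ (g , k) → node (gateIn (gate g , k))) (number ∘ feeds ∘ unnode)
                 (λ u → trans (cong (node ∘ gateIn) (gate-number (feeds (unnode u))))
                          (trans (cong node (gateIn-feeds (unnode u))) (combine-remQuot {n} 8 u)))
                 (λ (g , k) → trans (cong (number ∘ feeds) (unnode-node (gateIn (gate g , k))))
                          (trans (cong number (ports feeds gateIn gateIn-feeds (gate g , k)))
                                 (cong (_, k) (combine-remQuot {n} 4 g))))
    ; β      = mk↔ₛ′ (number ∘ made ∘ unnode) (λ (g , k) → node (gateOut (gate g , k)))
                 (λ (g , k) → trans (cong (number ∘ made) (unnode-node (gateOut (gate g , k))))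
                          (trans (cong number (ports made gateOut gateOut-made (gate g , k)))
                                 (cong (_, k) (combine-remQuot {n} 4 g))))
                 (λ u → trans (cong (node ∘ gateOut) (gate-number (made (unnode u))))
                          (trans (cong node (gateOut-made (unnode u))) (combine-remQuot {n} 8 u)))
    ; noLoop = λ (g , k) e → layers (gate g) k (begin
        proj₁ (made (gateIn (gate g , k)))                        ≡⟨ cong (proj₁ ∘ made) (unnode-node (gateIn (gate g , k))) ⟨
        proj₁ (made (unnode (node (gateIn (gate g , k)))))        ≡⟨ cong proj₁ (gate-number (made (unnode (node (gateIn (gate g , k)))))) ⟨
        gate (proj₁ (number (made (unnode (node (gateIn (gate g , k))))))) ≡⟨ cong gate e ⟩
        gate g                                                    ∎)
    ; dyn    = λ x u → trans (F-apply x u) (trans (apply-gate (x ∘ node) (unnode u))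
                 (cong (apply (x ∘ node) ∘ gateLocal) (sym (cong proj₁ (gate-number (made (unnode u)))))))
    }
    where
    open ≡-Reasoning
    gate : Fin (n * 4) → Gate
    gate = remQuot 4
    number : Port → Fin (n * 4) × Fin 2
    number (g , k) = gateNo g , k
    gate-number : ∀ q → (gate (proj₁ (number q)) , proj₂ (number q)) ≡ q
    gate-number ((v , j) , k) = cong (_, k) (remQuot-combine v j)
    -- Gates 0 and 1 read slots 4-7 and write slots 0-3, gates 2 and 3 do the opposite. Going from a
    -- gate to the writer of one of its inputs therefore changes the layer, which excludes loops.
    layer : Gate → Bool
    layer (_ , 0F) = true
    layer (_ , 1F) = true
    layer (_ , 2F) = false
    layer (_ , 3F) = false
    layer-choose : ∀ {P : Set} (d : Dec P) {b} {p p' : Port} → layer (proj₁ p) ≡ b → layer (proj₁ p') ≡ b → layer (proj₁ (choose d p p')) ≡ b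
    layer-choose (yes _) e e' = e
    layer-choose (no _)  e e' = e'
    upper : ∀ {P Q : Set} (d : Dec P) (d' : Dec Q) {a b : Fin n} k →
      layer (proj₁ (made (choose d (a , k Fin.↑ˡ 6) (b , choose d' 0F 1F)))) ≡ true
    upper (yes _) d' 0F = refl
    upper (yes _) d' 1F = refl
    upper (no _) (yes _) k = refl
    upper (no _) (no _)  k = refl
    flips : ∀ g k → layer (proj₁ (made (gateIn (g , k)))) ≡ not (layer g)
    flips (v , 0F) 0F = refl
    flips (v , 0F) 1F = layer-choose (i₀ v ≟ᶠ i₁ v) refl refl
    flips (v , 1F) 0F = refl
    flips (v , 1F) 1F = layer-choose (c₀ v ≟ᶠ c₁ v) refl refl
    flips (v , 2F) 0F = refl
    flips (v , 2F) 1F = refl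
    flips (a , 3F) k  = upper (i₀ (c₀ a) ≟ᶠ i₁ (c₀ a)) (a ≟ᶠ i₀ (c₀ a)) k
    layers : ∀ g k → proj₁ (made (gateIn (g , k))) ≢ g
    layers g k e = not≢ (trans (sym (flips g k)) (cong layer e))

-- The node structure of a 𝒢_m-network

first-or-last : ∀ (i : Fin 2) (l : Fin (suc (toℕ i))) → l ≡ 0F ⊎ l ≡ Fin.fromℕ (toℕ i)
first-or-last 0F 0F = inj₁ refl
first-or-last 1F 0F = inj₁ refl
first-or-last 1F 1F = inj₂ refl

-- Bounds the in-neighbour lists: three listed nodes would occupy at most two positions of one gate.
no-three : ∀ (i : Fin 2) (k l m : Fin (suc (toℕ i))) → k ≡ l ⊎ k ≡ m ⊎ l ≡ m
no-three i k l m with first-or-last i k | first-or-last i l | first-or-last i m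
... | inj₁ p | inj₁ q | _      = inj₁ (trans p (sym q))
... | inj₂ p | inj₂ q | _      = inj₁ (trans p (sym q))
... | inj₁ p | inj₂ q | inj₁ r = inj₂ (inj₁ (trans p (sym r)))
... | inj₂ p | inj₁ q | inj₂ r = inj₂ (inj₁ (trans p (sym r)))
... | inj₁ p | inj₂ q | inj₂ r = inj₂ (inj₂ (trans q (sym r)))
... | inj₂ p | inj₁ q | inj₁ r = inj₂ (inj₂ (trans q (sym r)))

-- Unary gates are the identity; calling all of them OR makes the kind of a node readable off its table.
normalKind : Fin 2 → Kind → Kind
normalKind 0F K = OR
normalKind 1F K = K

kindFn-one : ∀ K b → kindFn K (b ∷ []) ≡ b
kindFn-one AND b = ∧-identityʳ b
kindFn-one OR  b = ∨-identityʳ b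

module _ {A : Set} (i : Fin 2) (f : Fin (suc (toℕ i)) → A) (f-inj : ∀ {k l} → f k ≡ f l → k ≡ l)
         {a b : A} (cover : ∀ k → f k ≡ a ⊎ f k ≡ b) where

  same⇒unary : a ≡ b → i ≡ 0F
  same⇒unary refl = go i f f-inj λ k → [ (λ e → e) , (λ e → e) ]′ (cover k)
    where
    go : ∀ i (f : Fin (suc (toℕ i)) → A) → (∀ {k l} → f k ≡ f l → k ≡ l) → (∀ k → f k ≡ a) → i ≡ 0F
    go 0F f inj c = refl
    go 1F f inj c with inj (trans (c 0F) (sym (c 1F)))
    ... | ()

-- An entry determines the inputs of a gate but not their positions. Commutativity covers the order,
-- idempotence the single input that is named twice.
kindFn-inputs : ∀ {A : Set} K (i : Fin 2) (f : Fin (suc (toℕ i)) → A) → (∀ {k l} → f k ≡ f l → k ≡ l) → ∀ {a b} →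
  (∀ k → f k ≡ a ⊎ f k ≡ b) → ∃ (λ k → f k ≡ a) → ∃ (λ k → f k ≡ b) → ∀ (x : A → Bool) →
  kindFn K (tabulate (x ∘ f)) ≡ kindFn (normalKind i K) (x a ∷ x b ∷ [])
kindFn-inputs K 0F f inj c (0F , refl) (0F , refl) x =
  trans (kindFn-one K (x (f 0F))) (sym (trans (cong (x (f 0F) ∨_) (∨-identityʳ _)) (∨-idem (x (f 0F)))))
kindFn-inputs K 1F f inj c (0F , refl) (1F , refl) x = refl
kindFn-inputs K 1F f inj c (1F , refl) (0F , refl) x = kindFn-swap K _ _
kindFn-inputs K 1F f inj c (0F , refl) (0F , refl) x with c 1F
... | inj₁ e = contradiction (inj e) λ ()
... | inj₂ e = contradiction (inj e) λ ()
kindFn-inputs K 1F f inj c (1F , refl) (1F , refl) x with c 0F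
... | inj₁ e = contradiction (inj e) λ ()
... | inj₂ e = contradiction (inj e) λ ()

-- Because of this the table of a binary node can be copied bit by bit from the input, without
-- finding out its kind.
table-unique : ∀ K tb → length tb ≡ 4 → (∀ a b → nthD tb (bitsToℕ (a ∷ b ∷ [])) ≡ kindFn K (a ∷ b ∷ [])) → tb ≡ table K
table-unique AND (_ ∷ _ ∷ _ ∷ _ ∷ []) _ e
  rewrite e false false | e true false | e false true | e true true = refl
table-unique OR  (_ ∷ _ ∷ _ ∷ _ ∷ []) _ e
  rewrite e false false | e true false | e false true | e true true = refl

-- What the translation takes from a represented network: the wiring, with the inputs in the order
-- of the word, and the shape of each entry. The table of a unary node is left open, its kind being
-- known to be OR.
record Decoding (w : Word) {n : ℕ} (H : Network Bool n) : Set where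
  field
    W : Wiring n
  open Wiring W public
  field
    dynamics  : ∀ x v → H x v ≡ kindFn (kind v) (x (i₀ v) ∷ x (i₁ v) ∷ [])
    unary-OR  : ∀ v → i₀ v ≡ i₁ v → kind v ≡ OR
    e         : Fin n → Entry
    w≡        : w ≡ encRepr n e
    unary-e   : ∀ v → i₀ v ≡ i₁ v → proj₁ (e v) ≡ toℕ (i₀ v) ∷ []
    binary-e  : ∀ v → i₀ v ≢ i₁ v → e v ≡ (toℕ (i₀ v) ∷ toℕ (i₁ v) ∷ [] , table (kind v))

decode : ∀ {w n H} → RepresentsΓ Gm w n H → Decoding w H
decode {w} {n} {H} ((e , w≡ , wf , dep , ev) , N) = record
  { W = record
    { κ = κ ; γ = γ ; i₀ = i₀ ; i₁ = i₁
    ; c₀ = λ a → choose (p a Fin.≤? q a) (p a) (q a)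
    ; c₁ = λ a → choose (p a Fin.≤? q a) (q a) (p a)
    ; kind = kind
    ; κ-i₀ = κ-i₀
    ; κ-i₁ = κ-i₁
    ; inputs = inputs
    ; γ-c₀ = λ a → choose-either (p a Fin.≤? q a) (γ-out _ _) (γ-out _ _)
    ; γ-c₁ = λ a → choose-either (p a Fin.≤? q a) (γ-out _ _) (γ-out _ _)
    ; consumers = consumers
    ; c₀≤c₁ = ordered
    ; kind-γ = cong (λ j → normalKind (arity j) (kindOf j))
    }
  ; dynamics = dynamics
  ; unary-OR = λ v p → cong (λ z → normalKind z (kindOf (γ v)))
      (same⇒unary (arity (γ v)) (λ k → α.to (γ v , k)) α-inj {i₀ v} {i₁ v} (λ k → inputs (κ-in (γ v) k)) p)
  ; e = e
  ; w≡ = w≡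
  ; unary-e = unary-e
  ; binary-e = binary-e
  }
  where
  module N = IsGNetwork N
  module α = Inverse N.α
  module β = Inverse N.β
  γ κ : Fin n → Fin N.n
  γ v = proj₁ (β.to v)
  κ a = proj₁ (α.from a)
  arity : Fin N.n → Fin 2
  arity j = proj₁ (proj₂ (N.gates j))
  kindOf : Fin N.n → Kind
  kindOf j = proj₁ (N.gates j)
  kind : Fin n → Kind
  kind v = normalKind (arity (γ v)) (kindOf (γ v))
  κ-in : ∀ j k → κ (α.to (j , k)) ≡ j
  κ-in j k = cong proj₁ (α.strictlyInverseʳ (j , k))
  γ-out : ∀ j l → γ (β.from (j , l)) ≡ j
  γ-out j l = cong proj₁ (β.strictlyInverseˡ (j , l))
  α-inj : ∀ {j k l} → α.to (j , k) ≡ α.to (j , l) → k ≡ l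
  α-inj {j} {k} {l} eq = unpair (trans (sym (α.strictlyInverseʳ (j , k))) (trans (cong α.from eq) (α.strictlyInverseʳ (j , l))))
    where
    unpair : ∀ {k l} → _≡_ {A = N.I} (j , k) (j , l) → k ≡ l
    unpair refl = refl
  fed : ∀ {a j} → κ a ≡ j → ∃ λ k → α.to (j , k) ≡ a
  fed {a} refl = proj₂ (α.from a) , α.strictlyInverseˡ a

  -- An entry lists the nodes on which v depends, and these are all inputs of its gate, since AND
  -- and OR depend on every input. Together with `κ⇒member` this makes the list the input set of the
  -- gate.
  member⇒κ : ∀ {a v} → toℕ a ∈ proj₁ (e v) → κ a ≡ γ v
  member⇒κ {a} {v} m with depends⇒input H v (kindOf (γ v)) (λ k → α.to (γ v , k)) (λ x → N.dyn x v) (proj₁ (dep a v) m)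
  ... | k , refl = κ-in (γ v) k
  κ⇒member : ∀ {a v} → κ a ≡ γ v → toℕ a ∈ proj₁ (e v)
  κ⇒member {a} {v} eq with fed {a} eq
  ... | k , refl = proj₂ (dep (α.to (γ v , k)) v)
    (input⇒depends H v (kindOf (γ v)) (λ k → α.to (γ v , k)) (λ x → N.dyn x v) k)

  data Shape (v : Fin n) : List ℕ → Set where
    one : ∀ a → Shape v (toℕ a ∷ [])
    two : ∀ a b → a ≢ b → Shape v (toℕ a ∷ toℕ b ∷ [])

  -- The list is nonempty because position 0 of the gate is fed by a member of it, and it has at
  -- most two elements by `no-three`.
  shape : ∀ v → Shape v (proj₁ (e v))
  shape v = go (proj₁ (e v)) (proj₁ (wf v)) (proj₁ (proj₂ (wf v))) member⇒κ (κ⇒member (κ-in (γ v) 0F))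
    where
    meet : ∀ {x y} (lx : x < n) (ly : y < n) → fromℕ< lx ≡ fromℕ< ly → x ≡ y
    meet lx ly eq = trans (sym (toℕ-fromℕ< lx)) (trans (cong toℕ eq) (toℕ-fromℕ< ly))
    go : ∀ ns → All (_< n) ns → Unique ns → (∀ {a} → toℕ a ∈ ns → κ a ≡ γ v) → ∀ {b} → b ∈ ns → Shape v ns
    go (x ∷ []) (lt ∷ _) u m _ = subst (λ z → Shape v (z ∷ [])) (toℕ-fromℕ< lt) (one (fromℕ< lt))
    go (x ∷ y ∷ []) (lt ∷ lt' ∷ _) ((x≢y ∷ _) ∷ _) m _ =
      subst₂ (λ z z' → Shape v (z ∷ z' ∷ [])) (toℕ-fromℕ< lt) (toℕ-fromℕ< lt')
        (two (fromℕ< lt) (fromℕ< lt') λ eq → x≢y (trans (sym (toℕ-fromℕ< lt)) (trans (cong toℕ eq) (toℕ-fromℕ< lt'))))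
    go (x ∷ y ∷ z ∷ ns) (lx ∷ ly ∷ lz ∷ _) ((x≢y ∷ x≢z ∷ _) ∷ (y≢z ∷ _) ∷ _) m _
      with fed (m (here (toℕ-fromℕ< lx))) | fed (m (there (here (toℕ-fromℕ< ly)))) | fed (m (there (there (here (toℕ-fromℕ< lz)))))
    ... | k , ek | l , el | r , er with no-three (arity (γ v)) k l r
    ...   | inj₁ refl        = contradiction (meet lx ly (trans (sym ek) el)) x≢y
    ...   | inj₂ (inj₁ refl) = contradiction (meet lx lz (trans (sym ek) er)) x≢z
    ...   | inj₂ (inj₂ refl) = contradiction (meet ly lz (trans (sym el) er)) y≢z

  i₀ i₁ : Fin n → Fin n
  i₀ v with proj₁ (e v) | shape v
  ... | _ | one a     = a
  ... | _ | two a _ _ = a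
  i₁ v with proj₁ (e v) | shape v
  ... | _ | one a     = a
  ... | _ | two _ b _ = b

  unary-e : ∀ v → i₀ v ≡ i₁ v → proj₁ (e v) ≡ toℕ (i₀ v) ∷ []
  unary-e v eq with proj₁ (e v) | shape v
  ... | _ | one a      = refl
  ... | _ | two a b ne = contradiction eq ne

  binary-ns : ∀ v → i₀ v ≢ i₁ v → proj₁ (e v) ≡ toℕ (i₀ v) ∷ toℕ (i₁ v) ∷ []
  binary-ns v ne with proj₁ (e v) | shape v
  ... | _ | one a     = contradiction refl ne
  ... | _ | two a b _ = refl

  i₀-member : ∀ v → toℕ (i₀ v) ∈ proj₁ (e v)
  i₀-member v with proj₁ (e v) | shape v
  ... | _ | one a     = here refl
  ... | _ | two a b _ = here refl
  i₁-member : ∀ v → toℕ (i₁ v) ∈ proj₁ (e v)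
  i₁-member v with proj₁ (e v) | shape v
  ... | _ | one a     = here refl
  ... | _ | two a b _ = there (here refl)

  κ-i₀ : ∀ v → κ (i₀ v) ≡ γ v
  κ-i₀ v = member⇒κ (i₀-member v)
  κ-i₁ : ∀ v → κ (i₁ v) ≡ γ v
  κ-i₁ v = member⇒κ (i₁-member v)

  inputs : ∀ {a v} → κ a ≡ γ v → a ≡ i₀ v ⊎ a ≡ i₁ v
  inputs {a} {v} eq with proj₁ (e v) | shape v | κ⇒member {a} {v} eq
  ... | _ | one _     | here m         = inj₁ (toℕ-injective m)
  ... | _ | two _ _ _ | here m         = inj₁ (toℕ-injective m)
  ... | _ | two _ _ _ | there (here m) = inj₂ (toℕ-injective m)

  -- The first and the last output of the gate in its own numbering. They are sorted afterwards,
  -- because a search through the word meets consumers by increasing index.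
  p q : Fin n → Fin n
  p a = β.from (κ a , 0F)
  q a = β.from (κ a , Fin.fromℕ _)

  choose-either : ∀ {P : Set} (d : Dec P) {x y a} → γ x ≡ a → γ y ≡ a → γ (choose d x y) ≡ a
  choose-either (yes _) r s = r
  choose-either (no _)  r s = s

  consumers : ∀ {a v} → κ a ≡ γ v → v ≡ choose (p a Fin.≤? q a) (p a) (q a) ⊎ v ≡ choose (p a Fin.≤? q a) (q a) (p a)
  consumers {a} {v} eq = either (p a Fin.≤? q a) (subst (λ j → v ≡ β.from (j , 0F) ⊎ v ≡ β.from (j , Fin.fromℕ _)) (sym eq) out)
    where
    out : v ≡ β.from (γ v , 0F) ⊎ v ≡ β.from (γ v , Fin.fromℕ _)
    out with first-or-last (proj₂ (proj₂ (N.gates (γ v)))) (proj₂ (β.to v))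
    ... | inj₁ l = inj₁ (trans (sym (β.strictlyInverseʳ v)) (cong (λ l → β.from (γ v , l)) l))
    ... | inj₂ l = inj₂ (trans (sym (β.strictlyInverseʳ v)) (cong (λ l → β.from (γ v , l)) l))
    either : ∀ {P : Set} (d : Dec P) {x y} → v ≡ x ⊎ v ≡ y → v ≡ choose d x y ⊎ v ≡ choose d y x
    either (yes _) r        = r
    either (no _)  (inj₁ r) = inj₂ r
    either (no _)  (inj₂ r) = inj₁ r

  ordered : ∀ a → choose (p a Fin.≤? q a) (p a) (q a) Fin.≤ choose (p a Fin.≤? q a) (q a) (p a)
  ordered a with p a Fin.≤? q a
  ... | yes p≤q = p≤q
  ... | no p≰q  = ≰⇒≥ p≰q

  dynamics : ∀ x v → H x v ≡ kindFn (kind v) (x (i₀ v) ∷ x (i₁ v) ∷ [])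
  dynamics x v = trans (N.dyn x v) (kindFn-inputs (kindOf (γ v)) (arity (γ v)) (λ k → α.to (γ v , k)) α-inj
    (λ k → inputs (κ-in (γ v) k)) (fed (κ-i₀ v)) (fed (κ-i₁ v)) x)

  binary-e : ∀ v → i₀ v ≢ i₁ v → e v ≡ (toℕ (i₀ v) ∷ toℕ (i₁ v) ∷ [] , table (kind v))
  binary-e v ne = cong₂ _,_ ns≡ (table-unique (kind v) (proj₂ (e v))
      (trans (proj₂ (proj₂ (wf v))) (cong (λ ns → 2 ^ length ns) ns≡)) λ a b →
      -- A configuration with prescribed values at the two in-neighbours makes `evalRepr` read one
      -- chosen bit of the table.
      let x : Fin n → Bool
          x w = choose (w ≟ᶠ i₀ v) a b
          xa : nthD (tabulate x) (toℕ (i₀ v)) ≡ a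
          xa = trans (nthD-tabulate x (i₀ v)) (choose-yes (i₀ v ≟ᶠ i₀ v) refl)
          xb : nthD (tabulate x) (toℕ (i₁ v)) ≡ b
          xb = trans (nthD-tabulate x (i₁ v)) (choose-no (i₁ v ≟ᶠ i₀ v) λ eq → contradiction (sym eq) ne)
      in begin
        nthD (proj₂ (e v)) (bitsToℕ (a ∷ b ∷ []))
          ≡⟨ cong₂ (λ a b → nthD (proj₂ (e v)) (bitsToℕ (a ∷ b ∷ []))) (sym xa) (sym xb) ⟩
        nthD (proj₂ (e v)) (bitsToℕ (map (nthD (tabulate x)) (toℕ (i₀ v) ∷ toℕ (i₁ v) ∷ [])))
          ≡⟨ cong (λ ns → nthD (proj₂ (e v)) (bitsToℕ (map (nthD (tabulate x)) ns))) (sym ns≡) ⟩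
        evalRepr n e x v
          ≡⟨ sym (ev x v) ⟩
        H x v
          ≡⟨ dynamics x v ⟩
        kindFn (kind v) (x (i₀ v) ∷ x (i₁ v) ∷ [])
          ≡⟨ cong₂ (λ a b → kindFn (kind v) (a ∷ b ∷ [])) (choose-yes (i₀ v ≟ᶠ i₀ v) refl)
               (choose-no (i₁ v ≟ᶠ i₀ v) λ eq → contradiction (sym eq) ne) ⟩
        kindFn (kind v) (a ∷ b ∷ []) ∎)
    where
    open ≡-Reasoning
    ns≡ = binary-ns v ne

-- Structured programs and their compilation to logarithmic-space transducers

record Finite (A : Set) : Set where
  field
    card    : ℕ
    enc     : A → Fin card
    dec     : Fin card → A
    dec-enc : ∀ a → dec (enc a) ≡ a

open Finite

finite-⊤ : Finite ⊤
finite-⊤ = record { card = 1 ; enc = λ _ → Fin.zero ; dec = λ _ → tt ; dec-enc = λ _ → refl }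

finite-Fin : ∀ n → Finite (Fin n)
finite-Fin n = record { card = n ; enc = λ i → i ; dec = λ i → i ; dec-enc = λ _ → refl }

finite-⊎ : ∀ {A B} → Finite A → Finite B → Finite (A ⊎ B)
finite-⊎ FA FB = record
  { card    = card FA + card FB
  ; enc     = Fin.join (card FA) (card FB) ∘ Sum.map (enc FA) (enc FB)
  ; dec     = Sum.map (dec FA) (dec FB) ∘ Fin.splitAt (card FA)
  ; dec-enc = λ x → trans
      (cong (Sum.map (dec FA) (dec FB)) (Fin.splitAt-join (card FA) (card FB) (Sum.map (enc FA) (enc FB) x))) (retract x)
  }
  where
  retract : ∀ x → Sum.map (dec FA) (dec FB) (Sum.map (enc FA) (enc FB) x) ≡ x
  retract (inj₁ a) = cong inj₁ (dec-enc FA a)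
  retract (inj₂ b) = cong inj₂ (dec-enc FB b)

finite-× : ∀ {A B} → Finite A → Finite B → Finite (A × B)
finite-× FA FB = record
  { card    = card FA * card FB
  ; enc     = λ (a , b) → Fin.combine (enc FA a) (enc FB b)
  ; dec     = λ i → dec FA (proj₁ (Fin.remQuot (card FB) i)) , dec FB (proj₂ (Fin.remQuot {card FA} (card FB) i))
  ; dec-enc = λ (a , b) → cong₂ _,_
      (trans (cong (dec FA ∘ proj₁) (Fin.remQuot-combine (enc FA a) (enc FB b))) (dec-enc FA a))
      (trans (cong (dec FB ∘ proj₂) (Fin.remQuot-combine (enc FA a) (enc FB b))) (dec-enc FB b))
  }

finite-retract : ∀ {A B} → Finite B → (f : A → B) (g : B → A) → (∀ a → g (f a) ≡ a) → Finite A
finite-retract FB f g gf = record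
  { card    = card FB
  ; enc     = enc FB ∘ f
  ; dec     = g ∘ dec FB
  ; dec-enc = λ a → trans (cong g (dec-enc FB (f a))) (gf a)
  }

headM : Word → Maybe Bool
headM []      = nothing
headM (b ∷ _) = just b

module Programs (R D : Set) where

  Test : Set
  Test = R → Maybe Bool → D → Bool

  infixr 5 _⨾_

  -- Cell 0 of the work tape and the end markers of the input are invisible to a program: rewind and home
  -- return to the first proper cell.
  data Prog : Set where
    out                         : Test → Prog
    upd                         : (R → Maybe Bool → D → R × D) → Prog
    fwd rewind tapeRight home   : Prog
    _⨾_                         : Prog → Prog → Prog
    ite                         : Test → Prog → Prog → Prog
    while                       : Test → Prog → Prog

  -- leftOf is reversed; todo is the output still to be written, so that out consumes it as fwd consumes unread.
  record St : Set where
    constructor ⟨_,_,_,_,_⟩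
    field
      reg     : R
      unread  : Word
      leftOf  : List D
      rightOf : List D
      todo    : Word

  -- The list of cells keeps its total length, and each instruction asks for a cell under the head.
  -- A derivation thus certifies termination, the output and the space bound at once.
  data Run (w : Word) : Prog → St → St → Set where
    out       : ∀ {f r i l d t b o} → f r (headM i) d ≡ b →
                Run w (out f) ⟨ r , i , l , d ∷ t , b ∷ o ⟩ ⟨ r , i , l , d ∷ t , o ⟩
    upd       : ∀ {f r i l d t o r' d'} → f r (headM i) d ≡ (r' , d') →
                Run w (upd f) ⟨ r , i , l , d ∷ t , o ⟩ ⟨ r' , i , l , d' ∷ t , o ⟩
    fwd       : ∀ {r b i l d t o} →
                Run w fwd ⟨ r , b ∷ i , l , d ∷ t , o ⟩ ⟨ r , i , l , d ∷ t , o ⟩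
    rewind    : ∀ {r i l d t o} →
                Run w rewind ⟨ r , i , l , d ∷ t , o ⟩ ⟨ r , w , l , d ∷ t , o ⟩
    tapeRight : ∀ {r i l d t o} →
                Run w tapeRight ⟨ r , i , l , d ∷ t , o ⟩ ⟨ r , i , d ∷ l , t , o ⟩
    home      : ∀ {r i l d t o} →
                Run w home ⟨ r , i , l , d ∷ t , o ⟩ ⟨ r , i , [] , l ʳ++ (d ∷ t) , o ⟩
    _⨾_       : ∀ {p q s s' s''} → Run w p s s' → Run w q s' s'' → Run w (p ⨾ q) s s''
    iteᵗ      : ∀ {f p q r i l d t o s} → f r (headM i) d ≡ true →
                Run w p ⟨ r , i , l , d ∷ t , o ⟩ s → Run w (ite f p q) ⟨ r , i , l , d ∷ t , o ⟩ s
    iteᶠ      : ∀ {f p q r i l d t o s} → f r (headM i) d ≡ false →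
                Run w q ⟨ r , i , l , d ∷ t , o ⟩ s → Run w (ite f p q) ⟨ r , i , l , d ∷ t , o ⟩ s
    again     : ∀ {f p r i l d t o s s'} → f r (headM i) d ≡ true →
                Run w p ⟨ r , i , l , d ∷ t , o ⟩ s → Run w (while f p) s s' →
                Run w (while f p) ⟨ r , i , l , d ∷ t , o ⟩ s'
    done      : ∀ {f p r i l d t o} → f r (headM i) d ≡ false →
                Run w (while f p) ⟨ r , i , l , d ∷ t , o ⟩ ⟨ r , i , l , d ∷ t , o ⟩

  -- `rewind` needs two locations: both end markers read as `nothing`, so a first move to the left
  -- is made unconditionally before the search for the left marker starts.
  Loc : Prog → Set
  Loc rewind      = ⊤ ⊎ ⊤
  Loc (p ⨾ q)     = Loc p ⊎ Loc q
  Loc (ite _ p q) = ⊤ ⊎ (Loc p ⊎ Loc q)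
  Loc (while _ p) = ⊤ ⊎ Loc p
  Loc _           = ⊤

  entry : ∀ p → Loc p
  entry (out _)     = tt
  entry (upd _)     = tt
  entry fwd         = tt
  entry rewind      = inj₁ tt
  entry tapeRight   = tt
  entry home        = tt
  entry (p ⨾ q)     = inj₁ (entry p)
  entry (ite _ p q) = inj₁ tt
  entry (while _ p) = inj₁ tt

  finite-Loc : ∀ p → Finite (Loc p)
  finite-Loc (out _)     = finite-⊤
  finite-Loc (upd _)     = finite-⊤
  finite-Loc fwd         = finite-⊤
  finite-Loc rewind      = finite-⊎ finite-⊤ finite-⊤
  finite-Loc tapeRight   = finite-⊤
  finite-Loc home        = finite-⊤
  finite-Loc (p ⨾ q)     = finite-⊎ (finite-Loc p) (finite-Loc q)
  finite-Loc (ite _ p q) = finite-⊎ finite-⊤ (finite-⊎ (finite-Loc p) (finite-Loc q))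
  finite-Loc (while _ p) = finite-⊎ finite-⊤ (finite-Loc p)

  -- Tape symbols are Maybe D, nothing being the mark in cell 0.
  Instr : Set → Set
  Instr Q = Q × R × Maybe D × Move × Move × Maybe Bool

  stayAt : ∀ {Q} → Q → R → D → Instr Q
  stayAt q r d = q , r , just d , stay , stay , nothing

  branch : {Q : Set} → Bool → Q → Q → Q
  branch true  q q' = q
  branch false q q' = q'

  -- The instruction of p at a location, where locations are renamed by κ and leaving p means going to x.
  code : ∀ {Q} p → (Loc p → Q) → Q → Loc p → R → Maybe Bool → Maybe D → Instr Q
  code (out f)   κ x tt r i (just d)      = x , r , just d , stay , stay , just (f r i d)
  code (upd f)   κ x tt r i (just d)      = stayAt x (proj₁ (f r i d)) (proj₂ (f r i d))
  code fwd       κ x tt r i (just d)      = x , r , just d , right , stay , nothing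
  code tapeRight κ x tt r i (just d)      = x , r , just d , stay , right , nothing
  code rewind    κ x (inj₁ tt) r i s      = κ (inj₂ tt) , r , s , left , stay , nothing
  code rewind    κ x (inj₂ tt) r (just _) s = κ (inj₂ tt) , r , s , left , stay , nothing
  code rewind    κ x (inj₂ tt) r nothing  s = x , r , s , right , stay , nothing
  code home      κ x tt r i nothing       = x , r , nothing , stay , right , nothing
  code home      κ x tt r i (just d)      = κ tt , r , just d , stay , left , nothing
  code (p ⨾ q)   κ x (inj₁ l) r i s       = code p (κ ∘ inj₁) (κ (inj₂ (entry q))) l r i s
  code (p ⨾ q)   κ x (inj₂ l) r i s       = code q (κ ∘ inj₂) x l r i s
  code (ite f p q) κ x (inj₁ tt) r i (just d) =
    stayAt (branch (f r i d) (κ (inj₂ (inj₁ (entry p)))) (κ (inj₂ (inj₂ (entry q))))) r d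
  code (ite f p q) κ x (inj₂ (inj₁ l)) r i s = code p (κ ∘ inj₂ ∘ inj₁) x l r i s
  code (ite f p q) κ x (inj₂ (inj₂ l)) r i s = code q (κ ∘ inj₂ ∘ inj₂) x l r i s
  code (while f p) κ x (inj₁ tt) r i (just d) = stayAt (branch (f r i d) (κ (inj₂ (entry p))) x) r d
  code (while f p) κ x (inj₂ l) r i s     = code p (κ ∘ inj₂) (κ (inj₁ tt)) l r i s
  code _         κ x _ r i nothing        = x , r , nothing , stay , stay , nothing

  data Ctl (p : Prog) : Set where
    boot halt : Ctl p
    loc       : Loc p → Ctl p

  finite-Ctl : ∀ p → Finite (Ctl p)
  finite-Ctl p = finite-retract (finite-⊎ finite-⊤ (finite-⊎ finite-⊤ (finite-Loc p)))
    (λ { boot → inj₁ tt ; halt → inj₂ (inj₁ tt) ; (loc l) → inj₂ (inj₂ l) })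
    (λ { (inj₁ _) → boot ; (inj₂ (inj₁ _)) → halt ; (inj₂ (inj₂ l)) → loc l })
    (λ { boot → refl ; halt → refl ; (loc l) → refl })

  delta : ∀ p → Ctl p → R → Maybe Bool → Maybe D → Maybe (Instr (Ctl p))
  -- The tape starts blank, so the mark that stops `home` has to be written into cell 0 before the
  -- program starts.
  delta p boot    r i s = just (loc (entry p) , r , nothing , right , right , nothing)
  delta p halt    r i s = nothing
  delta p (loc l) r i s = just (code p loc halt l r i s)

  -- Correctness of the compilation

  module Compile
    (FR : Finite R) (r₀ : R) (K : ℕ)
    (encS : Maybe D → Fin (suc K)) (decS : Fin (suc K) → Maybe D)
    (decS-encS : ∀ s → decS (encS s) ≡ s)
    (main : Prog) where

    FQ : Finite (Ctl main × R)
    FQ = finite-× (finite-Ctl main) FR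

    encI : Instr (Ctl main) → Fin (card FQ) × Fin (suc K) × Move × Move × Maybe Bool
    encI (q , r , s , mi , mw , b) = enc FQ (q , r) , encS s , mi , mw , b

    machine : TM
    machine = record
      { nStates = card FQ
      ; K       = K
      ; start   = enc FQ (boot , r₀)
      ; δ       = λ n i s → Maybe.map encI
          (delta main (proj₁ (dec FQ n)) (proj₂ (dec FQ n)) i (decS s))
      }

    module OnInput (w : Word) (blank : D) (decS-blank : decS Fin.zero ≡ just blank)
                   (width : ℕ) (total : Word) where

      -- Stated through `decS`, so that untouched cells count as cells with the content `blank`.
      Cells : (ℕ → Fin (suc K)) → ℕ → List D → Set
      Cells t h []       = ⊤
      Cells t h (d ∷ ds) = decS (t h) ≡ just d × Cells t (suc h) ds

      Cells-right : ∀ {t h} l {ds} → Cells t h (l ʳ++ ds) → Cells t (length l + h) ds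
      Cells-right []      c = c
      Cells-right (x ∷ l) c = proj₂ (Cells-right l c)

      Cells-replace : ∀ {t t' h} l {ds ds'} → Cells t h (l ʳ++ ds) →
        (∀ j → j < length l + h → t' j ≡ t j) → Cells t' (length l + h) ds' → Cells t' h (l ʳ++ ds')
      Cells-replace []      c eq c' = c'
      Cells-replace (x ∷ l) c eq c' = Cells-replace l c (λ j j< → eq j (m≤n⇒m≤1+n j<))
        (trans (cong decS (eq _ ≤-refl)) (proj₁ (Cells-right l c)) , c')

      writeTape-same : ∀ (t : ℕ → Fin (suc K)) i a → writeTape t i a i ≡ a
      writeTape-same t i a rewrite dec-true (i ≟ i) refl = refl

      writeTape-other : ∀ (t : ℕ → Fin (suc K)) i a {j} → j ≢ i → writeTape t i a j ≡ t j
      writeTape-other t i a {j} j≢i rewrite dec-false (j ≟ i) j≢i = refl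

      Cells-above : ∀ {t a i} h {ds} → i < h → Cells t h ds → Cells (writeTape t i a) h ds
      Cells-above h {[]}     i<h _        = tt
      Cells-above h {d ∷ ds} i<h (e , cs) =
        trans (cong decS (writeTape-other _ _ _ (>⇒≢ i<h))) e , Cells-above (suc h) (m≤n⇒m≤1+n i<h) cs

      Cells-write : ∀ {t} l {d ds} d' → Cells t 1 (l ʳ++ (d ∷ ds)) →
        Cells (writeTape t (suc (length l)) (encS (just d'))) 1 (l ʳ++ (d' ∷ ds))
      Cells-write {t} l {d} {ds} d' c = Cells-replace l c
        (λ j j< → writeTape-other t h a (<⇒≢ (subst (j <_) (+-comm (length l) 1) j<)))
        (subst (λ k → Cells (writeTape t h a) k (d' ∷ ds)) (+-comm 1 (length l))
          ( trans (cong decS (writeTape-same t h a)) (decS-encS (just d'))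
          , Cells-above (suc h) ≤-refl
              (proj₂ (subst (λ h → Cells t h (d ∷ ds)) (+-comm (length l) 1) (Cells-right l c)))))
        where
        h = suc (length l)
        a = encS (just d')

      Cells-blank : ∀ n h → Cells (writeTape (λ _ → Fin.zero) 0 (encS nothing)) (suc h) (replicate n blank)
      Cells-blank zero    h = tt
      Cells-blank (suc n) h = decS-blank , Cells-blank n (suc h)

      Tape : (ℕ → Fin (suc K)) → List D → Set
      Tape t ds = decS (t 0) ≡ nothing × Cells t 1 ds × length ds ≡ width

      Conf : Ctl main → R → ℕ → (ℕ → Fin (suc K)) → ℕ → Word → Config machine
      Conf q r = cfg (enc FQ (q , r))

      -- Positions are the lengths of the reversed left parts; the added 1 stands for the left input
      -- marker and for the marked cell 0. Bits already written, followed by those still due, always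
      -- make up `total`.
      data At : Config machine → Ctl main → St → Set where
        at : ∀ {q r pre i t l ds o o'} → w ≡ pre ʳ++ i → Tape t (l ʳ++ ds) → o ++ o' ≡ total →
             At (Conf q r (suc (length pre)) t (suc (length l)) o) q ⟨ r , i , l , ds , o' ⟩

      data Steps : Config machine → Config machine → Set where
        []  : ∀ {c} → Steps c c
        _∷_ : ∀ {c c'} → Config.whead c ≤ suc width → Steps (step machine w c) c' → Steps c c'

      _++ₛ_ : ∀ {c c' c''} → Steps c c' → Steps c' c'' → Steps c c''
      []       ++ₛ ts = ts
      (b ∷ ss) ++ₛ ts = b ∷ (ss ++ₛ ts)

      readIn-ʳ++ : ∀ pre {i} → readIn (pre ʳ++ i) (suc (length pre)) ≡ headM i
      readIn-ʳ++ pre {i} = trans (cong (λ h → readIn (pre ʳ++ i) (suc h)) (sym (+-identityʳ (length pre))))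
                             (trans (shift pre 0) (start i))
        where
        start : ∀ i → readIn i 1 ≡ headM i
        start []      = refl
        start (b ∷ i) = refl
        shift : ∀ pre h {i} → readIn (pre ʳ++ i) (suc (length pre + h)) ≡ readIn i (suc h)
        shift []        h = refl
        shift (b ∷ pre) h {i} =
          trans (cong (λ k → readIn (pre ʳ++ (b ∷ i)) (suc k)) (sym (+-suc (length pre) h)))
                (shift pre (suc h))

      step-Conf : ∀ {q r ih t wh o i s q' r' s' mi mw b} →
        readIn w ih ≡ i → decS (t wh) ≡ s → delta main q r i s ≡ just (q' , r' , s' , mi , mw , b) →
        step machine w (Conf q r ih t wh o)
          ≡ Conf q' r' (moveIn w mi ih) (writeTape t wh (encS s')) (moveW mw wh) (emit b o)
      step-Conf {q} {r} {ih} {t} {wh} {o} refl refl eq =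
        cong (stepWith machine w (Conf q r ih t wh o))
          (trans (cong (λ z → Maybe.map encI (delta main (proj₁ z) (proj₂ z) _ _)) (dec-enc FQ (q , r)))
                 (cong (Maybe.map encI) eq))

      Cells-here : ∀ {t} l {d ds} → Cells t 1 (l ʳ++ (d ∷ ds)) → decS (t (suc (length l))) ≡ just d
      Cells-here {t} l {d} c = subst (λ h → decS (t h) ≡ just d) (+-comm (length l) 1) (proj₁ (Cells-right l c))

      Tape-write : ∀ {t} l {d ds} d' → Tape t (l ʳ++ (d ∷ ds)) →
        Tape (writeTape t (suc (length l)) (encS (just d'))) (l ʳ++ (d' ∷ ds))
      Tape-write {t} l d' (e , c , n) =
        trans (cong decS (writeTape-other t (suc (length l)) (encS (just d')) λ ())) e , Cells-write l d' c ,
        trans (trans (length-ʳ++ l) (sym (length-ʳ++ l))) n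

      whead-bound : ∀ l {ds : List D} → length (l ʳ++ ds) ≡ width → suc (length l) ≤ suc width
      whead-bound l {ds} n = s≤s (≤-trans (m≤m+n (length l) (length ds)) (≤-reflexive (trans (sym (length-ʳ++ l)) n)))

      moveIn-right : ∀ pre {b i} → w ≡ pre ʳ++ (b ∷ i) → moveIn w right (suc (length pre)) ≡ suc (suc (length pre))
      moveIn-right pre {b} {i} refl = m≤n⇒m⊓n≡m (s≤s (≤-trans (s≤s (m≤m+n (length pre) (length i)))
        (≤-reflexive (trans (sym (+-suc (length pre) (length i))) (sym (length-ʳ++ pre))))))

      data MoveI : Move → Word → Word → Set where
        stay  : ∀ {i} → MoveI stay i i
        right : ∀ {b i} → MoveI right (b ∷ i) i

      data MoveT : Move → List D → List D → List D → List D → Set where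
        stay  : ∀ {l ds} → MoveT stay l ds l ds
        right : ∀ {l d ds} → MoveT right l (d ∷ ds) (d ∷ l) ds

      data Emit : Maybe Bool → Word → Word → Set where
        none : ∀ {o} → Emit nothing o o
        some : ∀ {b o} → Emit (just b) (b ∷ o) o

      Reach : Config machine → Ctl main → St → Set
      Reach c q s = ∃ λ c' → Steps c c' × At c' q s

      single : ∀ {c q r i l d ds o q' r' d' mi mw b i' l' ds' o'} →
        At c q ⟨ r , i , l , d ∷ ds , o ⟩ →
        delta main q r (headM i) (just d) ≡ just (q' , r' , just d' , mi , mw , b) →
        MoveI mi i i' → MoveT mw l (d' ∷ ds) l' ds' → Emit b o o' →
        Reach c q' ⟨ r' , i' , l' , ds' , o' ⟩
      single (at {pre = pre} {l = l} {o = u} {o'} refl tp oeq) eq mi mt em =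
        _ , whead-bound l (proj₂ (proj₂ tp)) ∷ [] ,
        subst (λ c → At c _ _) (sym (step-Conf (readIn-ʳ++ pre) (Cells-here l (proj₁ (proj₂ tp))) eq))
          (final mi mt em)
        where
        emit-total : ∀ {b o''} → Emit b o' o'' → emit b u ++ o'' ≡ total
        emit-total none = oeq
        emit-total some = trans (++-assoc u _ _) oeq
        final : ∀ {q' r' d' mi mw b i' l' ds' o''} → MoveI mi _ i' → MoveT mw _ (d' ∷ _) l' ds' → Emit b o' o'' →
          At (Conf q' r' (moveIn w mi (suc (length pre))) (writeTape _ (suc (length l)) (encS (just d')))
                (moveW mw (suc (length l))) (emit b u)) q' ⟨ r' , i' , l' , ds' , o'' ⟩
        final {d' = d'} stay stay em  = at {pre = pre} {l = l} refl (Tape-write l d' tp) (emit-total em)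
        final {d' = d'} stay right em = at {pre = pre} {l = d' ∷ l} refl (Tape-write l d' tp) (emit-total em)
        final {d' = d'} (right {b}) stay em rewrite moveIn-right pre {b} refl =
          at {pre = b ∷ pre} {l = l} refl (Tape-write l d' tp) (emit-total em)
        final {d' = d'} (right {b}) right em rewrite moveIn-right pre {b} refl =
          at {pre = b ∷ pre} {l = d' ∷ l} refl (Tape-write l d' tp) (emit-total em)

      -- The program p sits inside `main` under the renaming κ and exits to x. As the transition
      -- function is that of `main`, descending into a subprogram only composes renamings.
      Impl : ∀ p → (Loc p → Ctl main) → Ctl main → Set
      Impl p κ x = ∀ l r i s → delta main (κ l) r i s ≡ just (code p κ x l r i s)

      _⟫_ : ∀ {c q s q' s'} → Reach c q s → (∀ {c'} → At c' q s → Reach c' q' s') → Reach c q' s'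
      (c' , ss , a) ⟫ k with k a
      ... | c'' , ts , a' = c'' , ss ++ₛ ts , a'

      rewind-loop : ∀ {κ x} → Impl rewind κ x → ∀ {r t o o'} pre {rest l d ds} → w ≡ pre ʳ++ rest →
        Tape t (l ʳ++ (d ∷ ds)) → o ++ o' ≡ total →
        Reach (Conf (κ (inj₂ tt)) r (length pre) t (suc (length l)) o) x ⟨ r , w , l , d ∷ ds , o' ⟩
      rewind-loop impl [] {l = l} {d} refl tp oeq =
        _ , whead-bound l (proj₂ (proj₂ tp)) ∷ [] ,
        subst (λ c → At c _ _)
          (sym (step-Conf refl (Cells-here l (proj₁ (proj₂ tp))) (impl (inj₂ tt) _ nothing _)))
          (at {pre = []} {l = l} refl (Tape-write l d tp) oeq)
      rewind-loop impl (b ∷ pre) {l = l} {d} refl tp oeq =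
        let c' , ss , a = rewind-loop impl pre refl (Tape-write l d tp) oeq in
        c' , whead-bound l (proj₂ (proj₂ tp)) ∷
          subst (λ c → Steps c c')
            (sym (step-Conf (readIn-ʳ++ pre) (Cells-here l (proj₁ (proj₂ tp))) (impl (inj₂ tt) _ (just b) _))) ss , a

      home-loop : ∀ {κ x} → Impl home κ x → ∀ {r t o o' pre i} l {d ds} → w ≡ pre ʳ++ i →
        Tape t (l ʳ++ (d ∷ ds)) → o ++ o' ≡ total →
        Reach (Conf (κ tt) r (suc (length pre)) t (length l) o) x ⟨ r , i , [] , l ʳ++ (d ∷ ds) , o' ⟩
      home-loop impl {t = t} {pre = pre} [] refl (e , c , n) oeq =
        _ , z≤n ∷ [] ,
        subst (λ c → At c _ _) (sym (step-Conf (readIn-ʳ++ pre) e (impl tt _ _ nothing)))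
          (at {pre = pre} {l = []} refl
            (trans (cong decS (writeTape-same t 0 (encS nothing))) (decS-encS nothing) , Cells-above 1 ≤-refl c , n) oeq)
      home-loop impl {pre = pre} (x ∷ l) {d} {ds} refl tp oeq =
        let c' , ss , a = home-loop impl {pre = pre} l refl (Tape-write l x tp) oeq in
        c' , whead-bound l (proj₂ (proj₂ tp)) ∷
          subst (λ c → Steps c c')
            (sym (step-Conf (readIn-ʳ++ pre) (Cells-here l (proj₁ (proj₂ tp))) (impl tt _ _ (just x)))) ss , a

      exec : ∀ {p κ x s s' c} → Impl p κ x → Run w p s s' → At c (κ (entry p)) s → Reach c x s'
      exec impl (out refl)  a = single a (impl tt _ _ _) stay stay some
      exec {x = x} impl (upd {r = r} eq) a =
        single a (trans (impl tt _ _ _) (cong (λ z → just (stayAt x (proj₁ z) (proj₂ z))) eq)) stay stay none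
      exec impl fwd         a = single a (impl tt _ _ _) right stay none
      exec impl tapeRight   a = single a (impl tt _ _ _) stay right none
      exec impl rewind (at {pre = pre} {l = l} refl tp oeq) =
        let c' , ss , a = rewind-loop impl pre refl (Tape-write l _ tp) oeq in
        c' , whead-bound l (proj₂ (proj₂ tp)) ∷
          subst (λ c → Steps c c')
            (sym (step-Conf (readIn-ʳ++ pre) (Cells-here l (proj₁ (proj₂ tp))) (impl (inj₁ tt) _ _ _))) ss , a
      exec impl home (at {pre = pre} {l = l} refl tp oeq) =
        let c' , ss , a = home-loop impl {pre = pre} l refl (Tape-write l _ tp) oeq in
        c' , whead-bound l (proj₂ (proj₂ tp)) ∷
          subst (λ c → Steps c c')
            (sym (step-Conf (readIn-ʳ++ pre) (Cells-here l (proj₁ (proj₂ tp))) (impl tt _ _ _))) ss , a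
      exec impl (ra ⨾ rb) a = exec (impl ∘ inj₁) ra a ⟫ exec (impl ∘ inj₂) rb
      exec {ite f p q} {κ} impl (iteᵗ {r = r} {d = d} eq ra) a =
        single a (trans (impl (inj₁ tt) _ _ _) (cong (λ z → just (stayAt (branch z _ _) r d)) eq)) stay stay none
        ⟫ exec (impl ∘ inj₂ ∘ inj₁) ra
      exec {ite f p q} {κ} impl (iteᶠ {r = r} {d = d} eq ra) a =
        single a (trans (impl (inj₁ tt) _ _ _) (cong (λ z → just (stayAt (branch z _ _) r d)) eq)) stay stay none
        ⟫ exec (impl ∘ inj₂ ∘ inj₂) ra
      exec {while f p} {κ} impl (again {r = r} {d = d} eq ra rb) a =
        single a (trans (impl (inj₁ tt) _ _ _) (cong (λ z → just (stayAt (branch z _ _) r d)) eq)) stay stay none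
        ⟫ λ a' → exec (impl ∘ inj₂) ra a' ⟫ exec impl rb
      exec {while f p} {κ} impl (done {r = r} {d = d} eq) a =
        single a (trans (impl (inj₁ tt) _ _ _) (cong (λ z → just (stayAt (branch z _ _) r d)) eq)) stay stay none

      iter-step : ∀ t (c : Config machine) → iter (step machine w) t (step machine w c) ≡ iter (step machine w) (suc t) c
      iter-step zero    c = refl
      iter-step (suc t) c = cong (step machine w) (iter-step t c)

      Steps⇒iter : ∀ {c c'} → Steps c c' → Config.whead c' ≤ suc width →
        ∃ λ t → iter (step machine w) t c ≡ c' ×
                (∀ t' → t' ≤ t → Config.whead (iter (step machine w) t' c) ≤ suc width)
      Steps⇒iter [] b = 0 , refl , λ { _ z≤n → b }
      Steps⇒iter {c} (b₀ ∷ ss) b with Steps⇒iter ss b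
      ... | t , eq , bd = suc t , trans (sym (iter-step t c)) eq , bd'
        where
        bd' : ∀ t' → t' ≤ suc t → Config.whead (iter (step machine w) t' c) ≤ suc width
        bd' zero     _  = b₀
        bd' (suc t') le = subst (λ c → Config.whead c ≤ suc width) (iter-step t' c) (bd t' (s≤s⁻¹ le))

      correct : ∀ {r i l ds} → Run w main ⟨ r₀ , w , [] , replicate width blank , total ⟩ ⟨ r , i , l , ds , [] ⟩ →
        ∃ λ t → δAt machine w (run machine w t) ≡ nothing × Config.out (run machine w t) ≡ total ×
                (∀ t' → t' ≤ t → Config.whead (run machine w t') ≤ suc width)
      correct {r} ra with exec {p = main} {loc} {halt} (λ _ _ _ _ → refl) ra first
        where
        first : At (Conf (loc (entry main)) r₀ 1 (writeTape (λ _ → Fin.zero) 0 (encS nothing)) 1 [])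
                   (loc (entry main)) ⟨ r₀ , w , [] , replicate width blank , total ⟩
        first = at {pre = []} {l = []} refl
          (trans (cong decS (writeTape-same (λ _ → Fin.zero) 0 (encS nothing))) (decS-encS nothing) , Cells-blank width 0 , length-replicate width) refl
      ... | c , ss , at {pre = pre} {t = t₁} {l = l} {o = o} _ tp oeq
          with Steps⇒iter (_∷_ {c = initial machine} z≤n
                 (subst (λ c₁ → Steps c₁ c) (sym (step-Conf {q = boot} refl refl refl)) ss))
                 (whead-bound l (proj₂ (proj₂ tp)))
      ... | t , eq , bd = t ,
        trans (cong (δAt machine w) eq)
          (cong (λ z → Maybe.map encI (delta main (proj₁ z) (proj₂ z) (readIn w (suc (length pre))) (decS (t₁ (suc (length l)))))) (dec-enc FQ (halt , r))) ,
        trans (cong Config.out eq) (trans (sym (++-identityʳ o)) oeq) , bd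

    computes-log : ∀ {w total r i l ds} blank → decS Fin.zero ≡ just blank →
      Run w main ⟨ r₀ , w , [] , replicate (suc ⌊log₂ suc (length w) ⌋) blank , total ⟩ ⟨ r , i , l , ds , [] ⟩ →
      ComputesInLogSpace machine 2 w total
    computes-log {w} {total} blank decS-blank ra =
      let t , halted , out≡ , bound = OnInput.correct w blank decS-blank (suc L) total ra
      in t , halted , out≡ , λ t' le → ≤-trans (bound t' le)
           -- The head stays within suc width = L + 2 ≤ 2 (L + 1), whence the space constant 2.
           (s≤s (≤-trans (s≤s (m≤m+n L (L + 0))) (≤-reflexive (sym (+-suc L (L + 0))))))
      where
      L = ⌊log₂ suc (length w) ⌋

-- Counters on the work tape

data Digit : Set where
  none one two : Digit

digit : Bool → Digit
digit false = one
digit true  = two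

value : Digit → ℕ
value none = 0
value one  = 1
value two  = 2

isDigit : Digit → Bool
isDigit none = false
isDigit _    = true

isTwo : Digit → Bool
isTwo two = true
isTwo _   = false

sameDigit : Digit → Digit → Bool
sameDigit none none = true
sameDigit one  one  = true
sameDigit two  two  = true
sameDigit _    _    = false

hd : ℕᵇ → Digit
hd B.zero   = none
hd 2[1+ _ ] = two
hd 1+[2 _ ] = one

tl : ℕᵇ → ℕᵇ
tl B.zero   = B.zero
tl 2[1+ x ] = x
tl 1+[2 x ] = x

consB : Bool → ℕᵇ → ℕᵇ
consB false = 1+[2_]
consB true  = 2[1+_]

record Triple (X : Set) : Set where
  constructor tri
  field
    a u c : X

data Track : Set where
  A U C : Track

get : ∀ {X} → Track → Triple X → X
get A (tri a u c) = a
get U (tri a u c) = u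
get C (tri a u c) = c

put : ∀ {X} → Track → X → Triple X → Triple X
put A x (tri a u c) = tri x u c
put U x (tri a u c) = tri a x c
put C x (tri a u c) = tri a u x

mapT : ∀ {X Y} → (X → Y) → Triple X → Triple Y
mapT f (tri a u c) = tri (f a) (f u) (f c)

get-map : ∀ {X Y} (f : X → Y) t v → get t (mapT f v) ≡ f (get t v)
get-map f A v = refl
get-map f U v = refl
get-map f C v = refl

put-map : ∀ {X Y} (f : X → Y) t x v → mapT f (put t x v) ≡ put t (f x) (mapT f v)
put-map f A x v = refl
put-map f U x v = refl
put-map f C x v = refl

put-get : ∀ {X} t (v : Triple X) → put t (get t v) v ≡ v
put-get A v = refl
put-get U v = refl
put-get C v = refl

Cell Vals : Set
Cell = Triple Digit
Vals = Triple ℕᵇ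

-- Bijective binary, least significant digit first; the cell after the last digit must exist.
cells : ℕ → Vals → List Cell
cells zero    v = []
cells (suc k) v = mapT hd v ∷ cells k (mapT tl v)

cells-put : ∀ k t y v →
  cells (suc k) (put t y v) ≡ put t (hd y) (mapT hd v) ∷ cells k (put t (tl y) (mapT tl v))
cells-put k t y v = cong₂ _∷_ (put-map hd t y v) (cong (cells k) (put-map tl t y v))

data Flag : Set where
  miss first second end : Flag

-- The carry of a multiplication by 8 starts at most at 7, and (8·2 + 14 - 1)/2 rounds down to 14,
-- so it never leaves the range 0-14.
record Reg : Set where
  constructor reg
  field
    acc  : Fin 15
    flag : Flag

open Reg
open Programs Reg Cell

atTrue : Test
atTrue _ (just true) _ = true
atTrue _ _           _ = false

isMiss isFirst isEnd : Flag → Bool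
isMiss miss = true
isMiss _    = false
isFirst first = true
isFirst _     = false
isEnd end = true
isEnd _   = false

flagOf : Bool → Flag
flagOf true  = first
flagOf false = miss

setFlag : Flag → Prog
setFlag f = upd λ r _ d → record r { flag = f } , d

setAcc : Fin 15 → Prog
setAcc p = upd λ r _ d → record r { acc = p } , d

-- Output either raw or with every bit b written as true, b (that is, inside encBits).
em : Bool → Test → Prog
em false f = out f
em true  f = out (λ _ _ _ → true) ⨾ out f

wrap : Bool → Word → Word → Word
wrap false k x = x
wrap true  k x = encBits x ++ k

em-run : ∀ {w} m {f r i l d t b k x} → f r (headM i) d ≡ b →
  Run w (em m f) ⟨ r , i , l , d ∷ t , wrap m k (b ∷ x) ⟩ ⟨ r , i , l , d ∷ t , wrap m k x ⟩
em-run false e = out e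
em-run true  e = out refl ⨾ out e

bit : Bool → Test
bit b _ _ _ = b

-- Digits of m x + p are produced from those of x by carrying p: a digit d of x turns p into
-- (m d + p) / 2, rounded so that the emitted digit is 1 or 2.
carry : ℕ → Digit → Fin 15 → Fin 15
carry m d p = ((m * value d + toℕ p ∸ 1) / 2) mod 15

emitted : ℕ → Digit → Fin 15 → Bool
emitted m d p = does ((m * value d + toℕ p) % 2 ≟ 0)

CarrySpec : ℕ → Digit → Fin 15 → Set
CarrySpec m d p = m * value d + toℕ p ≡ 2 * toℕ (carry m d p) + value (digit (emitted m d p))

carrySpec? : ∀ m d p → Dec (CarrySpec m d p)
carrySpec? m d p = _ ≟ _

data Factor : ℕ → Set where
  ×1 : Factor 1
  ×8 : Factor 8

-- An exhaustive check of all carries. In particular the reduction mod 15 inside `carry` loses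
-- nothing.
carry-spec : ∀ {m} → Factor m → ∀ b p → CarrySpec m (digit b) p
carry-spec ×1 false = from-yes (Fin.all? (carrySpec? 1 one))
carry-spec ×1 true  = from-yes (Fin.all? (carrySpec? 1 two))
carry-spec ×8 false = from-yes (Fin.all? (carrySpec? 8 one))
carry-spec ×8 true  = from-yes (Fin.all? (carrySpec? 8 two))

carry-flush : ∀ (p : Fin 14) → CarrySpec 0 none (Fin.suc p)
carry-flush = from-yes (Fin.all? λ p → carrySpec? 0 none (Fin.suc p))

fromℕ-suc : ∀ n → B.suc (fromℕ n) ≡ fromℕ (suc n)
fromℕ-suc n = trans (cong B.suc (B.fromℕ≡fromℕ' n)) (sym (B.fromℕ≡fromℕ' (suc n)))

toℕ-consB : ∀ b x → B.toℕ (consB b x) ≡ 2 * B.toℕ x + value (digit b)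
toℕ-consB false x = +-comm 1 (2 * B.toℕ x)
toℕ-consB true  x = solve 1 (λ x → con 2 :* (con 1 :+ x) := con 2 :* x :+ con 2) refl (B.toℕ x)
  where open +-*-Solver

fromℕ-digit : ∀ n b → fromℕ (2 * n + value (digit b)) ≡ consB b (fromℕ n)
fromℕ-digit n b = B.toℕ-injective (trans (B.toℕ-fromℕ _)
  (trans (cong (λ z → 2 * z + value (digit b)) (sym (B.toℕ-fromℕ n))) (sym (toℕ-consB b (fromℕ n)))))

encB-consB : ∀ b x k → encB (consB b x) ++ k ≡ true ∷ b ∷ (encB x ++ k)
encB-consB false x k = refl
encB-consB true  x k = refl

-- Emitting the lowest digit of m x + p leaves a number of the same form, for the remaining digits
-- of x and the new carry. This is the invariant of both streaming loops.
linear-step : ∀ {m} → Factor m → ∀ b p x →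
  fromℕ (m * B.toℕ (consB b x) + toℕ p)
    ≡ consB (emitted m (digit b) p) (fromℕ (m * B.toℕ x + toℕ (carry m (digit b) p)))
linear-step {m} F b p x = trans (cong fromℕ (begin
  m * B.toℕ (consB b x) + toℕ p                  ≡⟨ cong (λ z → m * z + toℕ p) (toℕ-consB b x) ⟩
  m * (2 * B.toℕ x + δ) + toℕ p                  ≡⟨ solve 4 (λ m x d p → m :* (con 2 :* x :+ d) :+ p
                                                     := con 2 :* (m :* x) :+ (m :* d :+ p)) refl m (B.toℕ x) δ (toℕ p) ⟩
  2 * (m * B.toℕ x) + (m * δ + toℕ p)            ≡⟨ cong (2 * (m * B.toℕ x) +_) (carry-spec F b p) ⟩
  2 * (m * B.toℕ x) + (2 * p' + ε)               ≡⟨ solve 3 (λ y q e → con 2 :* y :+ (con 2 :* q :+ e)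
                                                     := con 2 :* (y :+ q) :+ e) refl (m * B.toℕ x) p' ε ⟩
  2 * (m * B.toℕ x + p') + ε                     ∎)) (fromℕ-digit (m * B.toℕ x + p') (emitted m (digit b) p))
  where
  open +-*-Solver
  open ≡-Reasoning
  δ  = value (digit b)
  p' = toℕ (carry m (digit b) p)
  ε  = value (digit (emitted m (digit b) p))

pending : Test
pending r _ _ = isSuc (acc r)
  where
  isSuc : Fin 15 → Bool
  isSuc Fin.zero    = false
  isSuc (Fin.suc _) = true

-- When the digits of x are exhausted, the carry itself is the part of the number still to be
-- written; its digits are peeled off until it is 0.
flushStep flush : Bool → Prog
flushStep m = em m (bit true) ⨾ em m (λ r _ _ → emitted 0 none (acc r)) ⨾
  upd (λ r _ d → record r { acc = carry 0 none (acc r) } , d)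
flush m = while pending (flushStep m) ⨾ em m (bit false)

digitAt isTwoAt : Track → Test
digitAt t _ _ d = isDigit (get t d)
isTwoAt t _ _ d = isTwo (get t d)

streamTapeStep : Bool → ℕ → Track → Prog
streamTapeStep m f t = em m (bit true) ⨾ em m (λ r _ d → emitted f (get t d) (acc r)) ⨾
  upd (λ r _ d → record r { acc = carry f (get t d) (acc r) } , d) ⨾ tapeRight

streamTape : Bool → ℕ → Fin 15 → Track → Prog
streamTape m f p t = setAcc p ⨾ (while (digitAt t) (streamTapeStep m f t) ⨾ home) ⨾ flush m

inputDigit : Maybe Bool → Digit
inputDigit (just b) = digit b
inputDigit nothing  = none

streamInputStep : Bool → ℕ → Prog
streamInputStep m f = fwd ⨾ em m (bit true) ⨾ em m (λ r i _ → emitted f (inputDigit i) (acc r)) ⨾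
  upd (λ r i d → record r { acc = carry f (inputDigit i) (acc r) } , d) ⨾ fwd

streamInput : Bool → ℕ → Fin 15 → Prog
streamInput m f p = setAcc p ⨾ while atTrue (streamInputStep m f) ⨾ fwd ⨾ flush m

resetSweep reset : Track → Prog
resetSweep t = while (digitAt t) (upd (λ r _ d → r , put t none d) ⨾ tapeRight)
reset t = resetSweep t ⨾ home

bump : Digit → Digit
bump none = one
bump _    = two

-- In bijective binary a carry turns the leading run of twos into ones; the next digit goes from one
-- to two, or a blank becomes the new top digit one.
incSweep inc : Track → Prog
incSweep t = while (isTwoAt t) (upd (λ r _ d → r , put t one d) ⨾ tapeRight) ⨾
  upd (λ r _ d → r , put t (bump (get t d)) d)
inc t = incSweep t ⨾ home

agreeAt : Track → Track → Test
agreeAt t t' _ _ d = sameDigit (get t d) (get t' d) ∧ isDigit (get t d)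

equalSweep equal : Track → Track → Prog
equalSweep t t' = while (agreeAt t t') tapeRight ⨾
  upd (λ r _ d → record r { flag = flagOf (sameDigit (get t d) (get t' d)) } , d)
equal t t' = equalSweep t t' ⨾ home

-- The number in the input has to be passed completely even after a difference, so the outcome is
-- carried along in the flag.
compareStep compareEnd compare : Prog
compareStep = fwd ⨾ ite (λ r i d → isFirst (flag r) ∧ sameDigit (inputDigit i) (get A d)) tapeRight (setFlag miss) ⨾ fwd
compareEnd = upd (λ r _ d → record r { flag = flagOf (isFirst (flag r) ∧ not (isDigit (get A d))) } , d)
compare = (setFlag first ⨾ while atTrue compareStep ⨾ compareEnd ⨾ fwd) ⨾ home

-- Numbers and bit strings have the same outer form, pairs of `true` and a bit closed by `false`, so
-- one loop skips both.
skipPairs skipNums skipEntry : Prog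
skipPairs = while atTrue (fwd ⨾ fwd) ⨾ fwd
skipNums  = while atTrue (fwd ⨾ skipPairs) ⨾ fwd
skipEntry = fwd ⨾ skipNums ⨾ skipPairs

copyPairs : Prog
copyPairs = while atTrue (em true (bit true) ⨾ fwd ⨾ em true (λ _ i _ → isTwo (inputDigit i)) ⨾ fwd) ⨾ em true (bit false)

-- These encodings take the rest of the word as an argument, so that the next bits of the unread
-- input appear by computation, without reassociating `_++_`.
numsK : List ℕ → Word → Word
numsK []       k = false ∷ k
numsK (n ∷ ns) k = true ∷ (encℕ n ++ numsK ns k)

entryK : Entry → Word → Word
entryK (ns , tb) k = numsK ns (encBits tb ++ k)

entriesK : List Entry → Word → Word
entriesK []       k = false ∷ k
entriesK (e ∷ es) k = true ∷ entryK e (entriesK es k)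

-- Correctness of the counter and input programs

module _ {w : Word} where

  expect : ∀ {p r i l t o o' s} → o ≡ o' → Run w p ⟨ r , i , l , t , o ⟩ s → Run w p ⟨ r , i , l , t , o' ⟩ s
  expect refl x = x

  flush-run : ∀ m p {f i l d t k x} →
    Run w (flush m) ⟨ reg p f , i , l , d ∷ t , wrap m k (encB (fromℕ (toℕ p)) ++ x) ⟩
                    ⟨ reg Fin.zero f , i , l , d ∷ t , wrap m k x ⟩
  flush-run m p {f} {i} {l} {d} {t} {k} {x} = loop (toℕ p) p ≤-refl ⨾ em-run m refl
    where
    smaller : ∀ q → toℕ (carry 0 none (Fin.suc q)) ≤ toℕ q
    smaller = from-yes (Fin.all? λ q → toℕ (carry 0 none (Fin.suc q)) ≤? toℕ q)
    loop : ∀ n p → toℕ p ≤ n → Run w (while pending (flushStep m))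
      ⟨ reg p f , i , l , d ∷ t , wrap m k (encB (fromℕ (toℕ p)) ++ x) ⟩
      ⟨ reg Fin.zero f , i , l , d ∷ t , wrap m k (false ∷ x) ⟩
    loop n       Fin.zero      _        = done refl
    loop (suc n) p@(Fin.suc q) (s≤s le) =
      expect (cong (wrap m k) (sym (trans
          (cong (λ y → encB y ++ x) (trans (cong fromℕ (carry-flush q)) (fromℕ-digit (toℕ (carry 0 none p)) (emitted 0 none p))))
          (encB-consB (emitted 0 none p) _ x))))
        (again refl (em-run m refl ⨾ em-run m refl ⨾ upd refl)
          (loop n (carry 0 none p) (≤-trans (smaller q) le)))

  -- The head may stop anywhere; only the contents of the whole tape matter, as home follows.
  data Sweep (p : Prog) (s : St) (r : Reg) (i : Word) (l t : List Cell) (o : Word) : Set where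
    sweep : ∀ {l' d t'} → Run w p s ⟨ r , i , l' , d ∷ t' , o ⟩ → l' ʳ++ (d ∷ t') ≡ l ʳ++ t → Sweep p s r i l t o

  sweep-home : ∀ {p s r i l t o} → Sweep p s r i l t o → Run w (p ⨾ home) s ⟨ r , i , [] , l ʳ++ t , o ⟩
  sweep-home (sweep {l'} {d} {t'} ra eq) = subst (λ z → Run w _ _ ⟨ _ , _ , [] , z , _ ⟩) eq (ra ⨾ home)

  streamTape-loop : ∀ {f} → Factor f → ∀ m t x k v {p fl i l K X} → get t v ≡ x → size x < k →
    ∃ λ p' → Sweep (while (digitAt t) (streamTapeStep m f t))
      ⟨ reg p fl , i , l , cells k v , wrap m K (encB (fromℕ (f * B.toℕ x + toℕ p)) ++ X) ⟩
      (reg p' fl) i l (cells k v) (wrap m K (encB (fromℕ (toℕ p')) ++ X))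
  streamTape-cons : ∀ {f} → Factor f → ∀ m t b x k v {p fl i l K X} → get t v ≡ consB b x → size x < k →
    ∃ λ p' → Sweep (while (digitAt t) (streamTapeStep m f t))
      ⟨ reg p fl , i , l , cells (suc k) v , wrap m K (encB (fromℕ (f * B.toℕ (consB b x) + toℕ p)) ++ X) ⟩
      (reg p' fl) i l (cells (suc k) v) (wrap m K (encB (fromℕ (toℕ p')) ++ X))
  streamTape-loop {f} F m t B.zero (suc k) v {p} {K = K} {X} e s = p , sweep
    (expect (cong (λ z → wrap m K (encB (fromℕ (z + toℕ p)) ++ X)) (sym (*-zeroʳ f)))
      (done (cong isDigit (trans (get-map hd t v) (cong hd e))))) refl
  streamTape-loop F m t 2[1+ x ] (suc k) v e (s≤s s) = streamTape-cons F m t true x k v e s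
  streamTape-loop F m t 1+[2 x ] (suc k) v e (s≤s s) = streamTape-cons F m t false x k v e s
  streamTape-cons {f} F m t b x k v {p} {fl} {K = K} {X} e s
    with streamTape-loop F m t x k (mapT tl v) {carry f (digit b) p} (trans (get-map tl t v) (trans (cong tl e) (tl-cons b))) s
    where
    tl-cons : ∀ b → tl (consB b x) ≡ x
    tl-cons false = refl
    tl-cons true  = refl
  ... | p' , sweep ra eq = p' , sweep
    (expect (cong (wrap m K) (sym (trans (cong (λ y → encB y ++ X) (linear-step F b p x))
                                         (encB-consB (emitted f (digit b) p) _ X))))
      (again (trans (cong isDigit de) (isDigit-digit b))
        (em-run m refl ⨾ em-run m (cong (λ δ → emitted f δ p) de) ⨾
         upd (cong (λ δ → reg (carry f δ p) fl , mapT hd v) de) ⨾ tapeRight) ra)) eq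
    where
    hd-cons : ∀ b → hd (consB b x) ≡ digit b
    hd-cons false = refl
    hd-cons true  = refl
    isDigit-digit : ∀ b → isDigit (digit b) ≡ true
    isDigit-digit false = refl
    isDigit-digit true  = refl
    de : get t (mapT hd v) ≡ digit b
    de = trans (get-map hd t v) (trans (cong hd e) (hd-cons b))

  streamTape-run : ∀ {f} → Factor f → ∀ m t p k v {r i K X} → size (get t v) < suc k →
    ∃ λ r' → Run w (streamTape m f p t)
      ⟨ r , i , [] , cells (suc k) v , wrap m K (encB (fromℕ (f * B.toℕ (get t v) + toℕ p)) ++ X) ⟩
      ⟨ r' , i , [] , cells (suc k) v , wrap m K X ⟩
  streamTape-run F m t p k v s with streamTape-loop F m t _ (suc k) v {p} refl s
  ... | p' , sw = _ , upd refl ⨾ sweep-home sw ⨾ flush-run m p'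

  streamInput-loop : ∀ {f} → Factor f → ∀ m x {p fl i l d t K X} →
    ∃ λ p' → Run w (while atTrue (streamInputStep m f))
      ⟨ reg p fl , encB x ++ i , l , d ∷ t , wrap m K (encB (fromℕ (f * B.toℕ x + toℕ p)) ++ X) ⟩
      ⟨ reg p' fl , false ∷ i , l , d ∷ t , wrap m K (encB (fromℕ (toℕ p')) ++ X) ⟩
  streamInput-cons : ∀ {f} → Factor f → ∀ m b x {p fl i l d t K X} →
    ∃ λ p' → Run w (while atTrue (streamInputStep m f))
      ⟨ reg p fl , true ∷ b ∷ (encB x ++ i) , l , d ∷ t , wrap m K (encB (fromℕ (f * B.toℕ (consB b x) + toℕ p)) ++ X) ⟩
      ⟨ reg p' fl , false ∷ i , l , d ∷ t , wrap m K (encB (fromℕ (toℕ p')) ++ X) ⟩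
  streamInput-loop {f} F m B.zero {p} {K = K} {X} = p ,
    expect (cong (λ z → wrap m K (encB (fromℕ (z + toℕ p)) ++ X)) (sym (*-zeroʳ f))) (done refl)
  streamInput-loop F m 2[1+ x ] = streamInput-cons F m true x
  streamInput-loop F m 1+[2 x ] = streamInput-cons F m false x
  streamInput-cons {f} F m b x {p} {K = K} {X} with streamInput-loop F m x {carry f (digit b) p}
  ... | p' , ra = p' ,
    expect (cong (wrap m K) (sym (trans (cong (λ y → encB y ++ X) (linear-step F b p x))
                                        (encB-consB (emitted f (digit b) p) _ X))))
      (again refl (fwd ⨾ em-run m refl ⨾ em-run m refl ⨾ upd refl ⨾ fwd) ra)

  streamInput-run : ∀ {f} → Factor f → ∀ m p x {r i l d t K X} →
    ∃ λ r' → Run w (streamInput m f p)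
      ⟨ r , encB x ++ i , l , d ∷ t , wrap m K (encB (fromℕ (f * B.toℕ x + toℕ p)) ++ X) ⟩
      ⟨ r' , i , l , d ∷ t , wrap m K X ⟩
  streamInput-run F m p x with streamInput-loop F m x {p}
  ... | p' , ra = _ , upd refl ⨾ ra ⨾ fwd ⨾ flush-run m p'

  reset-run : ∀ t k v {r i o} → size (get t v) < k →
    Run w (reset t) ⟨ r , i , [] , cells k v , o ⟩ ⟨ r , i , [] , cells k (put t B.zero v) , o ⟩
  reset-run t k v {r} {i} {o} s = sweep-home (loop _ k v refl s)
    where
    loop : ∀ x k v {l} → get t v ≡ x → size x < k →
      Sweep (resetSweep t) ⟨ r , i , l , cells k v , o ⟩ r i l (cells k (put t B.zero v)) o
    more : ∀ x x' k v {l} → get t v ≡ x → isDigit (hd x) ≡ true → tl x ≡ x' → size x' < k →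
      Sweep (resetSweep t) ⟨ r , i , l , cells (suc k) v , o ⟩ r i l (cells (suc k) (put t B.zero v)) o
    loop B.zero (suc k) v {l} e s = sweep (done (cong isDigit (trans (get-map hd t v) (cong hd e))))
      (cong (λ z → l ʳ++ cells (suc k) z) (sym (trans (cong (λ z → put t z v) (sym e)) (put-get t v))))
    loop x@(2[1+ x' ]) (suc k) v e (s≤s s) = more x x' k v e refl refl s
    loop x@(1+[2 x' ]) (suc k) v e (s≤s s) = more x x' k v e refl refl s
    more x x' k v {l} e dx tx s with loop x' k (mapT tl v) {put t none (mapT hd v) ∷ l} (trans (get-map tl t v) (trans (cong tl e) tx)) s
    ... | sweep ra eq = sweep
      (again (trans (cong isDigit (trans (get-map hd t v) (cong hd e))) dx) (upd refl ⨾ tapeRight) ra)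
      (trans eq (cong (l ʳ++_) (sym (cells-put k t B.zero v))))

  inc-run : ∀ t k v {r i o} → size (get t v) < k →
    Run w (inc t) ⟨ r , i , [] , cells k v , o ⟩ ⟨ r , i , [] , cells k (put t (B.suc (get t v)) v) , o ⟩
  inc-run t k v {r} {i} {o} s = sweep-home (go _ k v refl s)
    where
    go : ∀ x k v {l} → get t v ≡ x → size x < k →
      Sweep (incSweep t) ⟨ r , i , l , cells k v , o ⟩ r i l (cells k (put t (B.suc x) v)) o
    stop : ∀ x y k v {l} → get t v ≡ x → isTwo (hd x) ≡ false → bump (hd x) ≡ hd y → tl x ≡ tl y →
      Sweep (incSweep t) ⟨ r , i , l , cells (suc k) v , o ⟩ r i l (cells (suc k) (put t y v)) o
    go x@B.zero      (suc k) v e s = stop x _ k v e refl refl refl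
    go x@(1+[2 x' ]) (suc k) v e s = stop x _ k v e refl refl refl
    go 2[1+ x ] (suc k) v {l} e (s≤s s) with go x k (mapT tl v) {put t one (mapT hd v) ∷ l} (trans (get-map tl t v) (cong tl e)) s
    ... | sweep (rb ⨾ rc) eq = sweep
      (again (cong isTwo (trans (get-map hd t v) (cong hd e))) (upd refl ⨾ tapeRight) rb ⨾ rc)
      (trans eq (cong (l ʳ++_) (sym (cells-put k t _ v))))
    stop x y k v {l} e nt bp te = sweep
      (done (trans (cong isTwo de) nt) ⨾ upd (cong (λ δ → r , put t δ (mapT hd v)) (trans (cong bump de) bp)))
      (cong (l ʳ++_) (sym (trans (cells-put k t y v) (cong (λ z → put t (hd y) (mapT hd v) ∷ cells k z)
        (trans (cong (λ z → put t z (mapT tl v)) (sym (trans (get-map tl t v) (trans (cong tl e) te))))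
               (put-get t (mapT tl v)))))))
      where
      de = trans (get-map hd t v) (cong hd e)

  equal-run : ∀ t t' k v {r i o} → size (get t v) < k → size (get t' v) < k →
    Σ (Dec (get t v ≡ get t' v)) λ q →
      Run w (equal t t') ⟨ r , i , [] , cells k v , o ⟩ ⟨ record r { flag = flagOf (does q) } , i , [] , cells k v , o ⟩
  equal-run t t' k v {r} {i} {o} s s' = let q , sw = go _ _ k v refl refl s s' in q , sweep-home sw
    where
    Result : ℕᵇ → ℕᵇ → ℕ → Vals → List Cell → Set
    Result x y k v l = Σ (Dec (x ≡ y)) λ q →
      Sweep (equalSweep t t') ⟨ r , i , l , cells k v , o ⟩ (record r { flag = flagOf (does q) }) i l (cells k v) o
    dig : ∀ {x} t v → get t v ≡ x → get t (mapT hd v) ≡ hd x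
    dig t v e = trans (get-map hd t v) (cong hd e)
    rest : ∀ {x} t v → get t v ≡ x → get t (mapT tl v) ≡ tl x
    rest t v e = trans (get-map tl t v) (cong tl e)
    stop : ∀ {x y} k v {l} → get t v ≡ x → get t' v ≡ y → (q : Dec (x ≡ y)) →
      sameDigit (hd x) (hd y) ∧ isDigit (hd x) ≡ false → sameDigit (hd x) (hd y) ≡ does q → Result x y (suc k) v l
    stop k v e e' q s d = q , sweep
      (done (trans (cong₂ (λ a b → sameDigit a b ∧ isDigit a) (dig t v e) (dig t' v e')) s) ⨾
       upd (cong (λ b → record r { flag = flagOf b } , mapT hd v) (trans (cong₂ sameDigit (dig t v e) (dig t' v e')) d))) refl
    go : ∀ x y k v {l} → get t v ≡ x → get t' v ≡ y → size x < k → size y < k → Result x y k v l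
    go B.zero   B.zero   (suc k) v e e' s s' = stop k v e e' (yes refl) refl refl
    go B.zero   2[1+ y ] (suc k) v e e' s s' = stop k v e e' (no λ ()) refl refl
    go B.zero   1+[2 y ] (suc k) v e e' s s' = stop k v e e' (no λ ()) refl refl
    go 2[1+ x ] B.zero   (suc k) v e e' s s' = stop k v e e' (no λ ()) refl refl
    go 2[1+ x ] 1+[2 y ] (suc k) v e e' s s' = stop k v e e' (no λ ()) refl refl
    go 1+[2 x ] B.zero   (suc k) v e e' s s' = stop k v e e' (no λ ()) refl refl
    go 1+[2 x ] 2[1+ y ] (suc k) v e e' s s' = stop k v e e' (no λ ()) refl refl
    go 2[1+ x ] 2[1+ y ] (suc k) v {l} e e' (s≤s s) (s≤s s')
      with go x y k (mapT tl v) {mapT hd v ∷ l} (rest t v e) (rest t' v e') s s'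
    ... | q , sweep (ra ⨾ rb) eq = map′ (cong 2[1+_]) (λ { refl → refl }) q , sweep
      (again (cong₂ (λ a b → sameDigit a b ∧ isDigit a) (dig t v e) (dig t' v e')) tapeRight ra ⨾ rb) eq
    go 1+[2 x ] 1+[2 y ] (suc k) v {l} e e' (s≤s s) (s≤s s')
      with go x y k (mapT tl v) {mapT hd v ∷ l} (rest t v e) (rest t' v e') s s'
    ... | q , sweep (ra ⨾ rb) eq = map′ (cong 1+[2_]) (λ { refl → refl }) q , sweep
      (again (cong₂ (λ a b → sameDigit a b ∧ isDigit a) (dig t v e) (dig t' v e')) tapeRight ra ⨾ rb) eq

  skipNum-run : ∀ x {r i l d t o} → Run w skipPairs ⟨ r , encB x ++ i , l , d ∷ t , o ⟩ ⟨ r , i , l , d ∷ t , o ⟩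
  skipNum-run B.zero   = done refl ⨾ fwd
  skipNum-run 2[1+ x ] with skipNum-run x
  ... | ra ⨾ rb = again refl (fwd ⨾ fwd) ra ⨾ rb
  skipNum-run 1+[2 x ] with skipNum-run x
  ... | ra ⨾ rb = again refl (fwd ⨾ fwd) ra ⨾ rb

  skipBits-run : ∀ bs {r i l d t o} → Run w skipPairs ⟨ r , encBits bs ++ i , l , d ∷ t , o ⟩ ⟨ r , i , l , d ∷ t , o ⟩
  skipBits-run []       = done refl ⨾ fwd
  skipBits-run (b ∷ bs) with skipBits-run bs
  ... | ra ⨾ rb = again refl (fwd ⨾ fwd) ra ⨾ rb

  skipNums-run : ∀ ns {r i l d t o} → Run w skipNums ⟨ r , numsK ns i , l , d ∷ t , o ⟩ ⟨ r , i , l , d ∷ t , o ⟩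
  skipNums-run []       = done refl ⨾ fwd
  skipNums-run (n ∷ ns) with skipNums-run ns
  ... | ra ⨾ rb = again refl (fwd ⨾ skipNum-run (fromℕ n)) ra ⨾ rb

  skipEntry-run : ∀ e {r i l d t o} → Run w skipEntry ⟨ r , true ∷ entryK e i , l , d ∷ t , o ⟩ ⟨ r , i , l , d ∷ t , o ⟩
  skipEntry-run (ns , tb) = fwd ⨾ skipNums-run ns ⨾ skipBits-run tb

  copyPairs-run : ∀ bs {r i l d t k x} →
    Run w copyPairs ⟨ r , encBits bs ++ i , l , d ∷ t , wrap true k (encBits bs ++ x) ⟩ ⟨ r , false ∷ i , l , d ∷ t , wrap true k x ⟩
  copyPairs-run []       {k = k} {x} = done refl ⨾ em-run true {k = k} {x} refl
  copyPairs-run (b ∷ bs) {k = k} {x} with copyPairs-run bs {k = k} {x}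
  ... | ra ⨾ rb = again refl (em-run true {k = k} {x = b ∷ (encBits bs ++ x)} refl ⨾ fwd ⨾ em-run true {k = k} {x = encBits bs ++ x} (isTwo-digit b) ⨾ fwd) ra ⨾ rb
    where
    isTwo-digit : ∀ b → isTwo (digit b) ≡ b
    isTwo-digit false = refl
    isTwo-digit true  = refl

  compare-missed : ∀ x {p i l d t o} →
    Run w (while atTrue compareStep ⨾ compareEnd ⨾ fwd) ⟨ reg p miss , encB x ++ i , l , d ∷ t , o ⟩ ⟨ reg p miss , i , l , d ∷ t , o ⟩
  compare-missed B.zero   = done refl ⨾ upd refl ⨾ fwd
  compare-missed 2[1+ x ] with compare-missed x
  ... | ra ⨾ rb = again refl (fwd ⨾ iteᶠ refl (upd refl) ⨾ fwd) ra ⨾ rb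
  compare-missed 1+[2 x ] with compare-missed x
  ... | ra ⨾ rb = again refl (fwd ⨾ iteᶠ refl (upd refl) ⨾ fwd) ra ⨾ rb

  compare-run : ∀ x k v {p f i o} → size (get A v) < k →
    Σ (Dec (x ≡ get A v)) λ q →
      Run w compare ⟨ reg p f , encB x ++ i , [] , cells k v , o ⟩ ⟨ reg p (flagOf (does q)) , i , [] , cells k v , o ⟩
  compare-run x (suc k) v {p} {f} {i} {o} s with go x (suc k) v s
    where
    Result : ℕᵇ → ℕ → Vals → List Cell → Set
    Result x k v l = Σ (Dec (x ≡ get A v)) λ q →
      Sweep (while atTrue compareStep ⨾ compareEnd ⨾ fwd) ⟨ reg p first , encB x ++ i , l , cells k v , o ⟩ (reg p (flagOf (does q))) i l (cells k v) o
    differ : ∀ b x k v {l} → (∀ {y} → get A v ≡ y → consB b x ≢ y) → sameDigit (digit b) (hd (get A v)) ≡ false → Result (consB b x) (suc k) v l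
    differ b x k v ne sd with compare-missed x
    ... | ra ⨾ rb = no (ne refl) , sweep
      (expectIn b (again refl (fwd ⨾ iteᶠ sd (upd refl) ⨾ fwd) ra ⨾ rb)) refl
      where
      expectIn : ∀ b {p r l t o s} → Run w p ⟨ r , true ∷ b ∷ (encB x ++ i) , l , t , o ⟩ s → Run w p ⟨ r , encB (consB b x) ++ i , l , t , o ⟩ s
      expectIn false ra = ra
      expectIn true  ra = ra
    go : ∀ x k v {l} → size (get A v) < k → Result x k v l
    go B.zero (suc k) v@(tri B.zero _ _)     s = yes refl , sweep (done refl ⨾ upd refl ⨾ fwd) refl
    go B.zero (suc k) v@(tri 2[1+ _ ] _ _)   s = no (λ ()) , sweep (done refl ⨾ upd refl ⨾ fwd) refl
    go B.zero (suc k) v@(tri 1+[2 _ ] _ _)   s = no (λ ()) , sweep (done refl ⨾ upd refl ⨾ fwd) refl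
    go 2[1+ x ] (suc k) v@(tri B.zero _ _)   s = differ true x k v (λ { refl () }) refl
    go 2[1+ x ] (suc k) v@(tri 1+[2 _ ] _ _) s = differ true x k v (λ { refl () }) refl
    go 1+[2 x ] (suc k) v@(tri B.zero _ _)   s = differ false x k v (λ { refl () }) refl
    go 1+[2 x ] (suc k) v@(tri 2[1+ _ ] _ _) s = differ false x k v (λ { refl () }) refl
    go 2[1+ x ] (suc (suc k)) v@(tri 2[1+ _ ] _ _) {l} (s≤s s) with go x (suc k) (mapT tl v) {mapT hd v ∷ l} s
    ... | q , sweep (ra ⨾ rb) eq = map′ (cong 2[1+_]) (λ { refl → refl }) q ,
      sweep (again refl (fwd ⨾ iteᵗ refl tapeRight ⨾ fwd) ra ⨾ rb) eq
    go 1+[2 x ] (suc (suc k)) v@(tri 1+[2 _ ] _ _) {l} (s≤s s) with go x (suc k) (mapT tl v) {mapT hd v ∷ l} s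
    ... | q , sweep (ra ⨾ rb) eq = map′ (cong 1+[2_]) (λ { refl → refl }) q ,
      sweep (again refl (fwd ⨾ iteᵗ refl tapeRight ⨾ fwd) ra ⨾ rb) eq
  ... | q , sweep ra eq = q , sweep-home {l = []} (sweep (upd refl ⨾ ra) eq)

-- The transducer

emitWord : Bool → Word → Prog
emitWord m []       = upd λ r _ d → r , d
emitWord m (b ∷ bs) = em m (bit b) ⨾ emitWord m bs

missed : Test
missed r _ _ = isMiss (flag r)

seek : Track → Prog
seek t = rewind ⨾ reset C ⨾ equal C t ⨾ while missed (skipEntry ⨾ inc C ⨾ equal C t)

tapeNumber : Track → Fin 15 → Prog
tapeNumber t j = streamTape true 8 j t

-- The first two moves pass the bit announcing the entry and the bit announcing its first
-- in-neighbour.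
item₀ item₁ : Track → Fin 15 → Prog
item₀ t j = seek t ⨾ fwd ⨾ fwd ⨾ streamInput true 8 j
item₁ t j = seek t ⨾ fwd ⨾ fwd ⨾ skipPairs ⨾ fwd ⨾ streamInput true 8 j

copyTable : Track → Prog
copyTable t = seek t ⨾ fwd ⨾ skipNums ⨾ copyPairs

constTable : Kind → Prog
constTable K = emitWord true (encBits (table K))

-- The constant bits announce the entry and its two in-neighbours and close their list; every entry
-- of the simulating network has exactly two.
entryProg : Prog → Prog → Prog → Prog
entryProg p q tb =
  emitWord true (true ∷ true ∷ []) ⨾ p ⨾ emitWord true (true ∷ []) ⨾ q ⨾ emitWord true (false ∷ []) ⨾ tb

ownProg : Fin 15 → Fin 15 → Kind → Track → Prog
ownProg j j' K t = entryProg (tapeNumber t j) (tapeNumber t j') (constTable K)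

ifBinary : Track → Prog → Prog → Prog
ifBinary t p q = seek t ⨾ fwd ⨾ fwd ⨾ skipPairs ⨾ ite atTrue p q

forwardProg₀ forwardProg₁ : Track → Prog
forwardProg₀ t = ifBinary t (entryProg (item₀ t 0F) (item₁ t 0F) (copyTable t))
                            (entryProg (item₀ t 0F) (item₀ t 1F) (constTable OR))
forwardProg₁ t = ifBinary t (entryProg (item₀ t 1F) (item₁ t 1F) (copyTable t)) (ownProg 2F 3F AND t)

hitFirst ended : Test
hitFirst r _ _ = isFirst (flag r)
ended    r _ _ = isEnd (flag r)

-- On a hit U stays in place and the flag tells at which position of the entry A occurs: slot 7 of a
-- node with a single consumer depends on that position.
probe : Prog
probe = seek U ⨾ ite atTrue
  (fwd ⨾ fwd ⨾ compare ⨾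
    ite hitFirst (setFlag first) (ite atTrue (fwd ⨾ compare ⨾ ite hitFirst (setFlag second) (inc U)) (inc U)))
  (setFlag end)

findNext : Prog
findNext = setFlag miss ⨾ while missed probe

blockProg : Prog
blockProg =
  ownProg 4F 5F OR A ⨾ ownProg 4F 5F OR A ⨾ ownProg 6F 7F AND A ⨾ ownProg 6F 7F AND A ⨾
  forwardProg₀ A ⨾ forwardProg₁ A ⨾
  reset U ⨾ findNext ⨾ ownProg 2F 3F AND U ⨾
  inc U ⨾ findNext ⨾
  -- If there is no second consumer, U has run past the last entry. The only consumer is found again
  -- from the start, which also restores the position of A in the flag.
  ite ended (reset U ⨾ findNext ⨾ ite hitFirst (forwardProg₀ U) (forwardProg₁ U)) (ownProg 2F 3F AND U)

forEach : Prog → Prog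
forEach p = reset A ⨾ seek A ⨾ while atTrue (p ⨾ inc A ⨾ seek A)

patProg : Bool → Prog
patProg b = emitWord false (true ∷ []) ⨾ streamTape false 1 0F A ⨾ emitWord false (false ∷ b ∷ [])

embProg : Prog
embProg = patProg true ⨾ patProg true ⨾ patProg false ⨾ patProg false ⨾
          patProg false ⨾ patProg false ⨾ patProg false ⨾ patProg false

mainProg : Prog
-- The first `false` closes the list of entries within the doubled output, the next one closes the
-- doubling itself.
mainProg = forEach blockProg ⨾ emitWord true (false ∷ []) ⨾ emitWord false (false ∷ encℕ 2) ⨾
           forEach embProg ⨾ emitWord false (false ∷ [])

chain : List (Word → Word) → Word → Word
chain fs X = foldr (λ f → f) X fs

-- The tracks that may be the target of `seek`: the counter C is overwritten by it.
data IsMain : Track → Set where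
  A : IsMain A
  U : IsMain U

drop-tabulate : ∀ {n} {X : Set} (f : Fin n → X) v → drop (toℕ v) (tabulate f) ≡ f v ∷ drop (suc (toℕ v)) (tabulate f)
drop-tabulate f Fin.zero    = refl
drop-tabulate f (Fin.suc v) = drop-tabulate (f ∘ Fin.suc) v

drop-all : ∀ {n} {X : Set} (f : Fin n → X) → drop n (tabulate f) ≡ []
drop-all {zero}  f = refl
drop-all {suc n} f = drop-all (f ∘ Fin.suc)

fromℕ-injective : ∀ {m n} → fromℕ m ≡ fromℕ n → m ≡ n
fromℕ-injective {m} {n} e = trans (sym (B.toℕ-fromℕ m)) (trans (cong B.toℕ e) (B.toℕ-fromℕ n))

-- Correctness of the transducer

module Macros {w₀ : Word} {n : ℕ} {H : Network Bool n} (dec : Decoding w₀ H) (k : ℕ)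
              (fit : ∀ {m} → m ≤ n → size (fromℕ m) < suc k) where

  open Decoding dec
  open Simulator W using (forward₀; forward₁; local; entryOf)

  w : Word
  w = entriesK (tabulate e) []

  entriesFrom : ℕ → Word
  entriesFrom m = entriesK (drop m (tabulate e)) []

  entriesFrom-cons : ∀ v → entriesFrom (toℕ v) ≡ true ∷ entryK (e v) (entriesFrom (suc (toℕ v)))
  entriesFrom-cons v = cong (λ es → entriesK es []) (drop-tabulate e v)

  vals : ℕ → ℕ → ℕ → Vals
  vals a u c = tri (fromℕ a) (fromℕ u) (fromℕ c)

  record Home : Set where
    constructor ⟪_,_,_,_,_,_⟫
    field
      r     : Reg
      i     : Word
      a u c : ℕ
      o     : Word

  st : Home → St
  st ⟪ r , i , a , u , c , o ⟫ = ⟨ r , i , [] , cells (suc k) (vals a u c) , o ⟩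

  record Runs (p : Prog) (s s' : Home) : Set where
    constructor runs
    field unruns : Run w p (st s) (st s')

  infixr 5 _⨾′_

  _⨾′_ : ∀ {p q s s' s''} → Runs p s s' → Runs q s' s'' → Runs (p ⨾ q) s s''
  runs ra ⨾′ runs rb = runs (ra ⨾ rb)

  head-cell : ℕ → ℕ → ℕ → Cell
  head-cell a u c = mapT hd (vals a u c)

  ite-true : ∀ {f p q r i a u c o s} → f r (headM i) (head-cell a u c) ≡ true →
    Runs p ⟪ r , i , a , u , c , o ⟫ s → Runs (ite f p q) ⟪ r , i , a , u , c , o ⟫ s
  ite-true e (runs ra) = runs (iteᵗ e ra)

  ite-false : ∀ {f p q r i a u c o s} → f r (headM i) (head-cell a u c) ≡ false →
    Runs q ⟪ r , i , a , u , c , o ⟫ s → Runs (ite f p q) ⟪ r , i , a , u , c , o ⟫ s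
  ite-false e (runs ra) = runs (iteᶠ e ra)

  while-again : ∀ {f p r i a u c o s s'} → f r (headM i) (head-cell a u c) ≡ true →
    Runs p ⟪ r , i , a , u , c , o ⟫ s → Runs (while f p) s s' → Runs (while f p) ⟪ r , i , a , u , c , o ⟫ s'
  while-again e (runs ra) (runs rb) = runs (again e ra rb)

  while-done : ∀ {f p r i a u c o} → f r (headM i) (head-cell a u c) ≡ false →
    Runs (while f p) ⟪ r , i , a , u , c , o ⟫ ⟪ r , i , a , u , c , o ⟫
  while-done e = runs (done e)

  forward : ∀ {r b i a u c o} → Runs fwd ⟪ r , b ∷ i , a , u , c , o ⟫ ⟪ r , i , a , u , c , o ⟫
  forward = runs fwd

  flagged : ∀ f {r i a u c o} → Runs (setFlag f) ⟪ r , i , a , u , c , o ⟫ ⟪ record r { flag = f } , i , a , u , c , o ⟫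
  flagged f = runs (upd refl)

  retape : ∀ {p s r i v v' o} → v ≡ v' →
    Run w p s ⟨ r , i , [] , cells (suc k) v , o ⟩ → Run w p s ⟨ r , i , [] , cells (suc k) v' , o ⟩
  retape refl ra = ra

  inc-A : ∀ {r i a u c o} → a ≤ n → Runs (inc A) ⟪ r , i , a , u , c , o ⟫ ⟪ r , i , suc a , u , c , o ⟫
  inc-A {a = a} {u} {c} le = runs (retape (cong (λ z → tri z (fromℕ u) (fromℕ c)) (fromℕ-suc a))
    (inc-run A (suc k) (vals a u c) (fit le)))

  inc-U : ∀ {r i a u c o} → u ≤ n → Runs (inc U) ⟪ r , i , a , u , c , o ⟫ ⟪ r , i , a , suc u , c , o ⟫
  inc-U {a = a} {u} {c} le = runs (retape (cong (λ z → tri (fromℕ a) z (fromℕ c)) (fromℕ-suc u))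
    (inc-run U (suc k) (vals a u c) (fit le)))

  inc-C : ∀ {r i a u c o} → c ≤ n → Runs (inc C) ⟪ r , i , a , u , c , o ⟫ ⟪ r , i , a , u , suc c , o ⟫
  inc-C {a = a} {u} {c} le = runs (retape (cong (tri (fromℕ a) (fromℕ u)) (fromℕ-suc c))
    (inc-run C (suc k) (vals a u c) (fit le)))

  reset-A : ∀ {r i a u c o} → a ≤ n → Runs (reset A) ⟪ r , i , a , u , c , o ⟫ ⟪ r , i , 0 , u , c , o ⟫
  reset-A {a = a} {u} {c} le = runs (reset-run A (suc k) (vals a u c) (fit le))

  reset-U : ∀ {r i a u c o} → u ≤ n → Runs (reset U) ⟪ r , i , a , u , c , o ⟫ ⟪ r , i , a , 0 , c , o ⟫
  reset-U {a = a} {u} {c} le = runs (reset-run U (suc k) (vals a u c) (fit le))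

  reset-C : ∀ {r i a u c o} → c ≤ n → Runs (reset C) ⟪ r , i , a , u , c , o ⟫ ⟪ r , i , a , u , 0 , o ⟫
  reset-C {a = a} {u} {c} le = runs (reset-run C (suc k) (vals a u c) (fit le))

  val : ∀ {t} → IsMain t → ℕ → ℕ → ℕ
  val A a u = a
  val U a u = u

  get-val : ∀ {t} (mt : IsMain t) {a u c} → get t (vals a u c) ≡ fromℕ (val mt a u)
  get-val A = refl
  get-val U = refl

  fit-val : ∀ {t} (mt : IsMain t) {a u c} → val mt a u ≤ n → size (get t (vals a u c)) < suc k
  fit-val mt {a} {u} {c} le = subst (λ x → size x < suc k) (sym (get-val mt {a} {u} {c})) (fit le)

  equal-C : ∀ {t} (mt : IsMain t) {r i a u c o} → c ≤ n → val mt a u ≤ n →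
    Σ (Dec (c ≡ val mt a u)) λ q →
      Runs (equal C t) ⟪ r , i , a , u , c , o ⟫ ⟪ record r { flag = flagOf (does q) } , i , a , u , c , o ⟫
  equal-C {t} mt {a = a} {u} {c} c≤ v≤ with equal-run C t (suc k) (vals a u c) (fit c≤) (fit-val mt {a} {u} {c} v≤)
  ... | yes e , ra = yes (fromℕ-injective (trans e (get-val mt {a} {u} {c}))) , runs ra
  ... | no ne , ra = no (λ e → ne (trans (cong fromℕ e) (sym (get-val mt {a} {u} {c})))) , runs ra

  Post : Set₁
  Post = Flag → Word → Set

  Any : Post
  Any _ _ = ⊤

  -- The seek counter and the register are scratch space of every macro.
  Result : Prog → Home → ℕ → ℕ → Word → Post → Set
  Result p s a' u' o' Q = ∃ λ r' → ∃ λ i' → ∃ λ c' →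
    c' ≤ n × Q (flag r') i' × Runs p s ⟪ r' , i' , a' , u' , c' , o' ⟫

  Does : Prog → ℕ → ℕ → Word → ℕ → ℕ → Word → Post → Set
  Does p a u o a' u' o' Q = ∀ r i c → c ≤ n → Result p ⟪ r , i , a , u , c , o ⟫ a' u' o' Q

  infixr 4 _▸_ _▹_

  _▸_ : ∀ {p q s a' u' o' Q a'' u'' o'' Q'} → Result p s a' u' o' Q →
    (∀ r i c → c ≤ n → Q (flag r) i → Result q ⟪ r , i , a' , u' , c , o' ⟫ a'' u'' o'' Q') →
    Result (p ⨾ q) s a'' u'' o'' Q'
  (r , i , c , c≤ , Q , ra) ▸ f with f r i c c≤ Q
  ... | r' , i' , c' , c'≤ , Q' , rb = r' , i' , c' , c'≤ , Q' , ra ⨾′ rb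

  _▹_ : ∀ {p q a u o a' u' o' Q a'' u'' o'' Q'} → Does p a u o a' u' o' Q → Does q a' u' o' a'' u'' o'' Q' →
    Does (p ⨾ q) a u o a'' u'' o'' Q'
  (d ▹ d') r i c c≤ = d r i c c≤ ▸ λ r i c c≤ _ → d' r i c c≤

  ret : ∀ {p s r' i' a' u' c' o'} {Q : Post} → c' ≤ n → Q (flag r') i' →
    Runs p s ⟪ r' , i' , a' , u' , c' , o' ⟫ → Result p s a' u' o' Q
  ret c≤ q ra = _ , _ , _ , c≤ , q , ra

  prefix : ∀ {p q s s' a u o Q} → Runs p s s' → Result q s' a u o Q → Result (p ⨾ q) s a u o Q
  prefix ra (r , i , c , c≤ , q , rb) = r , i , c , c≤ , q , ra ⨾′ rb

  -- Induction on the distance δ still to go. The first comparison is returned apart from the loop,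
  -- because each round ends with the comparison that decides about the next one.
  seek-loop : ∀ {t} (mt : IsMain t) {a u} δ j {r o} → j + δ ≡ val mt a u → val mt a u ≤ n →
    ∃ λ r' → ∃ λ s → Runs (equal C t) ⟪ r , entriesFrom j , a , u , j , o ⟫ s ×
      Runs (while missed (skipEntry ⨾ inc C ⨾ equal C t)) s ⟪ r' , entriesFrom (val mt a u) , a , u , val mt a u , o ⟫
  seek-loop mt {a} {u} δ j {r} {o} eq le
    with equal-C mt {r} {entriesFrom j} {a} {u} {j} {o} (≤-trans (≤-trans (m≤m+n j δ) (≤-reflexive eq)) le) le
  seek-loop mt δ j {r} {o} eq le | yes refl , ra = _ , _ , ra , while-done refl
  seek-loop mt zero j eq le | no ne , ra = contradiction (trans (sym (+-identityʳ j)) eq) ne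
  seek-loop {t} mt {a} {u} (suc δ) j {r} {o} eq le | no ne , ra
    with seek-loop mt {a} {u} δ (suc j) {record r { flag = miss }} {o} (trans (sym (+-suc j δ)) eq) le
  ... | r' , _ , rb , rc = r' , _ , ra ,
    while-again refl (skip ⨾′ inc-C (≤-trans (n≤1+n j) j<n) ⨾′ rb) rc
    where
    j<n : j < n
    j<n = ≤-trans (≤-trans (s≤s (m≤m+n j δ)) (≤-reflexive (trans (sym (+-suc j δ)) eq))) le
    skip : Runs skipEntry ⟪ record r { flag = miss } , entriesFrom j , a , u , j , o ⟫
                          ⟪ record r { flag = miss } , entriesFrom (suc j) , a , u , j , o ⟫
    skip = subst₂ (λ m i → Runs skipEntry ⟪ _ , i , a , u , j , o ⟫ ⟪ _ , entriesFrom (suc m) , a , u , j , o ⟫)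
      (toℕ-fromℕ< j<n) (trans (sym (entriesFrom-cons (Fin.fromℕ< j<n))) (cong entriesFrom (toℕ-fromℕ< j<n)))
      (runs (skipEntry-run (e (Fin.fromℕ< j<n))))

  seek-does : ∀ {t} (mt : IsMain t) {a u o} → val mt a u ≤ n →
    Does (seek t) a u o a u o (λ _ i → i ≡ entriesFrom (val mt a u))
  seek-does mt {a} {u} {o} le r i c c≤ with seek-loop mt {a} {u} (val mt a u) 0 {r} {o} refl le
  ... | r' , _ , ra , rb = ret le refl (runs rewind ⨾′ reset-C c≤ ⨾′ ra ⨾′ rb)

  -- The second in-neighbour, if any, is announced by the bit after the first number, so arity is
  -- visible without the table. For unary nodes the table disappears in z.
  data View (v : Fin n) : Word → Set where
    unary  : ∀ {z} → i₀ v ≡ i₁ v → View v (true ∷ true ∷ (encℕ (toℕ (i₀ v)) ++ false ∷ z))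
    binary : ∀ {z} → i₀ v ≢ i₁ v → View v (true ∷ true ∷ (encℕ (toℕ (i₀ v)) ++
               true ∷ (encℕ (toℕ (i₁ v)) ++ false ∷ (encBits (table (kind v)) ++ z))))

  view : ∀ v → View v (entriesFrom (toℕ v))
  view v with i₀ v ≟ᶠ i₁ v
  ... | yes eq = subst (View v) (sym (trans (entriesFrom-cons v)
    (cong (λ ns → true ∷ numsK ns (encBits (proj₂ (e v)) ++ entriesFrom (suc (toℕ v)))) (unary-e v eq)))) (unary eq)
  ... | no ne = subst (View v) (sym (trans (entriesFrom-cons v)
    (cong (λ en → true ∷ entryK en (entriesFrom (suc (toℕ v)))) (binary-e v ne)))) (binary ne)

  seek-view : ∀ {t} (mt : IsMain t) {a u o} v → val mt a u ≡ toℕ v → Does (seek t) a u o a u o (λ _ i → View v i)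
  seek-view mt v eq r i c c≤ with seek-does mt (subst (_≤ n) (sym eq) (<⇒≤ (toℕ<n v))) r i c c≤
  ... | r' , i' , c' , c'≤ , refl , ra = r' , i' , c' , c'≤ , subst (View v ∘ entriesFrom) (sym eq) (view v) , ra

  compare-A : ∀ m {r i a u c o} → a ≤ n → Σ (Dec (m ≡ a)) λ q →
    Runs compare ⟪ r , encℕ m ++ i , a , u , c , o ⟫ ⟪ record r { flag = flagOf (does q) } , i , a , u , c , o ⟫
  compare-A m {a = a} {u} {c} le with compare-run (fromℕ m) (suc k) (vals a u c) (fit le)
  ... | yes e , ra = yes (fromℕ-injective e) , runs ra
  ... | no ne , ra = no (ne ∘ cong fromℕ) , runs ra

  probe-hit : ∀ {a v o} → κ a ≡ γ v →
    Does probe (toℕ a) (toℕ v) o (toℕ a) (toℕ v) o (λ f _ → f ≡ choose (a ≟ᶠ i₀ v) first second)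
  probe-hit {a} {v} {o} h r i c c≤ = seek-view U v refl r i c c≤ ▸ λ r i c c≤ V → rest r c c≤ V
    where
    a≤ = <⇒≤ (toℕ<n a)
    rest : ∀ {i} r c → c ≤ n → View v i → Result _ ⟪ r , i , toℕ a , toℕ v , c , o ⟫ (toℕ a) (toℕ v) o
      (λ f _ → f ≡ choose (a ≟ᶠ i₀ v) first second)
    rest r c c≤ (unary eq) with compare-A (toℕ (i₀ v)) a≤
    ... | yes p , ra = ret c≤ (sym (choose-yes (a ≟ᶠ i₀ v) (toℕ-injective (sym p))))
      (ite-true refl (forward ⨾′ forward ⨾′ ra ⨾′ ite-true refl (flagged first)))
    ... | no ¬p , ra with inputs h
    ...   | inj₁ q = contradiction (cong toℕ (sym q)) ¬p
    ...   | inj₂ q = contradiction (cong toℕ (trans eq (sym q))) ¬p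
    rest r c c≤ (binary ne) with compare-A (toℕ (i₀ v)) a≤
    ... | yes p , ra = ret c≤ (sym (choose-yes (a ≟ᶠ i₀ v) (toℕ-injective (sym p))))
      (ite-true refl (forward ⨾′ forward ⨾′ ra ⨾′ ite-true refl (flagged first)))
    ... | no ¬p , ra with compare-A (toℕ (i₁ v)) a≤ | inputs h
    ...   | yes q , rb | _      = ret c≤ (sym (choose-no (a ≟ᶠ i₀ v) λ p → contradiction (cong toℕ (sym p)) ¬p))
      (ite-true refl (forward ⨾′ forward ⨾′ ra ⨾′ ite-false refl (ite-true refl
        (forward ⨾′ rb ⨾′ ite-true refl (flagged second)))))
    ...   | no ¬q , rb | inj₁ p = contradiction (cong toℕ (sym p)) ¬p
    ...   | no ¬q , rb | inj₂ q = contradiction (cong toℕ (sym q)) ¬q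

  probe-miss : ∀ {a v o} → κ a ≢ γ v →
    Does probe (toℕ a) (toℕ v) o (toℕ a) (suc (toℕ v)) o (λ f _ → f ≡ miss)
  probe-miss {a} {v} {o} ¬h r i c c≤ = seek-view U v refl r i c c≤ ▸ λ r i c c≤ V → rest r c c≤ V
    where
    a≤ = <⇒≤ (toℕ<n a)
    v≤ = <⇒≤ (toℕ<n v)
    absurd₀ : toℕ (i₀ v) ≢ toℕ a
    absurd₀ p = ¬h (trans (cong κ (sym (toℕ-injective p))) (κ-i₀ v))
    absurd₁ : toℕ (i₁ v) ≢ toℕ a
    absurd₁ p = ¬h (trans (cong κ (sym (toℕ-injective p))) (κ-i₁ v))
    rest : ∀ {i} r c → c ≤ n → View v i → Result _ ⟪ r , i , toℕ a , toℕ v , c , o ⟫ (toℕ a) (suc (toℕ v)) o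
      (λ f _ → f ≡ miss)
    rest r c c≤ (unary eq) with compare-A (toℕ (i₀ v)) a≤
    ... | yes p , ra = contradiction p absurd₀
    ... | no ¬p , ra = ret c≤ refl
      (ite-true refl (forward ⨾′ forward ⨾′ ra ⨾′ ite-false refl (ite-false refl (inc-U v≤))))
    rest r c c≤ (binary ne) with compare-A (toℕ (i₀ v)) a≤
    ... | yes p , ra = contradiction p absurd₀
    ... | no ¬p , ra with compare-A (toℕ (i₁ v)) a≤
    ...   | yes q , rb = contradiction q absurd₁
    ...   | no ¬q , rb = ret c≤ refl
      (ite-true refl (forward ⨾′ forward ⨾′ ra ⨾′ ite-false refl (ite-true refl
        (forward ⨾′ rb ⨾′ ite-false refl (inc-U v≤)))))

  entriesFrom-n : entriesFrom n ≡ false ∷ []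
  entriesFrom-n = cong (λ es → entriesK es []) (drop-all e)

  probe-end : ∀ {a o} → Does probe a n o a n o (λ f _ → f ≡ end)
  probe-end {a} r i c c≤ = seek-does U ≤-refl r i c c≤ ▸ λ { r _ c c≤ refl → ret c≤ refl
    (ite-false (cong (λ i → atTrue r (headM i) (head-cell a n c)) entriesFrom-n) (flagged end)) }

  data Stop (a : Fin n) : ℕ → Flag → Set where
    hit  : ∀ v → κ a ≡ γ v → Stop a (toℕ v) (choose (a ≟ᶠ i₀ v) first second)
    over : Stop a n end

  Misses : Fin n → ℕ → ℕ → Set
  Misses a u u' = ∀ v → u ≤ toℕ v → toℕ v < u' → κ a ≢ γ v

  findNext-does : ∀ {a u u' f o} → u ≤ u' → Stop a u' f → Misses a u u' →
    Does findNext (toℕ a) u o (toℕ a) u' o (λ f' _ → f' ≡ f)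
  findNext-does {a} {u} {u'} {f} {o} u≤ stop misses r i c c≤ =
    prefix (flagged miss) (loop (u' ∸ u) u (m+[n∸m]≡n u≤) (λ v le → misses v le) (record r { flag = miss }) i c c≤ refl)
    where
    stop≤ : ∀ {u f} → Stop a u f → u ≤ n
    stop≤ (hit v _) = <⇒≤ (toℕ<n v)
    stop≤ over      = ≤-refl
    not-miss : ∀ {u f} → Stop a u f → isMiss f ≡ false
    not-miss (hit v _) with a ≟ᶠ i₀ v
    ... | yes _ = refl
    ... | no _  = refl
    not-miss over = refl
    probe-stop : ∀ {u f} → Stop a u f → Does probe (toℕ a) u o (toℕ a) u o (λ f' _ → f' ≡ f)
    probe-stop (hit v h) = probe-hit h
    probe-stop over      = probe-end
    loop : ∀ δ u → u + δ ≡ u' → Misses a u u' → ∀ r i c → c ≤ n → flag r ≡ miss →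
      Result (while missed probe) ⟪ r , i , toℕ a , u , c , o ⟫ (toℕ a) u' o (λ f' _ → f' ≡ f)
    loop zero u eq ms r i c c≤ fl with trans (sym (+-identityʳ u)) eq
    ... | refl with probe-stop stop r i c c≤
    ... | r' , i' , c' , c'≤ , refl , ra = ret c'≤ refl (while-again (cong isMiss fl) ra (while-done (not-miss stop)))
    loop (suc δ) u eq ms r i c c≤ fl
      with ≤-trans (≤-trans (s≤s (m≤m+n u δ)) (≤-reflexive (trans (sym (+-suc u δ)) eq))) (stop≤ stop)
    ... | u<n with subst (λ z → Does probe (toℕ a) z o (toℕ a) (suc z) o (λ f' _ → f' ≡ miss)) (toℕ-fromℕ< u<n)
                     (probe-miss {a} {Fin.fromℕ< u<n} {o} (ms _ (≤-reflexive (sym (toℕ-fromℕ< u<n)))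
                       (subst (_< u') (sym (toℕ-fromℕ< u<n)) (≤-trans (s≤s (m≤m+n u δ)) (≤-reflexive (trans (sym (+-suc u δ)) eq)))))) r i c c≤
    ... | r₁ , i₁ , c₁ , c₁≤ , fl₁ , ra
        with loop δ (suc u) (trans (sym (+-suc u δ)) eq) (λ v le → ms v (≤-trans (n≤1+n u) le)) r₁ i₁ c₁ c₁≤ fl₁
    ... | r₂ , i₂ , c₂ , c₂≤ , q , rb = r₂ , i₂ , c₂ , c₂≤ , q , while-again (cong isMiss fl) ra rb

  -- `o m` is the output still due when A has the value m. The final U is existential because each
  -- block leaves U where its search stopped.
  forEach-does : ∀ {p} (o : ℕ → Word) →
    (∀ v u → u ≤ n → ∃ λ u' → u' ≤ n × Does p (toℕ v) u (o (toℕ v)) (toℕ v) u' (o (suc (toℕ v))) Any) →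
    ∀ {a u} → a ≤ n → u ≤ n → ∃ λ u' → u' ≤ n × Does (forEach p) a u (o 0) n u' (o n) Any
  forEach-does {p} o body a≤ u≤ with loop n 0 _ refl u≤
    where
    loop : ∀ δ m u → m + δ ≡ n → u ≤ n → ∃ λ u' → u' ≤ n × (∀ r c → c ≤ n →
      Result (while atTrue (p ⨾ inc A ⨾ seek A)) ⟪ r , entriesFrom m , m , u , c , o m ⟫ n u' (o n) Any)
    loop zero m u eq u≤ with trans (sym (+-identityʳ m)) eq
    ... | refl = u , u≤ , λ r c c≤ →
      ret c≤ tt (while-done (cong (λ i → atTrue r (headM i) (head-cell n u c)) entriesFrom-n))
    loop (suc δ) m u eq u≤ with ≤-trans (s≤s (m≤m+n m δ)) (≤-reflexive (trans (sym (+-suc m δ)) eq))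
    ... | m<n with subst (λ z → ∃ λ u' → u' ≤ n × Does p z u (o z) z u' (o (suc z)) Any) (toℕ-fromℕ< m<n) (body (Fin.fromℕ< m<n) u u≤)
    ... | u₁ , u₁≤ , once with loop δ (suc m) u₁ (trans (sym (+-suc m δ)) eq) u₁≤
    ... | u₂ , u₂≤ , more = u₂ , u₂≤ , λ r c c≤ →
      let r₁ , i₁ , c₁ , c₁≤ , _ , ra = once r (entriesFrom m) c c≤
          r₂ , i₂ , c₂ , c₂≤ , i₂≡ , rb = seek-does A m<n r₁ i₁ c₁ c₁≤
          r₃ , i₃ , c₃ , c₃≤ , _ , rc = more r₂ c₂ c₂≤
      in ret c₃≤ tt (while-again (at-true r c u)
           (ra ⨾′ inc-A (<⇒≤ m<n) ⨾′
             subst (λ i → Runs (seek A) ⟪ r₁ , i₁ , suc m , u₁ , c₁ , o (suc m) ⟫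
                                        ⟪ r₂ , i , suc m , u₁ , c₂ , o (suc m) ⟫) i₂≡ rb) rc)
      where
      at-true : ∀ r c u → atTrue r (headM (entriesFrom m)) (head-cell m u c) ≡ true
      at-true r c u = cong (λ i → atTrue r (headM i) (head-cell m u c))
        (trans (cong entriesFrom (sym (toℕ-fromℕ< m<n))) (entriesFrom-cons (Fin.fromℕ< m<n)))
  ... | u' , u'≤ , go = u' , u'≤ , λ r i c c≤ →
    prefix (reset-A a≤) (seek-does A z≤n r i c c≤ ▸ λ { r _ c c≤ refl → go r c c≤ })

  emits : ∀ m bs {k} X {r i a u c} →
    Runs (emitWord m bs) ⟪ r , i , a , u , c , wrap m k (bs ++ X) ⟫ ⟪ r , i , a , u , c , wrap m k X ⟫
  emits m bs {k} X = runs (emitWord-run m bs {k} {X})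
    where
    emitWord-run : ∀ m bs {k x r i l d t} → Run w (emitWord m bs)
      ⟨ r , i , l , d ∷ t , wrap m k (bs ++ x) ⟩ ⟨ r , i , l , d ∷ t , wrap m k x ⟩
    emitWord-run m []       = upd refl
    emitWord-run m (b ∷ bs) {k} {x} = em-run m {k = k} {x = bs ++ x} refl ⨾ emitWord-run m bs {k} {x}

  tape-emits : ∀ {f t} → Factor f → ∀ m (mt : IsMain t) j {a u c r i K} X → val mt a u ≤ n →
    ∃ λ r' → Runs (streamTape m f j t)
      ⟪ r , i , a , u , c , wrap m K (encℕ (f * val mt a u + toℕ j) ++ X) ⟫ ⟪ r' , i , a , u , c , wrap m K X ⟫
  tape-emits {f} {t} F m mt j {a} {u} {c} {K = K} X le with streamTape-run F m t j k (vals a u c) {K = K} {X} (fit-val mt {a} {u} {c} le)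
  ... | r' , ra = r' , runs (expect (cong (λ z → wrap m K (encℕ (f * z + toℕ j) ++ X))
    (trans (cong B.toℕ (get-val mt {a} {u} {c})) (B.toℕ-fromℕ (val mt a u)))) ra)

  module Doubled (K : Word) where

    pend : Word → Word
    pend = wrap true K

    record Writes (p : Prog) (a u : ℕ) (y : Word) : Set where
      constructor writes
      field written : ∀ X → Does p a u (pend (y ++ X)) a u (pend X) Any

    record WritesEntry (p : Prog) (a u : ℕ) (en : Entry) : Set where
      constructor writesEntry
      field writtenEntry : ∀ X → Does p a u (pend (true ∷ entryK en X)) a u (pend X) Any

    open Writes
    open WritesEntry

    emits-writes : ∀ bs {a u} → Writes (emitWord true bs) a u bs
    emits-writes bs = writes λ X r i c c≤ → ret c≤ tt (emits true bs X)

    tapeNumber-writes : ∀ {t} (mt : IsMain t) j {a u} → val mt a u ≤ n →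
      Writes (tapeNumber t j) a u (encℕ (8 * val mt a u + toℕ j))
    tapeNumber-writes mt j le = writes λ X r i c c≤ → let _ , ra = tape-emits ×8 true mt j X le in ret c≤ tt ra

    input-emits : ∀ j x {r i a u c} X → ∃ λ r' → Runs (streamInput true 8 j)
      ⟪ r , encℕ x ++ i , a , u , c , pend (encℕ (8 * x + toℕ j) ++ X) ⟫ ⟪ r' , i , a , u , c , pend X ⟫
    input-emits j x X with streamInput-run ×8 true j (fromℕ x) {K = K} {X}
    ... | r' , ra = r' , runs (expect (cong (λ z → pend (encℕ (8 * z + toℕ j) ++ X)) (B.toℕ-fromℕ x)) ra)

    skips : ∀ x {r i a u c o} → Runs skipPairs ⟪ r , encℕ x ++ i , a , u , c , o ⟫ ⟪ r , i , a , u , c , o ⟫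
    skips x = runs (skipNum-run (fromℕ x))

    skipsAll : ∀ ns {r i a u c o} → Runs skipNums ⟪ r , numsK ns i , a , u , c , o ⟫ ⟪ r , i , a , u , c , o ⟫
    skipsAll ns = runs (skipNums-run ns)

    copies : ∀ bs X {r i a u c} →
      Runs copyPairs ⟪ r , encBits bs ++ i , a , u , c , pend (encBits bs ++ X) ⟫ ⟪ r , false ∷ i , a , u , c , pend X ⟫
    copies bs X = runs (copyPairs-run bs {k = K} {X})

    item₀-writes : ∀ {t} (mt : IsMain t) j {a u} v → val mt a u ≡ toℕ v →
      Writes (item₀ t j) a u (encℕ (8 * toℕ (i₀ v) + toℕ j))
    item₀-writes mt j {a} {u} v eq = writes λ X r i c c≤ → seek-view mt v eq r i c c≤ ▸ λ
      { r _ c c≤ (unary _)  → let _ , ra = input-emits j (toℕ (i₀ v)) X in ret c≤ tt (forward ⨾′ forward ⨾′ ra)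
      ; r _ c c≤ (binary _) → let _ , ra = input-emits j (toℕ (i₀ v)) X in ret c≤ tt (forward ⨾′ forward ⨾′ ra) }

    item₁-writes : ∀ {t} (mt : IsMain t) j {a u} v → val mt a u ≡ toℕ v → i₀ v ≢ i₁ v →
      Writes (item₁ t j) a u (encℕ (8 * toℕ (i₁ v) + toℕ j))
    item₁-writes mt j {a} {u} v eq ne = writes λ X r i c c≤ → seek-view mt v eq r i c c≤ ▸ λ
      { r _ c c≤ (unary eq) → contradiction eq ne
      ; r _ c c≤ (binary _) → let _ , ra = input-emits j (toℕ (i₁ v)) X in
          ret c≤ tt (forward ⨾′ forward ⨾′ skips (toℕ (i₀ v)) ⨾′ forward ⨾′ ra) }

    copyTable-writes : ∀ {t} (mt : IsMain t) {a u} v → val mt a u ≡ toℕ v → i₀ v ≢ i₁ v →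
      Writes (copyTable t) a u (encBits (table (kind v)))
    copyTable-writes mt {a} {u} v eq ne = writes λ X r i c c≤ → seek-view mt v eq r i c c≤ ▸ λ
      { r _ c c≤ (unary eq) → contradiction eq ne
      ; r _ c c≤ (binary _) → ret c≤ tt (forward ⨾′ skipsAll (toℕ (i₀ v) ∷ toℕ (i₁ v) ∷ []) ⨾′ copies (table (kind v)) X) }

    entry-writes : ∀ {p q tb a u x y ts} → Writes p a u (encℕ x) → Writes q a u (encℕ y) → Writes tb a u (encBits ts) →
      WritesEntry (entryProg p q tb) a u (x ∷ y ∷ [] , ts)
    entry-writes {x = x} {y} {ts} wp wq wt = writesEntry λ X →
      let Z = encBits ts ++ X
          Y = encℕ y ++ false ∷ Z
      in written (emits-writes (true ∷ true ∷ [])) (encℕ x ++ true ∷ Y) ▹ written wp (true ∷ Y) ▹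
         written (emits-writes (true ∷ [])) Y ▹ written wq (false ∷ Z) ▹
         written (emits-writes (false ∷ [])) Z ▹ written wt X

    own-writes : ∀ {t} (mt : IsMain t) j j' L {a u} → val mt a u ≤ n →
      WritesEntry (ownProg j j' L t) a u (8 * val mt a u + toℕ j ∷ 8 * val mt a u + toℕ j' ∷ [] , table L)
    own-writes mt j j' L le =
      entry-writes (tapeNumber-writes mt j le) (tapeNumber-writes mt j' le) (emits-writes (encBits (table L)))

    ifBinary-does : ∀ {t p q} (mt : IsMain t) {a u o o'} v → val mt a u ≡ toℕ v →
      (i₀ v ≢ i₁ v → Does p a u o a u o' Any) → (i₀ v ≡ i₁ v → Does q a u o a u o' Any) →
      Does (ifBinary t p q) a u o a u o' Any
    ifBinary-does mt {a} {u} v eq dp dq r i c c≤ = seek-view mt v eq r i c c≤ ▸ λ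
      { r _ c c≤ (unary e)  → let r' , i' , c' , c'≤ , _ , ra = dq e r _ c c≤ in
          ret c'≤ tt (forward ⨾′ forward ⨾′ skips (toℕ (i₀ v)) ⨾′ ite-false refl ra)
      ; r _ c c≤ (binary e) → let r' , i' , c' , c'≤ , _ , ra = dp e r _ c c≤ in
          ret c'≤ tt (forward ⨾′ forward ⨾′ skips (toℕ (i₀ v)) ⨾′ ite-true refl ra) }

    forward₀-writes : ∀ {t} (mt : IsMain t) {a u} v → val mt a u ≡ toℕ v →
      WritesEntry (forwardProg₀ t) a u (entryOf (forward₀ v))
    forward₀-writes mt {a} {u} v eq = writesEntry λ X → ifBinary-does mt v eq
      (λ ne → writtenEntry (subst (WritesEntry _ a u ∘ entryOf) (sym (choose-no (i₀ v ≟ᶠ i₁ v) λ p → contradiction p ne))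
        (entry-writes (item₀-writes mt 0F v eq) (item₁-writes mt 0F v eq ne) (copyTable-writes mt v eq ne))) X)
      (λ p → writtenEntry (subst (WritesEntry _ a u ∘ entryOf)
        (trans (cong (λ L → (i₀ v , 0F) , (i₀ v , 1F) , L) (sym (unary-OR v p))) (sym (choose-yes (i₀ v ≟ᶠ i₁ v) p)))
        (entry-writes (item₀-writes mt 0F v eq) (item₀-writes mt 1F v eq) (emits-writes (encBits (table OR))))) X)

    own-writes-at : ∀ {t} (mt : IsMain t) j j' L {a u} v → val mt a u ≡ toℕ v →
      WritesEntry (ownProg j j' L t) a u (8 * toℕ v + toℕ j ∷ 8 * toℕ v + toℕ j' ∷ [] , table L)
    own-writes-at {t} mt j j' L {a} {u} v eq =
      subst (λ m → WritesEntry (ownProg j j' L t) a u (8 * m + toℕ j ∷ 8 * m + toℕ j' ∷ [] , table L)) eq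
        (own-writes mt j j' L (subst (_≤ n) (sym eq) (<⇒≤ (toℕ<n v))))

    forward₁-writes : ∀ {t} (mt : IsMain t) {a u} v → val mt a u ≡ toℕ v →
      WritesEntry (forwardProg₁ t) a u (entryOf (forward₁ v))
    forward₁-writes mt {a} {u} v eq = writesEntry λ X → ifBinary-does mt v eq
      (λ ne → writtenEntry (subst (WritesEntry _ a u ∘ entryOf) (sym (choose-no (i₀ v ≟ᶠ i₁ v) λ p → contradiction p ne))
        (entry-writes (item₀-writes mt 1F v eq) (item₁-writes mt 1F v eq ne) (copyTable-writes mt v eq ne))) X)
      (λ p → writtenEntry (subst (WritesEntry _ a u ∘ entryOf) (sym (choose-yes (i₀ v ≟ᶠ i₁ v) p))
        (own-writes-at mt 2F 3F AND v eq)) X)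

    entryWord : Fin n → Fin 8 → Word → Word
    entryWord v j X = true ∷ entryK (entryOf (local (v , j))) X

    blockWord : Fin n → Word → Word
    blockWord v X = entryWord v 0F (entryWord v 1F (entryWord v 2F (entryWord v 3F
      (entryWord v 4F (entryWord v 5F (entryWord v 6F (entryWord v 7F X)))))))

    misses-before : ∀ a → Misses a 0 (toℕ (c₀ a))
    misses-before a v _ v< h with consumers h
    ... | inj₁ refl = <-irrefl refl v<
    ... | inj₂ refl = <⇒≱ v< (c₀≤c₁ a)

    -- The search resumes one past the first consumer. Sortedness of the consumers makes it stop at
    -- `c₁ v` if that differs from `c₀ v`, and otherwise at n.
    last-does : ∀ v → ∃ λ u' → u' ≤ n × (∀ X → Does (inc U ⨾ findNext ⨾
        ite ended (reset U ⨾ findNext ⨾ ite hitFirst (forwardProg₀ U) (forwardProg₁ U)) (ownProg 2F 3F AND U))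
      (toℕ v) (toℕ (c₀ v)) (pend (entryWord v 7F X)) (toℕ v) u' (pend X) Any)
    last-does v with c₀ v ≟ᶠ c₁ v
    ... | no ne = toℕ (c₁ v) , <⇒≤ (toℕ<n (c₁ v)) , λ X r i c c≤ → prefix (inc-U (<⇒≤ (toℕ<n (c₀ v))))
          (findNext-does (≤∧≢⇒< (c₀≤c₁ v) (ne ∘ toℕ-injective)) (hit (c₁ v) (sym (γ-c₁ v))) between r i c c≤ ▸
            λ r i c c≤ f≡ → let r' , i' , c' , c'≤ , _ , ra = writtenEntry (own-writes-at U 2F 3F AND (c₁ v) refl) X r i c c≤ in
              ret c'≤ tt (ite-false (trans (cong isEnd f≡) (not-end (v ≟ᶠ i₀ (c₁ v)))) ra))
      where
      not-end : ∀ {P : Set} (d : Dec P) → isEnd (choose d first second) ≡ false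
      not-end (yes _) = refl
      not-end (no _)  = refl
      between : Misses v (suc (toℕ (c₀ v))) (toℕ (c₁ v))
      between x lo hi h with consumers h
      ... | inj₁ refl = <-irrefl refl lo
      ... | inj₂ refl = <-irrefl refl hi
    ... | yes eq = toℕ (c₀ v) , <⇒≤ (toℕ<n (c₀ v)) , λ X r i c c≤ → prefix (inc-U (<⇒≤ (toℕ<n (c₀ v))))
          (findNext-does (toℕ<n (c₀ v)) over after r i c c≤ ▸
            λ r i c c≤ f≡ → let r' , i' , c' , c'≤ , _ , ra = copy X r i c c≤ in ret c'≤ tt (ite-true (cong isEnd f≡) ra))
      where
      after : Misses v (suc (toℕ (c₀ v))) n
      after x lo hi h with consumers h
      ... | inj₁ refl = <-irrefl refl lo
      ... | inj₂ refl = <-irrefl (cong toℕ eq) lo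
      -- Abstracting the decision lets the flag set by the search and the entry expected by slot 7
      -- reduce together.
      select : ∀ (d : Dec (v ≡ i₀ (c₀ v))) X r i c → c ≤ n → flag r ≡ choose d first second →
        Result (ite hitFirst (forwardProg₀ U) (forwardProg₁ U))
          ⟪ r , i , toℕ v , toℕ (c₀ v) , c , pend (true ∷ entryK (entryOf (choose d (forward₀ (c₀ v)) (forward₁ (c₀ v)))) X) ⟫
          (toℕ v) (toℕ (c₀ v)) (pend X) Any
      select (yes _) X r i c c≤ f≡ = let r' , i' , c' , c'≤ , _ , ra = writtenEntry (forward₀-writes U (c₀ v) refl) X r i c c≤ in
        ret c'≤ tt (ite-true (cong isFirst f≡) ra)
      select (no _)  X r i c c≤ f≡ = let r' , i' , c' , c'≤ , _ , ra = writtenEntry (forward₁-writes U (c₀ v) refl) X r i c c≤ in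
        ret c'≤ tt (ite-false (cong isFirst f≡) ra)
      copy : ∀ X → Does (reset U ⨾ findNext ⨾ ite hitFirst (forwardProg₀ U) (forwardProg₁ U)) (toℕ v) n _ (toℕ v) (toℕ (c₀ v)) (pend X) Any
      copy X r i c c≤ = prefix (reset-U ≤-refl)
        (findNext-does z≤n (hit (c₀ v) (sym (γ-c₀ v))) (misses-before v) r i c c≤ ▸
          λ r i c c≤ f≡ → select (v ≟ᶠ i₀ (c₀ v)) X r i c c≤ f≡)

    block-does : ∀ v u → u ≤ n → ∃ λ u' → u' ≤ n × (∀ X → Does blockProg (toℕ v) u (pend (blockWord v X)) (toℕ v) u' (pend X) Any)
    block-does v u u≤ with last-does v
    ... | u' , u'≤ , lst = u' , u'≤ , λ X →
      let X₇ = entryWord v 7F X ; X₆ = entryWord v 6F X₇ ; X₅ = entryWord v 5F X₆ ; X₄ = entryWord v 4F X₅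
          X₃ = entryWord v 3F X₄ ; X₂ = entryWord v 2F X₃ ; X₁ = entryWord v 1F X₂
      in writtenEntry (own-writes-at A 4F 5F OR v refl) X₁ ▹ writtenEntry (own-writes-at A 4F 5F OR v refl) X₂ ▹
         writtenEntry (own-writes-at A 6F 7F AND v refl) X₃ ▹ writtenEntry (own-writes-at A 6F 7F AND v refl) X₄ ▹
         writtenEntry (forward₀-writes A v refl) X₅ ▹ writtenEntry (forward₁-writes A v refl) X₆ ▹
         (λ r i c c≤ → prefix (reset-U u≤)
           (findNext-does z≤n (hit (c₀ v) (sym (γ-c₀ v))) (misses-before v) r i c c≤ ▸ λ r i c c≤ _ →
             (writtenEntry (own-writes-at U 2F 3F AND (c₀ v) refl) X₇ ▹ lst X) r i c c≤))

  from : (Fin n → Word → Word) → Word → ℕ → Word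
  from g X m = chain (drop m (tabulate g)) X

  from-cons : ∀ g X v → from g X (toℕ v) ≡ g v (from g X (suc (toℕ v)))
  from-cons g X v = cong (λ fs → chain fs X) (drop-tabulate g v)

  from-n : ∀ g X → from g X n ≡ X
  from-n g X = cong (λ fs → chain fs X) (drop-all g)

  patWord : Fin n → Bool → Word → Word
  patWord v b X = true ∷ (encℕ (toℕ v) ++ false ∷ b ∷ X)

  embWord : Fin n → Word → Word
  embWord v X = patWord v true (patWord v true (patWord v false (patWord v false
    (patWord v false (patWord v false (patWord v false (patWord v false X)))))))

  pat-does : ∀ v b X {u} → Does (patProg b) (toℕ v) u (patWord v b X) (toℕ v) u X Any
  pat-does v b X {u} r i c c≤ =
    let r' , ra = tape-emits ×1 false A 0F {toℕ v} {u} {c} {r} {i} {[]} (false ∷ b ∷ X) (<⇒≤ (toℕ<n v)) in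
    ret c≤ tt (emits false (true ∷ []) {[]} (encℕ (toℕ v) ++ false ∷ b ∷ X) ⨾′
      subst (λ m → Runs (streamTape false 1 0F A) ⟪ r , i , toℕ v , u , c , encℕ m ++ false ∷ b ∷ X ⟫
                                                  ⟪ r' , i , toℕ v , u , c , false ∷ b ∷ X ⟫)
        (trans (+-identityʳ (1 * toℕ v)) (+-identityʳ (toℕ v))) ra ⨾′
      emits false (false ∷ b ∷ []) {[]} X)

  emb-does : ∀ v X {u} → Does embProg (toℕ v) u (embWord v X) (toℕ v) u X Any
  emb-does v X =
    let X₇ = patWord v false X ; X₆ = patWord v false X₇ ; X₅ = patWord v false X₆ ; X₄ = patWord v false X₅
        X₃ = patWord v false X₄ ; X₂ = patWord v false X₃ ; X₁ = patWord v true X₂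
    in pat-does v true X₁ ▹ pat-does v true X₂ ▹ pat-does v false X₃ ▹ pat-does v false X₄ ▹
       pat-does v false X₅ ▹ pat-does v false X₆ ▹ pat-does v false X₇ ▹ pat-does v false X

  embAll : Word
  embAll = from embWord (false ∷ []) 0

  outputWord : Word
  outputWord = Doubled.pend (encℕ 2 ++ embAll) (from (Doubled.blockWord (encℕ 2 ++ embAll)) (false ∷ []) 0)

  main-does : ∃ λ u → Does mainProg 0 0 outputWord n u [] Any
  main-does =
    let u₁ , u₁≤ , d₁ = forEach-does (λ m → pend (from blockWord (false ∷ []) m)) (λ v u u≤ →
          let u' , u'≤ , d = block-does v u u≤ in u' , u'≤ ,
            subst (λ z → Does blockProg (toℕ v) u (pend z) (toℕ v) u' (pend (from blockWord (false ∷ []) (suc (toℕ v)))) Any)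
              (sym (from-cons blockWord (false ∷ []) v)) (d (from blockWord (false ∷ []) (suc (toℕ v))))) z≤n z≤n
        u₂ , u₂≤ , d₂ = forEach-does (from embWord (false ∷ [])) (λ v u u≤ → u , u≤ ,
            subst (λ z → Does embProg (toℕ v) u z (toℕ v) u (from embWord (false ∷ []) (suc (toℕ v))) Any)
              (sym (from-cons embWord (false ∷ []) v)) (emb-does v (from embWord (false ∷ []) (suc (toℕ v))))) ≤-refl u₁≤
    in u₂ ,
       (subst (λ z → Does (forEach blockProg) 0 0 outputWord n u₁ (pend z) Any) (from-n blockWord (false ∷ [])) d₁ ▹
        (λ r i c c≤ → ret {Q = Any} c≤ tt (emits true (false ∷ []) {encℕ 2 ++ embAll} [])) ▹
        (λ r i c c≤ → ret {Q = Any} c≤ tt (emits false (false ∷ encℕ 2) {[]} embAll)) ▹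
        subst (λ z → Does (forEach embProg) n u₁ embAll n u₂ z Any) (from-n embWord (false ∷ [])) d₂ ▹
        (λ r i c c≤ → ret c≤ tt (emits false (false ∷ []) {[]} [])))
    where open Doubled (encℕ 2 ++ embAll)

-- Alphabet, output word and space bound of the machine

finite-Digit : Finite Digit
finite-Digit = finite-retract (finite-Fin 3)
  (λ { none → 0F ; one → 1F ; two → 2F }) (λ { 0F → none ; 1F → one ; 2F → two })
  (λ { none → refl ; one → refl ; two → refl })

finite-Flag : Finite Flag
finite-Flag = finite-retract (finite-Fin 4)
  (λ { miss → 0F ; first → 1F ; second → 2F ; end → 3F }) (λ { 0F → miss ; 1F → first ; 2F → second ; 3F → end })
  (λ { miss → refl ; first → refl ; second → refl ; end → refl })

finite-Reg : Finite Reg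
finite-Reg = finite-retract (finite-× (finite-Fin 15) finite-Flag)
  (λ { (reg p f) → p , f }) (λ { (p , f) → reg p f }) (λ _ → refl)

-- The order of the summands and digits matters: the blank `Fin.zero` has to decode to a cell in
-- which all three counters are empty.
finite-Symbol : Finite (Maybe Cell)
finite-Symbol = finite-retract (finite-⊎ (finite-× finite-Digit (finite-× finite-Digit finite-Digit)) finite-⊤)
  (λ { (just (tri a u c)) → inj₁ (a , u , c) ; nothing → inj₂ tt })
  (λ { (inj₁ (a , u , c)) → just (tri a u c) ; (inj₂ _) → nothing })
  (λ { (just _) → refl ; nothing → refl })

blankCell : Cell
blankCell = tri none none none

cells-zero : ∀ k → cells k (tri B.zero B.zero B.zero) ≡ replicate k blankCell
cells-zero zero    = refl
cells-zero (suc k) = cong (blankCell ∷_) (cells-zero k)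

encList-∷ : ∀ x xs X → encList (x ∷ xs) ++ X ≡ true ∷ (x ++ (encList xs ++ X))
encList-∷ x xs X = cong (true ∷_) (trans
  (cong (_++ X) (++-assoc x (concat (map (true ∷_) xs)) (false ∷ []))) (++-assoc x (encList xs) X))

chain-cong : ∀ {n} {g h : Fin n → Word → Word} → (∀ v Y → g v Y ≡ h v Y) → ∀ X → chain (tabulate g) X ≡ chain (tabulate h) X
chain-cong {zero}  e X = refl
chain-cong {suc n} {g} e X = trans (cong (g 0F) (chain-cong (e ∘ Fin.suc) X)) (e 0F _)

encList-chain : ∀ {n} (f : Fin n → Word) X →
  encList (tabulate f) ++ X ≡ chain (tabulate λ v Y → true ∷ (f v ++ Y)) (false ∷ X)
encList-chain {zero}  f X = refl
encList-chain {suc n} f X = trans (encList-∷ (f 0F) (tabulate (f ∘ Fin.suc)) X)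
  (cong (λ Z → true ∷ (f 0F ++ Z)) (encList-chain (f ∘ Fin.suc) X))

numsK-encList : ∀ ns X → encList (map encℕ ns) ++ X ≡ numsK ns X
numsK-encList []       X = refl
numsK-encList (m ∷ ns) X = trans (encList-∷ (encℕ m) (map encℕ ns) X) (cong (λ Z → true ∷ (encℕ m ++ Z)) (numsK-encList ns X))

entryK-encEntry : ∀ en X → encEntry en ++ X ≡ entryK en X
entryK-encEntry (ns , tb) X = trans (++-assoc (encList (map encℕ ns)) (encBits tb) X) (numsK-encList ns (encBits tb ++ X))

encRepr-chain : ∀ {n} (f : Fin n → Entry) → encRepr n f ≡ chain (tabulate λ v Y → true ∷ entryK (f v) Y) (false ∷ [])
encRepr-chain f = trans (sym (++-identityʳ _)) (trans (encList-chain (encEntry ∘ f) [])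
  (chain-cong (λ v Y → cong (true ∷_) (entryK-encEntry (f v) Y)) (false ∷ [])))

entriesK-chain : ∀ {n} (f : Fin n → Entry) X → chain (tabulate λ v Y → true ∷ entryK (f v) Y) (false ∷ X) ≡ entriesK (tabulate f) X
entriesK-chain {zero}  f X = refl
entriesK-chain {suc n} f X = cong (λ Z → true ∷ entryK (f 0F) Z) (entriesK-chain (f ∘ Fin.suc) X)

-- The wires are numbered 8v + j, so listing them by index lists the slots node by node, as the loop
-- over the nodes writes them.
chain-blocks : ∀ n (h : Fin (n * 8) → Word → Word) X → chain (tabulate h) X ≡
  chain (tabulate {n = n} λ v Y → let g = λ (j : Fin 8) → h (combine v j) in
    g 0F (g 1F (g 2F (g 3F (g 4F (g 5F (g 6F (g 7F Y)))))))) X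
chain-blocks zero    h X = refl
chain-blocks (suc n) h X = cong
  (λ Y → h 0F (h 1F (h 2F (h 3F (h 4F (h 5F (h 6F (h 7F Y))))))))
  (chain-blocks n (λ u → h (8 Fin.↑ʳ u)) X)

chain-8 : ∀ {n} (g : Fin n × Fin 8 → Word → Word) X → chain (tabulate (g ∘ Fin.remQuot {n} 8)) X ≡
  chain (tabulate λ v Y → g (v , 0F) (g (v , 1F) (g (v , 2F) (g (v , 3F)
    (g (v , 4F) (g (v , 5F) (g (v , 6F) (g (v , 7F) Y)))))))) X
chain-8 {n} g X = trans (chain-blocks n (g ∘ Fin.remQuot {n} 8) X) (chain-cong (λ v Y → at v 0F (at v 1F (at v 2F (at v 3F
    (at v 4F (at v 5F (at v 6F (at v 7F refl)))))))) X)
  where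
  at : ∀ v j {Y Z} → Y ≡ Z → g (Fin.remQuot {n} 8 (combine {n} {8} v j)) Y ≡ g (v , j) Z
  at v j = cong₂ g (remQuot-combine {n} {8} v j)

-- Each entry is announced by a bit. Hence n is bounded by the length of the input, and numbers up
-- to n fit on a tape of logarithmic length.
length-entriesK : ∀ es X → length es ≤ length (entriesK es X)
length-entriesK []              X = z≤n
length-entriesK ((ns , tb) ∷ es) X = s≤s (≤-trans (length-entriesK es X) (≤-trans (longer (encBits tb)) (nums ns)))
  where
  longer : ∀ (x : Word) {Y} → length Y ≤ length (x ++ Y)
  longer x {Y} = ≤-trans (m≤n+m (length Y) (length x)) (≤-reflexive (sym (length-++ x)))
  nums : ∀ ns {Y} → length Y ≤ length (numsK ns Y)
  nums []       = n≤1+n _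
  nums (m ∷ ns) = ≤-trans (nums ns) (≤-trans (longer (encℕ m)) (n≤1+n _))

-- The least number with s digits in bijective binary is 1...1, that is 2^s - 1.
2^size≤ : ∀ x → 2 ^ size x ≤ suc (B.toℕ x)
2^size≤ B.zero   = ≤-refl
2^size≤ 2[1+ x ] = ≤-trans (*-monoʳ-≤ 2 (2^size≤ x)) (n≤1+n _)
2^size≤ 1+[2 x ] = ≤-trans (*-monoʳ-≤ 2 (2^size≤ x)) (≤-reflexive (cong suc (+-suc (B.toℕ x) (B.toℕ x + 0))))

size-fromℕ : ∀ m → size (fromℕ m) ≤ ⌊log₂ suc m ⌋
size-fromℕ m = subst₂ _≤_ (⌊log₂[2^n]⌋≡n (size (fromℕ m))) (cong (λ z → ⌊log₂ suc z ⌋) (B.toℕ-fromℕ m))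
  (⌊log₂⌋-mono-≤ (2^size≤ (fromℕ m)))

module Translation {w : Word} {n : ℕ} {H : Network Bool n} (dec : Decoding w H) where
  open Decoding dec
  open Simulator W

  input≡ : w ≡ entriesK (tabulate e) []
  input≡ = trans w≡ (trans (encRepr-chain e) (entriesK-chain e []))

  logWidth : ℕ
  logWidth = ⌊log₂ suc (length w) ⌋

  fits : ∀ {m} → m ≤ n → size (fromℕ m) < suc logWidth
  fits {m} m≤n = s≤s (≤-trans (size-fromℕ m) (⌊log₂⌋-mono-≤ (s≤s (≤-trans m≤n (≤-trans
    (≤-reflexive (sym (length-tabulate e)))
    (≤-trans (length-entriesK (tabulate e) []) (≤-reflexive (cong length (sym input≡)))))))))

  open Macros dec logWidth fits hiding (w)

  encEmb≡ : encEmb embedding ≡ embAll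
  encEmb≡ = trans (sym (++-identityʳ (encEmb embedding))) (trans (encList-chain cell []) (trans
    (chain-cong (λ u Y → cong (true ∷_) (trans (++-assoc (block u) (slot (proj₂ (unnode u)) false ∷ slot (proj₂ (unnode u)) true ∷ []) Y)
      (cong (λ b → block u ++ b ∷ slot (proj₂ (unnode u)) true ∷ Y) (slot-false (proj₂ (unnode u)))))) (false ∷ []))
    (chain-8 {n} (λ p Y → true ∷ (encℕ (toℕ (proj₁ p)) ++ false ∷ slot (proj₂ p) true ∷ Y)) (false ∷ []))))
    where
    block cell : Fin (n * 8) → Word
    block u = encℕ (toℕ (proj₁ (unnode u)))
    cell u = block u ++ slot (proj₂ (unnode u)) false ∷ slot (proj₂ (unnode u)) true ∷ []
    slot-false : ∀ j → slot j false ≡ false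
    slot-false 0F = refl
    slot-false 1F = refl
    slot-false (Fin.suc (Fin.suc j)) = refl

  output≡ : encBits (encRepr (n * 8) entries) ++ encℕ 2 ++ encEmb embedding ≡ outputWord
  output≡ = cong₂ (λ x y → encBits x ++ encℕ 2 ++ y)
    (trans (encRepr-chain entries) (chain-8 {n} (λ p Y → true ∷ entryK (entryOf (local p)) Y) (false ∷ []))) encEmb≡

module Assembly (main : Prog) where
  -- There are 3·3·3 triples of digits and one mark, so 28 symbols, of which 27 are other than the
  -- blank.
  open Compile finite-Reg (reg 0F miss) 27
    (Finite.enc finite-Symbol) (Finite.dec finite-Symbol) (Finite.dec-enc finite-Symbol) main

  module _ {w : Word} {n : ℕ} {H : Network Bool n} (dec : Decoding w H) where
    open Decoding dec
    open Simulator W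
    open Translation dec
    open Macros dec logWidth fits hiding (w)

    computes-outputWord : (∃ λ u → Does main 0 0 outputWord n u [] Any) → ComputesInLogSpace machine 2 w outputWord
    computes-outputWord (u , d) = halting (d (reg 0F miss) (entriesK (tabulate e) []) 0 z≤n)
      where
      halting : Result main ⟪ reg 0F miss , entriesK (tabulate e) [] , 0 , 0 , 0 , outputWord ⟫ n u [] Any →
        ComputesInLogSpace machine 2 w outputWord
      halting (r , i , c , _ , _ , runs ra) = computes-log blankCell refl (subst₂
        (λ v ds → Run v main ⟨ reg 0F miss , v , [] , ds , outputWord ⟩
                             ⟨ r , i , [] , cells (suc logWidth) (vals n u c) , [] ⟩)
        (sym input≡) (cells-zero (suc logWidth)) ra)

    computes : (∃ λ u → Does main 0 0 outputWord n u [] Any) →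
      ComputesInLogSpace machine 2 w (encBits (encRepr (n * 8) entries) ++ encℕ 2 ++ encEmb embedding)
    computes d = subst (ComputesInLogSpace machine 2 w) (sym output≡) (computes-outputWord d)

    simulation : (∃ λ u → Does main 0 0 outputWord n u [] Any) →
      Σ Word λ wF → Σ (Network Bool (n * 8)) λ F → Σ (BlockEmb Bool Bool n (n * 8)) λ E →
        ComputesInLogSpace machine 2 w (encBits wF ++ encℕ 2 ++ encEmb E) × RepresentsΓ Gm2 wF (n * 8) F × SimulatesVia F H E 2
    simulation d = encRepr (n * 8) entries , F , embedding , computes d , (F-represents , F-gates) , simulates dynamics

  simulatesFamily : (∀ {w n H} (dec : Decoding w {n} H) → let open Translation dec in
      ∃ λ u → Macros.Does dec logWidth fits main 0 0 (Macros.outputWord dec logWidth fits) n u [] (Macros.Any dec logWidth fits)) →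
    SimulatesFamily Gm2 Gm (λ _ → 2) (λ n → n * 8)
  simulatesFamily does-main = machine , 2 , λ w n H rep → simulation (decode rep) (does-main (decode rep))

mainTheorem8 : Σ (ℕ → ℕ) λ T → Σ (ℕ → ℕ) λ S →
    IsConstant T × IsLinear S × SimulatesFamily Gm2 Gm T S
mainTheorem8 = (λ _ → 2) , (λ n → n * 8) , (2 , λ _ → refl) ,
  (8 , 0 , λ n → trans (*-comm n 8) (sym (+-identityʳ (8 * n)))) ,
  Assembly.simulatesFamily mainProg λ dec → Macros.main-does dec (Translation.logWidth dec) (Translation.fits dec)
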